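{- A minimal set $A\subset\mathbb{Z}^2$ is mortal if and only if its enclosing box $\operatorname{enc}(A)$ is dead.
   Context: $X$ is the graph with vertex set $\mathbb{Z}^2$ in which $(x,y)$ and $(x',y')$ are adjacent iff $|x-x'|+|y-y'|=1$. For $A\subset\mathbb{Z}^2$, $\partial A=\{u\in\mathbb{Z}^2\setminus A:\ u \text{ adjacent to some } v\in A\}$. A finite nonempty set $A$ is minimal if $|\partial A|\le|\partial C|$ for all $C$ with $|C|=|A|$. For integers $a,b,c,d$, $B(a,b,c,d)=\{(x,y): a\le y-x\le b,\ c\le y+x\le d\}$; a box is a nonempty set of this form; $\operatorname{enc}(A)$ is the smallest box containing $A$. The life expectancy of a minimal set $A$ is the supremum (in $\mathbb{N}\cup\{\infty\}$) of all $n$ such that there is a nested sequence $A=A_0\subset\dots\subset A_n$ of minimal sets with $|A_i|=|A|+i$. $A$ is mortal if its life expectancy is finite and dead if it is $0$. -}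

module Defs where

open import Data.Nat using (ℕ; _≤_; _<_; _+_)
open import Data.Integer as ℤ using (ℤ; ∣_∣) renaming (_+_ to _+ℤ_; _-_ to _-ℤ_; _≤_ to _≤ℤ_)
open import Data.Product using (Σ; ∃; _×_; _,_)
open import Data.List using (List; length)
open import Data.List.Membership.Propositional using (_∈_)
open import Data.List.Relation.Unary.Unique.Propositional using (Unique)
open import Relation.Binary.PropositionalEquality using (_≡_)
open import Relation.Nullary using (¬_)

Point : Set
Point = ℤ × ℤ

Subset : Set₁
Subset = Point → Set

_⊆_ : Subset → Subset → Set
A ⊆ B = ∀ p → A p → B p

Adj : Point → Point → Set
Adj (x , y) (x' , y') = ∣ x -ℤ x' ∣ + ∣ y -ℤ y' ∣ ≡ 1

∂ : Subset → Subset
∂ A u = ¬ A u × ∃ λ v → A v × Adj u v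

HasSize : Subset → ℕ → Set
HasSize A k = Σ (List Point) λ l →
  Unique l × (∀ p → (p ∈ l → A p) × (A p → p ∈ l)) × length l ≡ k

Minimal : Subset → Set₁
Minimal A = Σ ℕ λ k → HasSize A k × 1 ≤ k × Σ ℕ λ m → HasSize (∂ A) m ×
  (∀ (C : Subset) (m' : ℕ) → HasSize C k → HasSize (∂ C) m' → m ≤ m')

Chain : Subset → ℕ → Set₁
Chain A n = Σ ℕ λ k → HasSize A k × Σ (ℕ → Subset) λ S →
  S 0 ≡ A ×
  (∀ i → i < n → S i ⊆ S (Data.Nat.suc i)) ×
  (∀ i → i ≤ n → Minimal (S i) × HasSize (S i) (k + i))

Mortal : Subset → Set₁
Mortal A = Minimal A × Σ ℕ λ N → ∀ n → Chain A n → n ≤ N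

Dead : Subset → Set₁
Dead A = Minimal A × (∀ n → Chain A n → n ≡ 0)

Box : ℤ → ℤ → ℤ → ℤ → Subset
Box a b c d (x , y) = (a ≤ℤ (y -ℤ x) × (y -ℤ x) ≤ℤ b) × (c ≤ℤ (y +ℤ x) × (y +ℤ x) ≤ℤ d)

NonEmpty : Subset → Set
NonEmpty A = ∃ λ p → A p

IsEnc : Subset → ℤ → ℤ → ℤ → ℤ → Set
IsEnc A a b c d = NonEmpty (Box a b c d) × A ⊆ Box a b c d ×
  (∀ a' b' c' d' → A ⊆ Box a' b' c' d' → NonEmpty (Box a' b' c' d') → Box a b c d ⊆ Box a' b' c' d')

{-# OPTIONS --safe #-}
-- In the rotated coordinates u = y - x, v = y + x the neighbours of a point are its four diagonal
-- neighbours, so a set splits into two parity classes X and Y, and N(X) is X plus a 2 × 2 square.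
-- Counting runs gives |N(X)| ≥ |X| + p + q + 1, where p and q count the lines met by X, and hence
-- |∂A| = p_X + q_X + p_Y + q_Y + 2 + δ, where δ ≥ 0 measures gaps and points without neighbours.
-- A set with |∂A| = s + 2 therefore has |A| ≤ (s² + 4) / 8, and if it has more than
-- ((s - 1)² + 4) / 8 points (this is minimality) then δ = 0, so that its enclosing box has side
-- lengths P + Q = s.  Such a set can be filled up to its enclosing box point by point without
-- enlarging the boundary.  If the box has the largest possible size for its P + Q, it can be
-- extended on a suitable side, which again gives a box of the largest size, so the set is immortal.
-- Otherwise a chain can leave the box only after exceeding that largest size, but it runs out of
-- points of the box before.
module Submission where

open import Defs
open import Data.Bool using (Bool; true; false; not; if_then_else_)
import Data.Bool.Properties as Bool
open import Data.Bool.Properties using (not-involutive; not-¬)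
open import Data.Empty using (⊥; ⊥-elim)
open import Data.Integer as ℤ using (ℤ; +_; -[1+_]; 0ℤ; 1ℤ; -1ℤ; _+_; _-_; -_; _≤_; +≤+; ∣_∣)
import Data.Integer.Properties as ℤP
open import Data.Integer.Tactic.RingSolver using (solve-∀)
open import Data.List using (List; []; _∷_; _++_; map; filter; length; deduplicate; cartesianProduct; upTo)
open import Data.List.Membership.Propositional using (_∈_; _∉_)
open import Data.List.Membership.Propositional.Properties
open import Data.List.Properties using (length-map; length-++; map-∘; map-id; length-++-sucʳ; length-upTo)
open import Data.List.Relation.Binary.Subset.Propositional using () renaming (_⊆_ to _⊑_)
open import Data.List.Relation.Unary.All as All using ([]; _∷_)
open import Data.List.Relation.Unary.AllPairs using ([]; _∷_)
open import Data.List.Relation.Unary.Any using (here; there)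
open import Data.List.Relation.Unary.Unique.Propositional using (Unique)
import Data.List.Relation.Unary.Unique.Propositional.Properties as Uniq
open import Data.Nat as ℕ using (ℕ; zero; suc; z≤n; s≤s)
import Data.Nat.Properties as ℕP
import Data.Nat.Tactic.RingSolver as ℕR
open import Data.Product using (Σ; ∃; ∃₂; _×_; _,_; proj₁; proj₂; swap)
open import Data.Product.Properties using (≡-dec; ,-injectiveˡ; ,-injectiveʳ)
open import Data.Sum using (_⊎_; inj₁; inj₂; [_,_]′)
open import Function using (case_of_; _∘_; id)
open import Relation.Binary.Definitions using (DecidableEquality)
open import Relation.Binary.PropositionalEquality using (_≡_; _≢_; refl; sym; trans; cong; cong₂; subst; subst₂)
open import Relation.Nullary using (¬_; Dec; yes; no; contradiction; ¬?; _×-dec_)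
open import Relation.Unary using (Decidable)

-- Linear certificates and parity of integers

-- Minimality quantifies over all sets of one size, so it is replaced by arithmetic. Every nonempty
-- set obeys `Iso`, and `Good` says that one boundary point fewer would break `Iso`; hence good sets
-- are minimal. Conversely, growing a single point forever yields a good set of every positive size,
-- and comparison with it shows that minimal sets are good. The growth procedure thus serves twice:
-- for the optimum and for the immortal case.
--
-- The size bound has to combine two sources. Bounding each class by the product of its projections
-- is enough only while the two classes have nearly equal p + q. Otherwise the larger class is
-- limited by the neighbourhood of the smaller one, at the price of points without neighbours, which
-- are part of δ.
--
-- Filling a prescribed missing point of the box may enlarge the boundary. The search for a better
-- point moves from hole to hole in one direction, and each move relies on the absence of gaps that
-- δ = 0 provides.

≤⇒+ : ∀ {i j} → i ≤ j → ∃ λ n → j ≡ i + + n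
≤⇒+ {i} {j} i≤j with j - i in eq | ℤP.i≤j⇒0≤j-i i≤j
... | + n | _ = n , trans (sym (e i j)) (cong (λ k → i + k) eq)
  where
  e : ∀ i j → i + (j - i) ≡ j
  e = solve-∀

+-cancelˡ : ∀ a {i j} → a + i ≡ a + j → i ≡ j
+-cancelˡ a {i} {j} eq = trans (sym (e a i)) (trans (cong (λ k → - a + k) eq) (e a j))
  where
  e : ∀ a i → - a + (a + i) ≡ i
  e = solve-∀

-- Certificates for linear inequalities: the conclusion minus the hypotheses is a natural number.
le₀ : ∀ n {i j} → j ≡ i + + n → i ≤ j
le₀ n {i} refl = ℤP.i≤i+j i (+ n)

le₁ : ∀ n {a b i j} → a ≤ b → j + a ≡ i + b + + n → i ≤ j
le₁ n {a} {b} {i} {j} a≤b eq with ≤⇒+ a≤b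
... | m , refl = le₀ (m ℕ.+ n) (+-cancelˡ a (trans (ℤP.+-comm a j) (trans eq (e i a (+ m) (+ n)))))
  where
  e : ∀ i a m n → i + (a + m) + n ≡ a + (i + (m + n))
  e = solve-∀

le₂ : ∀ n {a b c d i j} → a ≤ b → c ≤ d → j + (a + c) ≡ i + (b + d) + + n → i ≤ j
le₂ n p q eq = le₁ n (ℤP.+-mono-≤ p q) eq

absurd₁ : ∀ n {a b} → a ≤ b → a ≡ b + + suc n → ⊥
absurd₁ n {a} {b} p eq with ≤⇒+ p
... | m , refl = case +-cancelˡ a (sym (trans (trans (ℤP.+-identityʳ a) eq) (ℤP.+-assoc a (+ m) (+ suc n)))) of λ e →
  ℕP.1+n≢0 (ℕP.m+n≡0⇒n≡0 m (ℤP.+-injective e))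

odd : ℕ → Bool
odd zero    = false
odd (suc n) = not (odd n)

par : ℤ → Bool
par (+ n)    = odd n
par -[1+ n ] = not (odd n)

par-1+ : ∀ i → par (1ℤ + i) ≡ not (par i)
par-1+ (+ n)          = refl
par-1+ -[1+ zero ]    = refl
par-1+ -[1+ suc n ]   = sym (not-involutive _)

par-neg : ∀ i → par (- i) ≡ par i
par-neg (+ zero)  = refl
par-neg (+ suc n) = refl
par-neg -[1+ n ]  = refl

IsUnit : ℤ → Set
IsUnit s = s ≡ 1ℤ ⊎ s ≡ -1ℤ

IsUnit-neg : ∀ {s} → IsUnit s → IsUnit (- s)
IsUnit-neg (inj₁ refl) = inj₂ refl
IsUnit-neg (inj₂ refl) = inj₁ refl

par-unit : ∀ i {s} → IsUnit s → par (i + s) ≡ not (par i)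
par-unit i (inj₁ refl) = trans (cong par (ℤP.+-comm i 1ℤ)) (par-1+ i)
par-unit i (inj₂ refl) = trans (sym (not-involutive _)) (cong not (trans (sym (par-1+ (i + -1ℤ))) (cong par (e i))))
  where
  e : ∀ i → 1ℤ + (i + -1ℤ) ≡ i
  e = solve-∀

par-±2 : ∀ i {s} → IsUnit s → par (i + (s + s)) ≡ par i
par-±2 i {s} us = trans (cong par (sym (ℤP.+-assoc i s s)))
  (trans (par-unit (i + s) us) (trans (cong not (par-unit i us)) (not-involutive _)))

par-double⁺ : ∀ i n → par (i + + (n ℕ.+ n)) ≡ par i
par-double⁺ i zero    = cong par (ℤP.+-identityʳ i)
par-double⁺ i (suc n) = trans (cong par (trans (cong (λ k → i + + suc k) (ℕP.+-suc n n)) (e i (+ (n ℕ.+ n)))))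
  (trans (par-±2 (i + + (n ℕ.+ n)) (inj₁ refl)) (par-double⁺ i n))
  where
  e : ∀ i m → i + (1ℤ + (1ℤ + m)) ≡ i + m + (1ℤ + 1ℤ)
  e = solve-∀

par-double : ∀ i h → par (i + (h + h)) ≡ par i
par-double i (+ n)    = par-double⁺ i n
par-double i -[1+ n ] = trans (sym (par-double⁺ (i + (-[1+ n ] + -[1+ n ])) (suc n))) (cong par (e i (+ suc n)))
  where
  e : ∀ i m → i + (- m - m) + (m + m) ≡ i
  e = solve-∀

odd-split : ∀ n → (∃ λ k → n ≡ k ℕ.+ k) ⊎ (∃ λ k → n ≡ suc (k ℕ.+ k))
odd-split zero = inj₁ (0 , refl)
odd-split (suc n) with odd-split n
... | inj₁ (k , refl) = inj₂ (k , refl)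
... | inj₂ (k , refl) = inj₁ (suc k , cong suc (sym (ℕP.+-suc k k)))

par-≤ : ∀ {i j} → par i ≡ par j → i ≤ j → ∃ λ k → j ≡ i + + (k ℕ.+ k)
par-≤ {i} {j} ij i≤j with ≤⇒+ i≤j
... | n , refl with odd-split n
... | inj₁ (k , refl) = k , refl
... | inj₂ (k , refl) = ⊥-elim (not-¬ refl (trans ij (trans (cong par (e i (+ (k ℕ.+ k))))
        (trans (par-unit (i + + (k ℕ.+ k)) (inj₁ refl)) (cong not (par-double⁺ i k))))))
  where
  e : ∀ i m → i + (1ℤ + m) ≡ i + m + 1ℤ
  e = solve-∀

par-diff : ∀ {i j} → par i ≡ par j → ∃ λ h → j ≡ i + (h + h)
par-diff {i} {j} ij with ℤP.≤-total i j
... | inj₁ i≤j with k , eq ← par-≤ ij i≤j = + k , eq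
... | inj₂ j≤i with k , refl ← par-≤ (sym ij) j≤i = - + k , e j (+ k)
  where
  e : ∀ j k → j ≡ j + (k + k) + (- k - k)
  e = solve-∀

par-step : ∀ {i j} → par i ≡ par j → i ≤ j → i ≢ j → i + + 2 ≤ j
par-step {i} {j} ij i≤j i≢j with par-≤ ij i≤j
... | zero  , refl = contradiction (sym (ℤP.+-identityʳ i)) i≢j
... | suc k , refl = le₀ (k ℕ.+ k) (trans (cong (λ m → i + + suc m) (ℕP.+-suc k k)) (e i (+ (k ℕ.+ k))))
  where
  e : ∀ i m → i + (+ 2 + m) ≡ i + + 2 + m
  e = solve-∀

-- Cardinalities and runs

Pt : Set
Pt = ℤ × ℤ

_≟_ : DecidableEquality Pt
_≟_ = ≡-dec ℤ._≟_ ℤ._≟_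

open import Data.List.Membership.DecPropositional _≟_ using (_∈?_)
open import Data.List.Relation.Unary.Unique.DecPropositional.Properties _≟_ using (deduplicate-!)

unique-≤ : ∀ {T : Set} {xs ys : List T} → Unique xs → xs ⊑ ys → length xs ℕ.≤ length ys
unique-≤ [] sub = z≤n
unique-≤ {xs = x ∷ xs} (x∉ ∷ u) sub with ∈-∃++ (sub (here refl))
... | as , bs , refl = subst (suc (length xs) ℕ.≤_) (sym (length-++-sucʳ as x bs)) (s≤s (unique-≤ u sub′))
  where
  sub′ : xs ⊑ as ++ bs
  sub′ {z} z∈ with ∈-++⁻ as (sub (there z∈))
  ... | inj₁ p         = ∈-++⁺ˡ p
  ... | inj₂ (there p) = ∈-++⁺ʳ as p
  ... | inj₂ (here refl) = contradiction refl (All.lookup x∉ z∈)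

-- Lists stand for finite sets: repetitions do not count, so unions can be written as `_++_` and
-- images as `map`.
card : List Pt → ℕ
card X = length (deduplicate _≟_ X)

card-≤ : ∀ {X Y} → X ⊑ Y → card X ℕ.≤ length Y
card-≤ {X} sub = unique-≤ (deduplicate-! X) (sub ∘ ∈-deduplicate⁻ _≟_ X)

≤-card : ∀ {X Y} → Unique X → X ⊑ Y → length X ℕ.≤ card Y
≤-card u sub = unique-≤ u (∈-deduplicate⁺ _≟_ ∘ sub)

card-mono : ∀ {X Y} → X ⊑ Y → card X ℕ.≤ card Y
card-mono {X} sub = ≤-card (deduplicate-! X) (sub ∘ ∈-deduplicate⁻ _≟_ X)

card-cong : ∀ {X Y} → X ⊑ Y → Y ⊑ X → card X ≡ card Y
card-cong p q = ℕP.≤-antisym (card-mono p) (card-mono q)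

card-pos : ∀ {X z} → z ∈ X → 1 ℕ.≤ card X
card-pos z∈ = ≤-card ([] ∷ []) λ { (here refl) → z∈ }

card-∷ : ∀ {X z} → z ∉ X → card (z ∷ X) ≡ suc (card X)
card-∷ {X} {z} z∉ = ℕP.≤-antisym
  (card-≤ {z ∷ X} {z ∷ deduplicate _≟_ X} λ { (here refl) → here refl ; (there p) → there (∈-deduplicate⁺ _≟_ p) })
  (≤-card (All.tabulate (λ { p refl → z∉ (∈-deduplicate⁻ _≟_ X p) }) ∷ deduplicate-! X)
    λ { (here refl) → here refl ; (there p) → there (∈-deduplicate⁻ _≟_ X p) })

card-mono-< : ∀ {X Y z} → X ⊑ Y → z ∈ Y → z ∉ X → card X ℕ.< card Y
card-mono-< {X} {Y} {z} sub z∈ z∉ = subst (ℕ._≤ card Y) (card-∷ z∉)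
  (card-mono λ { (here refl) → z∈ ; (there p) → sub p })

card-++-≤ : ∀ X Y → card (X ++ Y) ℕ.≤ card X ℕ.+ card Y
card-++-≤ X Y = ℕP.≤-trans (card-≤ λ p → [ ∈-++⁺ˡ ∘ ∈-deduplicate⁺ _≟_ , ∈-++⁺ʳ _ ∘ ∈-deduplicate⁺ _≟_ ]′ (∈-++⁻ X p))
  (ℕP.≤-reflexive (length-++ (deduplicate _≟_ X)))

card-++ : ∀ X Y → (∀ {z} → z ∈ X → z ∉ Y) → card (X ++ Y) ≡ card X ℕ.+ card Y
card-++ X Y disj = ℕP.≤-antisym (card-++-≤ X Y) (ℕP.≤-trans (ℕP.≤-reflexive (sym (length-++ (deduplicate _≟_ X))))
  (≤-card (Uniq.++⁺ (deduplicate-! X) (deduplicate-! Y)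
            λ (p , q) → disj (∈-deduplicate⁻ _≟_ X p) (∈-deduplicate⁻ _≟_ Y q))
    λ p → [ ∈-++⁺ˡ ∘ ∈-deduplicate⁻ _≟_ X , ∈-++⁺ʳ X ∘ ∈-deduplicate⁻ _≟_ Y ]′ (∈-++⁻ (deduplicate _≟_ X) p)))

card-map-≤ : ∀ f X → card (map f X) ℕ.≤ card X
card-map-≤ f X = ℕP.≤-trans (card-≤ sub) (ℕP.≤-reflexive (length-map f (deduplicate _≟_ X)))
  where
  sub : map f X ⊑ map f (deduplicate _≟_ X)
  sub p with ∈-map⁻ f p
  ... | x , x∈ , refl = ∈-map⁺ f (∈-deduplicate⁺ _≟_ x∈)

card-map : ∀ {f} → (∀ {x y} → f x ≡ f y → x ≡ y) → ∀ X → card (map f X) ≡ card X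
card-map {f} inj X = ℕP.≤-antisym (card-map-≤ f X)
  (ℕP.≤-trans (ℕP.≤-reflexive (sym (length-map f (deduplicate _≟_ X))))
    (≤-card (Uniq.map⁺ inj (deduplicate-! X)) sub))
  where
  sub : map f (deduplicate _≟_ X) ⊑ map f X
  sub p with ∈-map⁻ f p
  ... | x , x∈ , refl = ∈-map⁺ f (∈-deduplicate⁻ _≟_ X x∈)

-- Removing `y` does not change the image, because `x` still supplies the common value.
card-map-< : ∀ f {X x y} → x ∈ X → y ∈ X → x ≢ y → f x ≡ f y → card (map f X) ℕ.< card X
card-map-< f {X} {x} {y} x∈ y∈ x≢y eq = ℕP.≤-<-trans
  (ℕP.≤-trans (card-mono sub) (card-map-≤ f X∖y))
  (card-mono-< (proj₁ ∘ ∈-filter⁻ P? {xs = X}) y∈ λ p → proj₂ (∈-filter⁻ P? {xs = X} p) refl)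
  where
  P? : Decidable (_≢ y)
  P? z = ¬? (z ≟ y)
  X∖y : List Pt
  X∖y = filter P? X
  sub : map f X ⊑ map f X∖y
  sub p with ∈-map⁻ f p
  ... | z , z∈ , refl with z ≟ y
  ... | yes refl = subst (_∈ map f X∖y) eq (∈-map⁺ f (∈-filter⁺ P? x∈ x≢y))
  ... | no z≢y   = ∈-map⁺ f (∈-filter⁺ P? z∈ z≢y)

infixl 7 _∖_
_∖_ : List Pt → List Pt → List Pt
X ∖ Y = filter (λ z → ¬? (z ∈? Y)) X

∈-∖⁺ : ∀ {X Y z} → z ∈ X → z ∉ Y → z ∈ X ∖ Y
∈-∖⁺ {Y = Y} = ∈-filter⁺ (λ z → ¬? (z ∈? Y))

∈-∖⁻ : ∀ X Y {z} → z ∈ X ∖ Y → z ∈ X × z ∉ Y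
∈-∖⁻ X Y = ∈-filter⁻ (λ z → ¬? (z ∈? Y))

card-∪ : ∀ X Y → card (X ++ Y) ≡ card (X ∖ Y) ℕ.+ card Y
card-∪ X Y = trans (card-cong sub₁ sub₂) (card-++ (X ∖ Y) Y λ p → proj₂ (∈-∖⁻ X Y p))
  where
  sub₁ : X ++ Y ⊑ X ∖ Y ++ Y
  sub₁ {z} p with z ∈? Y | ∈-++⁻ X p
  ... | yes q | _      = ∈-++⁺ʳ (X ∖ Y) q
  ... | no q  | inj₁ r = ∈-++⁺ˡ (∈-∖⁺ r q)
  ... | no q  | inj₂ r = contradiction r q
  sub₂ : X ∖ Y ++ Y ⊑ X ++ Y
  sub₂ p with ∈-++⁻ (X ∖ Y) p
  ... | inj₁ q = ∈-++⁺ˡ (proj₁ (∈-∖⁻ X Y q))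
  ... | inj₂ q = ∈-++⁺ʳ X q

-- Both sides count the union. With `sq X` in place of `X` this measures the neighbours of one class
-- outside the other class without any subtraction.
card-exchange : ∀ X Y → card (X ∖ Y) ℕ.+ card Y ≡ card X ℕ.+ card (Y ∖ X)
card-exchange X Y = trans (sym (card-∪ X Y)) (trans (card-cong (comm X Y) (comm Y X))
  (trans (card-∪ Y X) (ℕP.+-comm (card (Y ∖ X)) (card X))))
  where
  comm : ∀ X Y → X ++ Y ⊑ Y ++ X
  comm X Y p = [ ∈-++⁺ʳ Y , ∈-++⁺ˡ ]′ (∈-++⁻ X p)

-- The values stay in `Pt`, so that `E₁`, `starts` and `Convex` apply to projections as well.
π₁ π₂ : Pt → Pt
π₁ p = proj₁ p , 0ℤ
π₂ p = proj₂ p , 0ℤ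

card-product : ∀ X → card X ℕ.≤ card (map π₁ X) ℕ.* card (map π₂ X)
card-product X = ℕP.≤-trans (card-≤ sub) (ℕP.≤-reflexive len)
  where
  D₁ D₂ : List Pt
  D₁ = deduplicate _≟_ (map π₁ X)
  D₂ = deduplicate _≟_ (map π₂ X)
  g : Pt × Pt → Pt
  g (p , q) = proj₁ p , proj₁ q
  sub : X ⊑ map g (cartesianProduct D₁ D₂)
  sub p = ∈-map⁺ g (∈-cartesianProduct⁺ (∈-deduplicate⁺ _≟_ (∈-map⁺ π₁ p)) (∈-deduplicate⁺ _≟_ (∈-map⁺ π₂ p)))
  len-× : ∀ (xs ys : List Pt) → length (cartesianProduct xs ys) ≡ length xs ℕ.* length ys
  len-× []       ys = refl
  len-× (x ∷ xs) ys = trans (length-++ (map (x ,_) ys)) (cong₂ ℕ._+_ (length-map (x ,_) ys) (len-× xs ys))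
  len : length (map g (cartesianProduct D₁ D₂)) ≡ length D₁ ℕ.* length D₂
  len = trans (length-map g (cartesianProduct D₁ D₂)) (len-× D₁ D₂)

sw : List Pt → List Pt
sw = map swap

∈-sw⁺ : ∀ {X u v} → (u , v) ∈ X → (v , u) ∈ sw X
∈-sw⁺ = ∈-map⁺ swap

∈-sw⁻ : ∀ {X u v} → (u , v) ∈ sw X → (v , u) ∈ X
∈-sw⁻ p with ∈-map⁻ swap p
... | _ , q , refl = q

card-sw : ∀ X → card (sw X) ≡ card X
card-sw = card-map λ { refl → refl }

argmin : ∀ (X : List Pt) {x} → x ∈ X → ∃ λ m → m ∈ X × (∀ {y} → y ∈ X → proj₁ m ≤ proj₁ y)
argmin (x ∷ []) _ = x , here refl , λ { (here refl) → ℤP.≤-refl }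
argmin (x ∷ X@(_ ∷ _)) _ with argmin X (here refl)
... | m , m∈ , min with ℤP.≤-total (proj₁ x) (proj₁ m)
... | inj₁ x≤m = x , here refl , λ { (here refl) → ℤP.≤-refl ; (there p) → ℤP.≤-trans x≤m (min p) }
... | inj₂ m≤x = m , there m∈ , λ { (here refl) → m≤x ; (there p) → min p }

shift : ℤ → Pt → Pt
shift s (u , v) = u + s , v

E₁ : List Pt → List Pt
E₁ X = map (shift 1ℤ) X ++ map (shift -1ℤ) X

∈-E₁⁺ : ∀ {X u v s} → IsUnit s → (u , v) ∈ X → (u + s , v) ∈ E₁ X
∈-E₁⁺ (inj₁ refl) p = ∈-++⁺ˡ (∈-map⁺ (shift 1ℤ) p)
∈-E₁⁺ {X} (inj₂ refl) p = ∈-++⁺ʳ (map (shift 1ℤ) X) (∈-map⁺ (shift -1ℤ) p)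

∈-E₁⁻ : ∀ X {u v} → (u , v) ∈ E₁ X → ∃₂ λ u′ s → IsUnit s × (u′ , v) ∈ X × u ≡ u′ + s
∈-E₁⁻ X p with ∈-++⁻ (map (shift 1ℤ) X) p
... | inj₁ q with ∈-map⁻ (shift 1ℤ) q
...   | (u′ , _) , r , refl = u′ , 1ℤ , inj₁ refl , r , refl
∈-E₁⁻ X p | inj₂ q with ∈-map⁻ (shift -1ℤ) q
...   | (u′ , _) , r , refl = u′ , -1ℤ , inj₂ refl , r , refl

start? : ∀ X → Decidable (λ p → shift (- + 2) p ∉ X)
start? X p = ¬? (shift (- + 2) p ∈? X)

starts : List Pt → List Pt
starts X = filter (start? X) X

-- The left translate of X leaves the right translate exactly at the starts of runs.
card-E₁ : ∀ X → card (E₁ X) ≡ card X ℕ.+ card (starts X)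
card-E₁ X = trans (card-cong sub₁ sub₂)
  (trans (card-++ R L disj) (cong₂ ℕ._+_ (card-map (shift-inj 1ℤ) X) (card-map (shift-inj -1ℤ) (starts X))))
  where
  R L : List Pt
  R = map (shift 1ℤ) X
  L = map (shift -1ℤ) (starts X)
  shift-inj : ∀ s {x y} → shift s x ≡ shift s y → x ≡ y
  shift-inj s {a , b} {c , d} eq = cong₂ _,_ (+-cancelˡ s (trans (ℤP.+-comm s a)
    (trans (,-injectiveˡ eq) (ℤP.+-comm c s)))) (,-injectiveʳ eq)
  back : ∀ u → u + -1ℤ ≡ u + - + 2 + 1ℤ
  back = solve-∀
  back′ : ∀ u → u + 1ℤ + 1ℤ + - + 2 ≡ u
  back′ = solve-∀
  back″ : ∀ u → u ≡ u + -1ℤ + 1ℤ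
  back″ = solve-∀
  sub₁ : E₁ X ⊑ R ++ L
  sub₁ p with ∈-++⁻ R p
  ... | inj₁ q = ∈-++⁺ˡ q
  ... | inj₂ q with ∈-map⁻ (shift -1ℤ) q
  ... | (u , v) , r , refl with (u + - + 2 , v) ∈? X
  ... | yes t = ∈-++⁺ˡ (subst (λ w → (w , v) ∈ R) (sym (back u)) (∈-map⁺ (shift 1ℤ) t))
  ... | no t  = ∈-++⁺ʳ R (∈-map⁺ (shift -1ℤ) (∈-filter⁺ (start? X) r t))
  sub₂ : R ++ L ⊑ E₁ X
  sub₂ p with ∈-++⁻ R p
  ... | inj₁ q = ∈-++⁺ˡ q
  ... | inj₂ q with ∈-map⁻ (shift -1ℤ) q
  ... | _ , r , refl = ∈-++⁺ʳ R (∈-map⁺ (shift -1ℤ) (proj₁ (∈-filter⁻ (start? X) {xs = X} r)))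
  disj : ∀ {z} → z ∈ R → z ∉ L
  disj p q with ∈-map⁻ (shift 1ℤ) p | ∈-map⁻ (shift -1ℤ) q
  ... | (u , v) , r , refl | (u′ , _) , t , eq = proj₂ (∈-filter⁻ (start? X) {xs = X} t)
    (subst (_∈ X) (cong₂ _,_ (trans (sym (back′ u)) (cong (λ w → w + - + 2)
      (trans (cong (λ w → w + 1ℤ) (,-injectiveˡ eq)) (sym (back″ u′))))) (,-injectiveʳ eq)) r)

∈-starts : ∀ {X u v} → (u , v) ∈ X → (u + - + 2 , v) ∉ X → (u , v) ∈ starts X
∈-starts {X} = ∈-filter⁺ (start? X)

onLine? : ∀ v → Decidable (λ (q : Pt) → proj₂ q ≡ v)
onLine? v q = proj₂ q ℤ.≟ v

-- The least point of a line has nothing two steps to its left, so it starts a run. Every occupied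
-- line therefore carries a start, which gives `lines≤starts`.
leftmost : ∀ X {u v} → (u , v) ∈ X → ∃ λ u′ → (u′ , v) ∈ starts X × u′ ≤ u
leftmost X {u} {v} p with argmin (filter (onLine? v) X) (∈-filter⁺ (onLine? v) p refl)
... | (m , _) , m∈ , min with ∈-filter⁻ (onLine? v) {xs = X} m∈
... | m∈X , refl = m , ∈-starts m∈X (λ q → absurd₁ 1 (min (∈-filter⁺ (onLine? v) q refl)) (e m)) ,
  min (∈-filter⁺ (onLine? v) p refl)
  where
  e : ∀ m → m ≡ m + - + 2 + + 2
  e = solve-∀

lines⊑starts : ∀ X → map π₂ X ⊑ map π₂ (starts X)
lines⊑starts X p with ∈-map⁻ π₂ p
... | (u , v) , q , refl = ∈-map⁺ π₂ (proj₁ (proj₂ (leftmost X q)))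

lines≤starts : ∀ X → card (map π₂ X) ℕ.≤ card (starts X)
lines≤starts X = ℕP.≤-trans (card-mono (lines⊑starts X)) (card-map-≤ π₂ (starts X))

Convex : List Pt → Set
Convex X = ∀ {u₁ w u₂ v} → (u₁ , v) ∈ X → (u₂ , v) ∈ X → u₁ ≤ w → w ≤ u₂ → par w ≡ par u₂ → (w , v) ∈ X

-- If `w` were missing, its line would carry two starts: one at most `u₁`, and the first point
-- beyond `w` that has the parity of `w`. Projecting starts to lines would then identify two of
-- them, so there would be fewer lines than starts.
starts≤lines⇒Convex : ∀ X → card (starts X) ℕ.≤ card (map π₂ X) → Convex X
starts≤lines⇒Convex X le {u₁} {w} {u₂} {v} p₁ p₂ u₁≤w w≤u₂ pw with (w , v) ∈? X
... | yes w∈ = w∈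
... | no w∉ = contradiction
    (ℕP.≤-<-trans (card-mono (lines⊑starts X)) (card-map-< π₂ (proj₁ (proj₂ left)) s∈ ne refl))
    (ℕP.≤⇒≯ le)
  where
  Q : Pt → Set
  Q q = proj₂ q ≡ v × w ≤ proj₁ q × par w ≡ par (proj₁ q)
  Q? : Decidable Q
  Q? q = (proj₂ q ℤ.≟ v) ×-dec (w ℤ.≤? proj₁ q) ×-dec (par w Bool.≟ par (proj₁ q))
  left : ∃ λ u → (u , v) ∈ starts X × u ≤ u₁
  left = leftmost X p₁
  right : ∃ λ m → m ∈ filter Q? X × (∀ {y} → y ∈ filter Q? X → proj₁ m ≤ proj₁ y)
  right = argmin (filter Q? X) (∈-filter⁺ Q? p₂ (refl , w≤u₂ , pw))
  m : ℤ
  m = proj₁ (proj₁ right)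
  mX : proj₁ right ∈ X × Q (proj₁ right)
  mX = ∈-filter⁻ Q? {xs = X} (proj₁ (proj₂ right))
  m∈ : (m , v) ∈ X
  m∈ = subst (λ t → (m , t) ∈ X) (proj₁ (proj₂ mX)) (proj₁ mX)
  w+2≤m : w + + 2 ≤ m
  w+2≤m = par-step (proj₂ (proj₂ (proj₂ mX))) (proj₁ (proj₂ (proj₂ mX))) λ w≡m → w∉ (subst (λ t → (t , v) ∈ X) (sym w≡m) m∈)
  s∈ : (m , v) ∈ starts X
  s∈ = ∈-starts m∈ λ q → absurd₁ 1 (proj₂ (proj₂ right) (∈-filter⁺ Q? q
      (refl , le₁ 0 w+2≤m (e₁ m w) , trans (proj₂ (proj₂ (proj₂ mX))) (sym (par-±2 m (inj₂ refl)))))) (e₂ m)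
    where
    e₁ : ∀ m w → m + - + 2 + (w + + 2) ≡ w + m + 0ℤ
    e₁ = solve-∀
    e₂ : ∀ m → m ≡ m + - + 2 + + 2
    e₂ = solve-∀
  ne : (proj₁ left , v) ≢ (m , v)
  ne eq = absurd₁ 1 (ℤP.≤-trans (subst (_≤ u₁) (,-injectiveˡ eq) (proj₂ (proj₂ left))) u₁≤w) m≡
    where
    m≡ : m ≡ w + + 2
    m≡ = ℤP.≤-antisym (ℤP.≤-trans (ℤP.≤-trans (subst (_≤ u₁) (,-injectiveˡ eq) (proj₂ (proj₂ left))) u₁≤w) (le₀ 2 refl)) w+2≤m

-- The sum with a 2 × 2 square

-- The counterpart of `le₁` in ℕ: the hypothesis is added crosswise to the goal, so nothing is
-- subtracted, and `n` is the slack left over.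
n≤₁ : ∀ n {a b i j} → a ℕ.≤ b → j ℕ.+ a ≡ i ℕ.+ b ℕ.+ n → i ℕ.≤ j
n≤₁ n {a} {b} {i} {j} a≤b eq = ℕP.+-cancelʳ-≤ a i j (ℕP.≤-trans (ℕP.+-monoʳ-≤ i a≤b)
  (ℕP.≤-trans (ℕP.m≤m+n (i ℕ.+ b) n) (ℕP.≤-reflexive (sym eq))))

n≤₂ : ∀ n {a b c d i j} → a ℕ.≤ b → c ℕ.≤ d → j ℕ.+ (a ℕ.+ c) ≡ i ℕ.+ (b ℕ.+ d) ℕ.+ n → i ℕ.≤ j
n≤₂ n p q = n≤₁ n (ℕP.+-mono-≤ p q)

n≤₃ : ∀ n {a b c d e f i j} → a ℕ.≤ b → c ℕ.≤ d → e ℕ.≤ f →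
  j ℕ.+ (a ℕ.+ (c ℕ.+ e)) ≡ i ℕ.+ (b ℕ.+ (d ℕ.+ f)) ℕ.+ n → i ℕ.≤ j
n≤₃ n p q r = n≤₂ n p (ℕP.+-mono-≤ q r)

sq : List Pt → List Pt
sq X = sw (E₁ (sw (E₁ X)))

∈-sq⁺ : ∀ {X u v s t} → IsUnit s → IsUnit t → (u , v) ∈ X → (u + s , v + t) ∈ sq X
∈-sq⁺ us ut p = ∈-sw⁺ (∈-E₁⁺ ut (∈-sw⁺ (∈-E₁⁺ us p)))

∈-sq⁻ : ∀ X {u v} → (u , v) ∈ sq X →
  ∃₂ λ u′ v′ → ∃₂ λ s t → IsUnit s × IsUnit t × (u′ , v′) ∈ X × u ≡ u′ + s × v ≡ v′ + t
∈-sq⁻ X p with ∈-E₁⁻ (sw (E₁ X)) (∈-sw⁻ p)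
... | v′ , t , ut , q , ev with ∈-E₁⁻ X (∈-sw⁻ q)
... | u′ , s , us , r , eu = u′ , v′ , s , t , us , ut , r , eu , ev

sq-mono : ∀ {X Y} → X ⊑ Y → sq X ⊑ sq Y
sq-mono {X} sub p with ∈-sq⁻ X p
... | _ , _ , _ , _ , us , ut , q , refl , refl = ∈-sq⁺ us ut (sub q)

card-sq-sw : ∀ X → card (sq (sw X)) ≡ card (sq X)
card-sq-sw X = trans (card-cong sub₁ sub₂) (card-sw (sq X))
  where
  sub₁ : sq (sw X) ⊑ sw (sq X)
  sub₁ p with ∈-sq⁻ (sw X) p
  ... | _ , _ , _ , _ , us , ut , q , refl , refl = ∈-sw⁺ (∈-sq⁺ ut us (∈-sw⁻ q))
  sub₂ : sw (sq X) ⊑ sq (sw X)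
  sub₂ p with ∈-sq⁻ X (∈-sw⁻ p)
  ... | _ , _ , _ , _ , us , ut , q , refl , refl = ∈-sq⁺ ut us (∈-sw⁺ q)

ps qs : List Pt → ℕ
ps X = card (map π₁ X)
qs X = card (map π₂ X)

ps-sw : ∀ X → ps (sw X) ≡ qs X
ps-sw X = cong card (sym (map-∘ X))

qs-sw : ∀ X → qs (sw X) ≡ ps X
qs-sw X = cong card (sym (map-∘ X))

card-π₁-E₁ : ∀ X → card (map π₁ (E₁ X)) ≡ card (E₁ (map π₁ X))
card-π₁-E₁ X = card-cong sub₁ sub₂
  where
  sub₁ : map π₁ (E₁ X) ⊑ E₁ (map π₁ X)
  sub₁ p with ∈-map⁻ π₁ p
  ... | _ , q , refl with ∈-E₁⁻ X q
  ... | _ , _ , us , r , refl = ∈-E₁⁺ us (∈-map⁺ π₁ r)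
  sub₂ : E₁ (map π₁ X) ⊑ map π₁ (E₁ X)
  sub₂ p with ∈-E₁⁻ (map π₁ X) p
  ... | _ , _ , us , q , refl with ∈-map⁻ π₁ q
  ... | _ , r , refl = ∈-map⁺ π₁ (∈-E₁⁺ us r)

card-sq : ∀ X → card (sq X) ≡ card X ℕ.+ card (starts X) ℕ.+ card (starts (sw (E₁ X)))
card-sq X = trans (card-sw (E₁ (sw (E₁ X)))) (trans (card-E₁ (sw (E₁ X)))
  (cong (ℕ._+ card (starts (sw (E₁ X)))) (trans (card-sw (E₁ X)) (card-E₁ X))))

module _ {X : List Pt} {z : Pt} (z∈ : z ∈ X) where
  private
    a b c : ℕ
    a = card (starts X)
    b = card (starts (sw (E₁ X)))
    c = card (starts (map π₁ X))

    r≡ : card (map π₂ (sw (E₁ X))) ≡ ps X ℕ.+ c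
    r≡ = trans (qs-sw (E₁ X)) (trans (card-π₁-E₁ X) (card-E₁ (map π₁ X)))

    q≤a : qs X ℕ.≤ a
    q≤a = lines≤starts X

    r≤b : ps X ℕ.+ c ℕ.≤ b
    r≤b = subst (ℕ._≤ b) r≡ (lines≤starts (sw (E₁ X)))

    1≤l : 1 ℕ.≤ card (map π₂ (map π₁ X))
    1≤l = card-pos (∈-map⁺ π₂ (∈-map⁺ π₁ z∈))

    1≤c : 1 ℕ.≤ c
    1≤c = ℕP.≤-trans 1≤l (lines≤starts (map π₁ X))

    i₁ : ∀ x p q a b c → x ℕ.+ a ℕ.+ b ℕ.+ (q ℕ.+ (p ℕ.+ c ℕ.+ 1)) ≡ x ℕ.+ (p ℕ.+ q) ℕ.+ 1 ℕ.+ (a ℕ.+ (b ℕ.+ c)) ℕ.+ 0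
    i₁ = ℕR.solve-∀

  -- Widening in the first coordinate adds one point per run, at least `qs X`. Widening in the
  -- second adds the runs of the widened set in the other direction, at least its number of occupied
  -- lines; these form the widened projection, of size `ps X` plus the number `c` of runs of the
  -- projection. The final 1 is `1≤c`.
  sq-lower : card X ℕ.+ (ps X ℕ.+ qs X) ℕ.+ 1 ℕ.≤ card (sq X)
  sq-lower = ℕP.≤-trans (n≤₃ 0 q≤a r≤b 1≤c (i₁ (card X) (ps X) (qs X) a b c)) (ℕP.≤-reflexive (sym (card-sq X)))

  module _ (tight : card (sq X) ℕ.≤ card X ℕ.+ (ps X ℕ.+ qs X) ℕ.+ 1) where
    private
      tight′ : card X ℕ.+ a ℕ.+ b ℕ.≤ card X ℕ.+ (ps X ℕ.+ qs X) ℕ.+ 1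
      tight′ = ℕP.≤-trans (ℕP.≤-reflexive (sym (card-sq X))) tight
      j₁ : ∀ x p q a b c → q ℕ.+ (x ℕ.+ a ℕ.+ b ℕ.+ (p ℕ.+ c ℕ.+ 1)) ≡ a ℕ.+ (x ℕ.+ (p ℕ.+ q) ℕ.+ 1 ℕ.+ (b ℕ.+ c)) ℕ.+ 0
      j₁ = ℕR.solve-∀
      j₂ : ∀ x p q a b c → p ℕ.+ c ℕ.+ (x ℕ.+ a ℕ.+ b ℕ.+ (q ℕ.+ 1)) ≡ b ℕ.+ (x ℕ.+ (p ℕ.+ q) ℕ.+ 1 ℕ.+ (a ℕ.+ c)) ℕ.+ 0
      j₂ = ℕR.solve-∀
      j₃ : ∀ x p q a b c → 1 ℕ.+ (x ℕ.+ a ℕ.+ b ℕ.+ (q ℕ.+ (p ℕ.+ c))) ≡ c ℕ.+ (x ℕ.+ (p ℕ.+ q) ℕ.+ 1 ℕ.+ (a ℕ.+ b)) ℕ.+ 0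
      j₃ = ℕR.solve-∀

    -- Equality in `sq-lower` leaves no slack in `q≤a`, `r≤b` and `1≤c`. Each of these comes from
    -- counting lines by starts, so `starts≤lines⇒Convex` applies to the set, to its widening and to
    -- its projection.
    tight⇒Convex : Convex X
    tight⇒Convex = starts≤lines⇒Convex X (n≤₃ 0 tight′ r≤b 1≤c (j₁ (card X) (ps X) (qs X) a b c))

    tight⇒Convex-E₁ : Convex (sw (E₁ X))
    tight⇒Convex-E₁ = starts≤lines⇒Convex (sw (E₁ X)) (subst (b ℕ.≤_) (sym r≡)
      (n≤₃ 0 tight′ q≤a 1≤c (j₂ (card X) (ps X) (qs X) a b c)))

    tight⇒Convex-π₁ : Convex (map π₁ X)
    tight⇒Convex-π₁ = starts≤lines⇒Convex (map π₁ X)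
      (ℕP.≤-trans (n≤₃ 0 tight′ q≤a r≤b (j₃ (card X) (ps X) (qs X) a b c)) 1≤l)

-- `convex-E₁` concerns the lines at `u - 1` and `u + 1` taken together, and `convex-π₁` the set of
-- occupied lines. The fields with index 2 are the transposes.
record Tight (X : List Pt) : Set where
  field
    convex₁    : Convex X
    convex₂    : Convex (sw X)
    convex-E₁  : Convex (sw (E₁ X))
    convex-E₂  : Convex (sw (E₁ (sw X)))
    convex-π₁  : Convex (map π₁ X)
    convex-π₂  : Convex (map π₁ (sw X))

tight : ∀ {X z} → z ∈ X → card (sq X) ℕ.≤ card X ℕ.+ (ps X ℕ.+ qs X) ℕ.+ 1 → Tight X
tight {X} {z} z∈ le = record
  { convex₁ = tight⇒Convex z∈ le
  ; convex₂ = tight⇒Convex z∈′ le′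
  ; convex-E₁ = tight⇒Convex-E₁ z∈ le
  ; convex-E₂ = tight⇒Convex-E₁ z∈′ le′
  ; convex-π₁ = tight⇒Convex-π₁ z∈ le
  ; convex-π₂ = tight⇒Convex-π₁ z∈′ le′
  }
  where
  z∈′ : swap z ∈ sw X
  z∈′ = ∈-sw⁺ z∈
  le′ : card (sq (sw X)) ℕ.≤ card (sw X) ℕ.+ (ps (sw X) ℕ.+ qs (sw X)) ℕ.+ 1
  le′ = ℕP.≤-trans (ℕP.≤-reflexive (card-sq-sw X)) (ℕP.≤-trans le (ℕP.≤-reflexive
    (cong₂ (λ x t → x ℕ.+ t ℕ.+ 1) (sym (card-sw X))
      (trans (ℕP.+-comm (ps X) (qs X)) (sym (cong₂ ℕ._+_ (ps-sw X) (qs-sw X)))))))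

-- Size bounds for one and for two parity classes

amgm : ∀ p q → 4 ℕ.* (p ℕ.* q) ℕ.≤ (p ℕ.+ q) ℕ.* (p ℕ.+ q)
amgm p q with ℕP.≤-total p q
... | inj₁ p≤q with e , refl ← ℕP.m≤n⇒∃[o]m+o≡n p≤q = ℕP.m+n≤o⇒m≤o _ (ℕP.≤-reflexive (i p e))
  where
  i : ∀ p e → 4 ℕ.* (p ℕ.* (p ℕ.+ e)) ℕ.+ e ℕ.* e ≡ (p ℕ.+ (p ℕ.+ e)) ℕ.* (p ℕ.+ (p ℕ.+ e))
  i = ℕR.solve-∀
... | inj₂ q≤p with e , refl ← ℕP.m≤n⇒∃[o]m+o≡n q≤p = ℕP.m+n≤o⇒m≤o _ (ℕP.≤-reflexive (i q e))
  where
  i : ∀ q e → 4 ℕ.* ((q ℕ.+ e) ℕ.* q) ℕ.+ e ℕ.* e ≡ (q ℕ.+ e ℕ.+ q) ℕ.* (q ℕ.+ e ℕ.+ q)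
  i = ℕR.solve-∀

4card≤ : ∀ X → 4 ℕ.* card X ℕ.≤ (ps X ℕ.+ qs X) ℕ.* (ps X ℕ.+ qs X)
4card≤ X = ℕP.≤-trans (ℕP.*-monoʳ-≤ 4 (card-product X)) (amgm (ps X) (qs X))

-- `t` and `t + e` are the values of p + q for the two classes. The projection bounds give 8(x + y)
-- ≤ 2t² + 2(t + e)² = (2t + e)² + e², which suffices for e ≤ 2 and is where the 4 comes from. For e
-- ≥ 3 the second projection bound is too weak, and the larger class is limited by the neighbourhood
-- of the smaller one instead: y ≤ x + t + 2 + D.
two-class-≤ : ∀ t e D x y → 1 ℕ.≤ t → 4 ℕ.* x ℕ.≤ t ℕ.* t → 4 ℕ.* y ℕ.≤ (t ℕ.+ e) ℕ.* (t ℕ.+ e) →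
  y ℕ.≤ x ℕ.+ t ℕ.+ 2 ℕ.+ D → 8 ℕ.* (x ℕ.+ y) ℕ.≤ (t ℕ.+ (t ℕ.+ e) ℕ.+ D) ℕ.* (t ℕ.+ (t ℕ.+ e) ℕ.+ D) ℕ.+ 4
two-class-≤ t 0 D x y _ hx hy _ = n≤₂ (4 ℕ.+ D ℕ.* (4 ℕ.* t ℕ.+ D)) (ℕP.*-monoʳ-≤ 2 hx) (ℕP.*-monoʳ-≤ 2 hy) (i t D x y)
  where
  i : ∀ t D x y → (t ℕ.+ (t ℕ.+ 0) ℕ.+ D) ℕ.* (t ℕ.+ (t ℕ.+ 0) ℕ.+ D) ℕ.+ 4 ℕ.+ (2 ℕ.* (4 ℕ.* x) ℕ.+ 2 ℕ.* (4 ℕ.* y))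
    ≡ 8 ℕ.* (x ℕ.+ y) ℕ.+ (2 ℕ.* (t ℕ.* t) ℕ.+ 2 ℕ.* ((t ℕ.+ 0) ℕ.* (t ℕ.+ 0))) ℕ.+ (4 ℕ.+ D ℕ.* (4 ℕ.* t ℕ.+ D))
  i = ℕR.solve-∀
two-class-≤ t 1 D x y _ hx hy _ = n≤₂ (3 ℕ.+ D ℕ.* (4 ℕ.* t ℕ.+ 2 ℕ.+ D)) (ℕP.*-monoʳ-≤ 2 hx) (ℕP.*-monoʳ-≤ 2 hy) (i t D x y)
  where
  i : ∀ t D x y → (t ℕ.+ (t ℕ.+ 1) ℕ.+ D) ℕ.* (t ℕ.+ (t ℕ.+ 1) ℕ.+ D) ℕ.+ 4 ℕ.+ (2 ℕ.* (4 ℕ.* x) ℕ.+ 2 ℕ.* (4 ℕ.* y))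
    ≡ 8 ℕ.* (x ℕ.+ y) ℕ.+ (2 ℕ.* (t ℕ.* t) ℕ.+ 2 ℕ.* ((t ℕ.+ 1) ℕ.* (t ℕ.+ 1))) ℕ.+ (3 ℕ.+ D ℕ.* (4 ℕ.* t ℕ.+ 2 ℕ.+ D))
  i = ℕR.solve-∀
two-class-≤ t 2 D x y _ hx hy _ = n≤₂ (D ℕ.* (4 ℕ.* t ℕ.+ 4 ℕ.+ D)) (ℕP.*-monoʳ-≤ 2 hx) (ℕP.*-monoʳ-≤ 2 hy) (i t D x y)
  where
  i : ∀ t D x y → (t ℕ.+ (t ℕ.+ 2) ℕ.+ D) ℕ.* (t ℕ.+ (t ℕ.+ 2) ℕ.+ D) ℕ.+ 4 ℕ.+ (2 ℕ.* (4 ℕ.* x) ℕ.+ 2 ℕ.* (4 ℕ.* y))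
    ≡ 8 ℕ.* (x ℕ.+ y) ℕ.+ (2 ℕ.* (t ℕ.* t) ℕ.+ 2 ℕ.* ((t ℕ.+ 2) ℕ.* (t ℕ.+ 2))) ℕ.+ (D ℕ.* (4 ℕ.* t ℕ.+ 4 ℕ.+ D))
  i = ℕR.solve-∀
two-class-≤ (suc t) (suc (suc (suc e))) D x y _ hx _ hxy =
  n≤₂ _ (ℕP.*-monoʳ-≤ 4 hx) (ℕP.*-monoʳ-≤ 8 hxy) (i t e D x y)
  where
  i : ∀ t e D x y → (1 ℕ.+ t ℕ.+ (1 ℕ.+ t ℕ.+ (3 ℕ.+ e)) ℕ.+ D) ℕ.* (1 ℕ.+ t ℕ.+ (1 ℕ.+ t ℕ.+ (3 ℕ.+ e)) ℕ.+ D) ℕ.+ 4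
      ℕ.+ (4 ℕ.* (4 ℕ.* x) ℕ.+ 8 ℕ.* y)
    ≡ 8 ℕ.* (x ℕ.+ y) ℕ.+ (4 ℕ.* ((1 ℕ.+ t) ℕ.* (1 ℕ.+ t)) ℕ.+ 8 ℕ.* (x ℕ.+ (1 ℕ.+ t) ℕ.+ 2 ℕ.+ D))
      ℕ.+ (1 ℕ.+ 4 ℕ.* t ℕ.+ 10 ℕ.* e ℕ.+ 4 ℕ.* (t ℕ.* e) ℕ.+ 2 ℕ.* D ℕ.+ 4 ℕ.* (t ℕ.* D) ℕ.+ e ℕ.* e ℕ.+ D ℕ.* D ℕ.+ 2 ℕ.* (e ℕ.* D))
  i = ℕR.solve-∀

two-class : ∀ t T D x y → 1 ℕ.≤ t → 1 ℕ.≤ T → 4 ℕ.* x ℕ.≤ t ℕ.* t → 4 ℕ.* y ℕ.≤ T ℕ.* T →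
  y ℕ.≤ x ℕ.+ t ℕ.+ 2 ℕ.+ D → x ℕ.≤ y ℕ.+ T ℕ.+ 2 ℕ.+ D →
  8 ℕ.* (x ℕ.+ y) ℕ.≤ (t ℕ.+ T ℕ.+ D) ℕ.* (t ℕ.+ T ℕ.+ D) ℕ.+ 4
two-class t T D x y ht hT hx hy hxy hyx with ℕP.≤-total t T
... | inj₁ t≤T with e , refl ← ℕP.m≤n⇒∃[o]m+o≡n t≤T = two-class-≤ t e D x y ht hx hy hxy
... | inj₂ T≤t with e , refl ← ℕP.m≤n⇒∃[o]m+o≡n T≤t =
  subst₂ (λ k s → 8 ℕ.* k ℕ.≤ (s ℕ.+ D) ℕ.* (s ℕ.+ D) ℕ.+ 4) (ℕP.+-comm y x) (ℕP.+-comm T (T ℕ.+ e))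
    (two-class-≤ T e D y x hT hy hx hyx)

square-bound : ∀ x t → 8 ℕ.* x ℕ.≤ (x ℕ.+ 2 ℕ.+ t) ℕ.* (x ℕ.+ 2 ℕ.+ t) ℕ.+ 4
square-bound 0 t = z≤n
square-bound 1 t = n≤₁ _ (z≤n {0}) (i t)
  where
  i : ∀ t → (1 ℕ.+ 2 ℕ.+ t) ℕ.* (1 ℕ.+ 2 ℕ.+ t) ℕ.+ 4 ℕ.+ 0 ≡ 8 ℕ.+ 0 ℕ.+ (5 ℕ.+ 6 ℕ.* t ℕ.+ t ℕ.* t)
  i = ℕR.solve-∀
square-bound (suc (suc x)) t = n≤₁ _ (z≤n {0}) (i x t)
  where
  i : ∀ x t → (2 ℕ.+ x ℕ.+ 2 ℕ.+ t) ℕ.* (2 ℕ.+ x ℕ.+ 2 ℕ.+ t) ℕ.+ 4 ℕ.+ 0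
    ≡ 8 ℕ.* (2 ℕ.+ x) ℕ.+ 0 ℕ.+ (4 ℕ.+ x ℕ.* x ℕ.+ 8 ℕ.* t ℕ.+ 2 ℕ.* (x ℕ.* t) ℕ.+ t ℕ.* t)
  i = ℕR.solve-∀

-- Here p + q = 2 + t. `square-bound` settles t > 0; for t = 0 the projections are single points,
-- and so is the set.
one-class : ∀ x t D → 1 ℕ.≤ x → 4 ℕ.* x ℕ.≤ (2 ℕ.+ t) ℕ.* (2 ℕ.+ t) →
  8 ℕ.* x ℕ.≤ (x ℕ.+ (1 ℕ.+ t) ℕ.+ D) ℕ.* (x ℕ.+ (1 ℕ.+ t) ℕ.+ D) ℕ.+ 4
one-class 1 zero D _ _ = n≤₁ _ (z≤n {0}) (i D)
  where
  i : ∀ D → (1 ℕ.+ 1 ℕ.+ D) ℕ.* (1 ℕ.+ 1 ℕ.+ D) ℕ.+ 4 ℕ.+ 0 ≡ 8 ℕ.+ 0 ℕ.+ (4 ℕ.* D ℕ.+ D ℕ.* D)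
  i = ℕR.solve-∀
one-class (suc (suc x)) zero D _ h = contradiction h (ℕP.<⇒≱ (ℕP.*-monoʳ-< 4 {1} (s≤s (s≤s z≤n))))
one-class x (suc t) D _ _ = subst (λ k → 8 ℕ.* x ℕ.≤ k ℕ.* k ℕ.+ 4) (i x t D) (square-bound x (t ℕ.+ D))
  where
  i : ∀ x t D → x ℕ.+ 2 ℕ.+ (t ℕ.+ D) ≡ x ℕ.+ (2 ℕ.+ t) ℕ.+ D
  i = ℕR.solve-∀

-- The two parity classes

sqr : ℕ → ℕ
sqr n = n ℕ.* n

bd : List Pt → List Pt
bd L = sq L ∖ L

-- The points (y - x , y + x) are those with coordinates of equal parity.
Lat : List Pt → Set
Lat L = ∀ {u v} → (u , v) ∈ L → par u ≡ par v

-- ⌊(s² + 4) / 8⌋ is the largest number of lattice points in a box with side lengths summing to s.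
Iso : List Pt → Set
Iso L = 8 ℕ.* card L ℕ.≤ sqr (card (bd L) ℕ.∸ 2) ℕ.+ 4

-- With one boundary point fewer, `Iso` would fail. This is the arithmetic form of minimality, by
-- `good⇒minimal` and `minimal⇒good`.
Good : List Pt → Set
Good L = sqr (card (bd L) ℕ.∸ 3) ℕ.+ 4 ℕ.< 8 ℕ.* card L

class? : ∀ b → Decidable (λ (p : Pt) → par (proj₂ p) ≡ b)
class? b p = par (proj₂ p) Bool.≟ b

cls : Bool → List Pt → List Pt
cls b L = filter (class? b) L

∈-cls⁺ : ∀ {L u v b} → (u , v) ∈ L → par v ≡ b → (u , v) ∈ cls b L
∈-cls⁺ {b = b} = ∈-filter⁺ (class? b)

∈-cls⁻ : ∀ L b {p} → p ∈ cls b L → p ∈ L × par (proj₂ p) ≡ b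
∈-cls⁻ L b = ∈-filter⁻ (class? b) {xs = L}

cls⊑ : ∀ L b → cls b L ⊑ L
cls⊑ L b p = proj₁ (∈-cls⁻ L b p)

sq-parity : ∀ L b {p} → p ∈ sq (cls b L) → par (proj₂ p) ≡ not b
sq-parity L b p with ∈-sq⁻ (cls b L) p
... | _ , v′ , _ , _ , _ , ut , q , refl , refl = trans (par-unit v′ ut) (cong not (proj₂ (∈-cls⁻ L b q)))

split-⊑ : ∀ L → L ⊑ cls false L ++ cls true L
split-⊑ L {u , v} p with par v in eq
... | false = ∈-++⁺ˡ (∈-cls⁺ p eq)
... | true  = ∈-++⁺ʳ (cls false L) (∈-cls⁺ p eq)

split-⊒ : ∀ L → cls false L ++ cls true L ⊑ L
split-⊒ L p = [ cls⊑ L false , cls⊑ L true ]′ (∈-++⁻ (cls false L) p)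

card-split : ∀ L → card L ≡ card (cls false L) ℕ.+ card (cls true L)
card-split L = trans (card-cong (split-⊑ L) (split-⊒ L)) (card-++ (cls false L) (cls true L)
  λ p q → case trans (sym (proj₂ (∈-cls⁻ L false p))) (proj₂ (∈-cls⁻ L true q)) of λ ())

-- `sq` reverses parity, so a neighbour of one class can be occupied only by the other class, and
-- the two parts of the boundary differ in parity.
bd-split : ∀ L → card (bd L) ≡ card (sq (cls false L) ∖ cls true L) ℕ.+ card (sq (cls true L) ∖ cls false L)
bd-split L = trans (card-cong sub₁ sub₂) (card-++ (sq X ∖ Y) (sq Y ∖ X) disj)
  where
  X Y : List Pt
  X = cls false L
  Y = cls true L
  sub₁ : bd L ⊑ sq X ∖ Y ++ sq Y ∖ X
  sub₁ p with ∈-∖⁻ (sq L) L p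
  ... | q , p∉ with ∈-sq⁻ L q
  ... | u , v , _ , _ , us , ut , r , refl , refl with ∈-++⁻ X (split-⊑ L r)
  ... | inj₁ r′ = ∈-++⁺ˡ (∈-∖⁺ (∈-sq⁺ us ut r′) (p∉ ∘ cls⊑ L true))
  ... | inj₂ r′ = ∈-++⁺ʳ (sq X ∖ Y) (∈-∖⁺ (∈-sq⁺ us ut r′) (p∉ ∘ cls⊑ L false))
  sub₂ : sq X ∖ Y ++ sq Y ∖ X ⊑ bd L
  sub₂ p with ∈-++⁻ (sq X ∖ Y) p
  ... | inj₁ q with r , p∉ ← ∈-∖⁻ (sq X) Y q = ∈-∖⁺ (sq-mono (cls⊑ L false) r) λ p∈ → p∉ (∈-cls⁺ p∈ (sq-parity L false r))
  ... | inj₂ q with r , p∉ ← ∈-∖⁻ (sq Y) X q = ∈-∖⁺ (sq-mono (cls⊑ L true) r) λ p∈ → p∉ (∈-cls⁺ p∈ (sq-parity L true r))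
  disj : ∀ {z} → z ∈ sq X ∖ Y → z ∉ sq Y ∖ X
  disj p q = case trans (sym (sq-parity L false (proj₁ (∈-∖⁻ (sq X) Y p)))) (sq-parity L true (proj₁ (∈-∖⁻ (sq Y) X q))) of λ ()

-- What the filling argument uses, for a predicate instead of a list because a predicate is easily
-- transposed and reflected. `joinᵤ` closes gaps in the union of the lines at `u - 1` and `u + 1`;
-- `coverᵤ` says that no line between two occupied lines is empty.
record Solid (M : ℤ → ℤ → Set) : Set where
  field
    dec   : ∀ u v → Dec (M u v)
    lat   : ∀ {u v} → M u v → par u ≡ par v
    nbr   : ∀ {u v} → M u v → ∃₂ λ s t → IsUnit s × IsUnit t × M (u + s) (v + t)
    joinᵤ : ∀ u {s₁ s₂ v₁ w v₂} → IsUnit s₁ → IsUnit s₂ → M (u + s₁) v₁ → M (u + s₂) v₂ →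
            v₁ ≤ w → w ≤ v₂ → par w ≡ not (par u) → ∃ λ s → IsUnit s × M (u + s) w
    joinᵥ : ∀ v {s₁ s₂ u₁ w u₂} → IsUnit s₁ → IsUnit s₂ → M u₁ (v + s₁) → M u₂ (v + s₂) →
            u₁ ≤ w → w ≤ u₂ → par w ≡ not (par v) → ∃ λ s → IsUnit s × M w (v + s)
    coverᵤ : ∀ {u₁ v₁ w u₂ v₂} → M u₁ v₁ → M u₂ v₂ → u₁ ≤ w → w ≤ u₂ → ∃ λ v → M w v
    coverᵥ : ∀ {u₁ v₁ w u₂ v₂} → M u₁ v₁ → M u₂ v₂ → v₁ ≤ w → w ≤ v₂ → ∃ λ u → M u w

In : List Pt → ℤ → ℤ → Set
In L u v = (u , v) ∈ L

module _ {M : ℤ → ℤ → Set} (nbr : ∀ {u v} → M u v → ∃₂ λ s t → IsUnit s × IsUnit t × M (u + s) (v + t)) where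

  -- `convex-π₁` of a class relates only lines of one parity. An endpoint of the wrong parity is
  -- replaced by a neighbour, which lies on an adjacent line and cannot pass `w` because the
  -- endpoint is not on the line `w` itself.
  same-parity-below : ∀ {u v w} → M u v → u ≤ w → ∃₂ λ u′ v′ → M u′ v′ × u′ ≤ w × par w ≡ par u′
  same-parity-below {u} {v} {w} m u≤w with par w Bool.≟ par u
  ... | yes pw = u , v , m , u≤w , pw
  ... | no pw with nbr m
  ... | s , t , us , ut , m′ = u + s , v + t , m′ , bound us , trans (Bool.¬-not pw) (sym (par-unit u us))
    where
    u+1≤w : u + 1ℤ ≤ w
    u+1≤w = subst (_≤ w) (ℤP.+-comm 1ℤ u) (ℤP.i<j⇒suc[i]≤j (ℤP.≤∧≢⇒< u≤w λ { refl → pw refl }))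
    bound : ∀ {s} → IsUnit s → u + s ≤ w
    bound (inj₁ refl) = u+1≤w
    bound (inj₂ refl) = le₁ 1 u≤w (e u w)
      where
      e : ∀ u w → w + u ≡ u + -1ℤ + w + 1ℤ
      e = solve-∀

  same-parity-above : ∀ {u v w} → M u v → w ≤ u → ∃₂ λ u′ v′ → M u′ v′ × w ≤ u′ × par w ≡ par u′
  same-parity-above {u} {v} {w} m w≤u with par w Bool.≟ par u
  ... | yes pw = u , v , m , w≤u , pw
  ... | no pw with nbr m
  ... | s , t , us , ut , m′ = u + s , v + t , m′ , bound us , trans (Bool.¬-not pw) (sym (par-unit u us))
    where
    w+1≤u : w + 1ℤ ≤ u
    w+1≤u = subst (_≤ u) (ℤP.+-comm 1ℤ w) (ℤP.i<j⇒suc[i]≤j (ℤP.≤∧≢⇒< w≤u λ { refl → pw refl }))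
    bound : ∀ {s} → IsUnit s → w ≤ u + s
    bound (inj₁ refl) = le₁ 1 w≤u (e u w)
      where
      e : ∀ u w → u + 1ℤ + w ≡ w + u + 1ℤ
      e = solve-∀
    bound (inj₂ refl) = le₁ 0 w+1≤u (e u w)
      where
      e : ∀ u w → u + -1ℤ + (w + 1ℤ) ≡ w + u + 0ℤ
      e = solve-∀

unit-cancel : ∀ u s → u + s + - s ≡ u
unit-cancel = solve-∀

module _ {L : List Pt} (latL : Lat L) (T : ∀ b → Tight (cls b L))
  (nbrL : ∀ {p} → p ∈ L → p ∈ sq L) where
  open Tight

  private
    nbr′ : ∀ {u v} → In L u v → ∃₂ λ s t → IsUnit s × IsUnit t × In L (u + s) (v + t)
    nbr′ p with ∈-sq⁻ L (nbrL p)
    ... | u′ , v′ , s , t , us , ut , q , refl , refl = - s , - t , IsUnit-neg us , IsUnit-neg ut ,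
      subst₂ (In L) (sym (unit-cancel u′ s)) (sym (unit-cancel v′ t)) q

    ∈-cls-u : ∀ {u v b} → In L u v → par u ≡ b → (u , v) ∈ cls b L
    ∈-cls-u p pu = ∈-cls⁺ p (trans (sym (latL p)) pu)

    coverᵤ′ : ∀ {u₁ v₁ w u₂ v₂} → In L u₁ v₁ → In L u₂ v₂ → u₁ ≤ w → w ≤ u₂ → ∃ λ v → In L w v
    coverᵤ′ {w = w} p₁ p₂ l₁ l₂ with same-parity-below {In L} nbr′ p₁ l₁ | same-parity-above {In L} nbr′ p₂ l₂
    ... | u₁ , v₁ , m₁ , k₁ , e₁ | u₂ , v₂ , m₂ , k₂ , e₂
      with ∈-map⁻ π₁ (convex-π₁ (T (par w)) (∈-map⁺ π₁ (∈-cls-u m₁ (sym e₁))) (∈-map⁺ π₁ (∈-cls-u m₂ (sym e₂))) k₁ k₂ e₂)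
    ... | (_ , v) , q , refl = v , cls⊑ L _ q

    coverᵥ′ : ∀ {u₁ v₁ w u₂ v₂} → In L u₁ v₁ → In L u₂ v₂ → v₁ ≤ w → w ≤ v₂ → ∃ λ u → In L u w
    coverᵥ′ {w = w} p₁ p₂ l₁ l₂ with same-parity-below {λ v u → In L u v} nbr″ p₁ l₁ | same-parity-above {λ v u → In L u v} nbr″ p₂ l₂
      where
      nbr″ : ∀ {v u} → In L u v → ∃₂ λ t s → IsUnit t × IsUnit s × In L (u + s) (v + t)
      nbr″ p with s , t , us , ut , q ← nbr′ p = t , s , ut , us , q
    ... | v₁ , u₁ , m₁ , k₁ , e₁ | v₂ , u₂ , m₂ , k₂ , e₂
      with ∈-map⁻ π₁ (convex-π₂ (T (par w)) (∈-map⁺ π₁ (∈-sw⁺ (∈-cls⁺ m₁ (sym e₁)))) (∈-map⁺ π₁ (∈-sw⁺ (∈-cls⁺ m₂ (sym e₂)))) k₁ k₂ e₂)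
    ... | (_ , u) , q , refl = u , cls⊑ L _ (∈-sw⁻ q)

    joinᵤ′ : ∀ u {s₁ s₂ v₁ w v₂} → IsUnit s₁ → IsUnit s₂ → In L (u + s₁) v₁ → In L (u + s₂) v₂ →
             v₁ ≤ w → w ≤ v₂ → par w ≡ not (par u) → ∃ λ s → IsUnit s × In L (u + s) w
    joinᵤ′ u {s₁} {s₂} {v₁} {w} {v₂} us₁ us₂ p₁ p₂ l₁ l₂ pw = - s , IsUnit-neg us ,
        subst (λ k → In L k w) (sym (trans (cong (λ k → k + - s) (proj₂ (proj₂ (proj₂ (proj₂ r))))) (unit-cancel u′ s)))
          (cls⊑ L b (proj₁ (proj₂ (proj₂ (proj₂ r)))))
      where
      b : Bool
      b = not (par u)
      q : ∀ {s v} → IsUnit s → In L (u + s) v → (v , u) ∈ sw (E₁ (cls b L))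
      q {s} {v} us p = ∈-sw⁺ (subst (λ k → (k , v) ∈ E₁ (cls b L)) (unit-cancel u s)
        (∈-E₁⁺ (IsUnit-neg us) (∈-cls-u p (par-unit u us))))
      r : ∃₂ λ u′ s → IsUnit s × (u′ , w) ∈ cls b L × u ≡ u′ + s
      r = ∈-E₁⁻ (cls b L) (∈-sw⁻ (convex-E₁ (T b) (q us₁ p₁) (q us₂ p₂) l₁ l₂
        (trans pw (trans (sym (par-unit u us₂)) (latL p₂)))))
      u′ s : ℤ
      u′ = proj₁ r
      s = proj₁ (proj₂ r)
      us : IsUnit s
      us = proj₁ (proj₂ (proj₂ r))

    joinᵥ′ : ∀ v {s₁ s₂ u₁ w u₂} → IsUnit s₁ → IsUnit s₂ → In L u₁ (v + s₁) → In L u₂ (v + s₂) →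
             u₁ ≤ w → w ≤ u₂ → par w ≡ not (par v) → ∃ λ s → IsUnit s × In L w (v + s)
    joinᵥ′ v {s₁} {s₂} {u₁} {w} {u₂} us₁ us₂ p₁ p₂ l₁ l₂ pw = - s , IsUnit-neg us ,
        subst (In L w) (sym (trans (cong (λ k → k + - s) (proj₂ (proj₂ (proj₂ (proj₂ r))))) (unit-cancel v′ s)))
          (cls⊑ L b (∈-sw⁻ (proj₁ (proj₂ (proj₂ (proj₂ r))))))
      where
      b : Bool
      b = not (par v)
      q : ∀ {s u} → IsUnit s → In L u (v + s) → (u , v) ∈ sw (E₁ (sw (cls b L)))
      q {s} {u} us p = ∈-sw⁺ (subst (λ k → (k , u) ∈ E₁ (sw (cls b L))) (unit-cancel v s)
        (∈-E₁⁺ (IsUnit-neg us) (∈-sw⁺ (∈-cls⁺ p (par-unit v us)))))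
      r : ∃₂ λ v′ s → IsUnit s × (v′ , w) ∈ sw (cls b L) × v ≡ v′ + s
      r = ∈-E₁⁻ (sw (cls b L)) (∈-sw⁻ (convex-E₂ (T b) (q us₁ p₁) (q us₂ p₂) l₁ l₂
        (trans pw (trans (sym (par-unit v us₂)) (sym (latL p₂))))))
      v′ s : ℤ
      v′ = proj₁ r
      s = proj₁ (proj₂ r)
      us : IsUnit s
      us = proj₁ (proj₂ (proj₂ r))

  solid : Solid (In L)
  solid = record
    { dec = λ u v → (u , v) ∈? L
    ; lat = latL
    ; nbr = nbr′
    ; joinᵤ = joinᵤ′
    ; joinᵥ = joinᵥ′
    ; coverᵤ = coverᵤ′
    ; coverᵥ = coverᵥ′
    }

card-0 : ∀ X → card X ≡ 0 → ∀ {z} → z ∉ X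
card-0 X eq z∈ = ℕP.<⇒≢ (card-pos z∈) (sym eq)

ps-pos : ∀ {X z} → z ∈ X → 1 ℕ.≤ ps X
ps-pos = card-pos ∘ ∈-map⁺ π₁

qs-pos : ∀ {X z} → z ∈ X → 1 ℕ.≤ qs X
qs-pos = card-pos ∘ ∈-map⁺ π₂

module TwoClasses {L : List Pt} {z z′ : Pt} (z∈ : z ∈ cls false L) (z′∈ : z′ ∈ cls true L) where
  private
    X Y : List Pt
    X = cls false L
    Y = cls true L
    x y t T A B d d′ β : ℕ
    x = card X
    y = card Y
    t = ps X ℕ.+ qs X
    T = ps Y ℕ.+ qs Y
    A = card (sq X ∖ Y)
    B = card (sq Y ∖ X)
    d = card (Y ∖ sq X)
    d′ = card (X ∖ sq Y)
    β = card (bd L)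
    gX : ∃ λ g → x ℕ.+ t ℕ.+ 1 ℕ.+ g ≡ card (sq X)
    gX = ℕP.m≤n⇒∃[o]m+o≡n (sq-lower z∈)
    gY : ∃ λ g → y ℕ.+ T ℕ.+ 1 ℕ.+ g ≡ card (sq Y)
    gY = ℕP.m≤n⇒∃[o]m+o≡n (sq-lower z′∈)
    g g′ δ : ℕ
    g = proj₁ gX
    g′ = proj₁ gY
    δ = g ℕ.+ d ℕ.+ (g′ ℕ.+ d′)

    eqA : A ℕ.+ y ≡ x ℕ.+ t ℕ.+ 1 ℕ.+ g ℕ.+ d
    eqA = trans (card-exchange (sq X) Y) (cong (ℕ._+ d) (sym (proj₂ gX)))
    eqB : B ℕ.+ x ≡ y ℕ.+ T ℕ.+ 1 ℕ.+ g′ ℕ.+ d′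
    eqB = trans (card-exchange (sq Y) X) (cong (ℕ._+ d′) (sym (proj₂ gY)))

    eqβ : β ≡ 2 ℕ.+ (t ℕ.+ T ℕ.+ δ)
    eqβ = ℕP.+-cancelʳ-≡ (x ℕ.+ y) β _ (trans (cong (ℕ._+ (x ℕ.+ y)) (bd-split L))
      (trans (i₁ A B x y) (trans (cong₂ ℕ._+_ eqA eqB) (i₂ x y t T g d g′ d′))))
      where
      i₁ : ∀ A B x y → A ℕ.+ B ℕ.+ (x ℕ.+ y) ≡ A ℕ.+ y ℕ.+ (B ℕ.+ x)
      i₁ = ℕR.solve-∀
      i₂ : ∀ x y t T g d g′ d′ → x ℕ.+ t ℕ.+ 1 ℕ.+ g ℕ.+ d ℕ.+ (y ℕ.+ T ℕ.+ 1 ℕ.+ g′ ℕ.+ d′)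
        ≡ 2 ℕ.+ (t ℕ.+ T ℕ.+ (g ℕ.+ d ℕ.+ (g′ ℕ.+ d′))) ℕ.+ (x ℕ.+ y)
      i₂ = ℕR.solve-∀

    -- The neighbourhood of X gives y ≤ x + t + 1 + δ, while `two-class` tolerates y ≤ x + t + 2 +
    -- D. So for δ > 0 already D = δ - 1 works, which is the size bound for one boundary point
    -- fewer. This is why `Good` forces δ = 0.
    bound : ∀ D → δ ℕ.≤ suc D → 8 ℕ.* card L ℕ.≤ sqr (t ℕ.+ T ℕ.+ D) ℕ.+ 4
    bound D δ≤ = subst (λ k → 8 ℕ.* k ℕ.≤ sqr (t ℕ.+ T ℕ.+ D) ℕ.+ 4) (sym (card-split L))
      (two-class t T D x y (ℕP.≤-trans (ps-pos z∈) (ℕP.m≤m+n _ _)) (ℕP.≤-trans (ps-pos z′∈) (ℕP.m≤m+n _ _))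
        (4card≤ X) (4card≤ Y)
        (n≤₂ (g′ ℕ.+ d′) (ℕP.≤-trans (ℕP.m≤n+m y A) (ℕP.≤-reflexive eqA)) δ≤ (i₁ x y t D g d g′ d′))
        (n≤₂ (g ℕ.+ d) (ℕP.≤-trans (ℕP.m≤n+m x B) (ℕP.≤-reflexive eqB)) δ≤ (i₂ x y T D g d g′ d′)))
      where
      i₁ : ∀ x y t D g d g′ d′ → x ℕ.+ t ℕ.+ 2 ℕ.+ D ℕ.+ (y ℕ.+ (g ℕ.+ d ℕ.+ (g′ ℕ.+ d′)))
        ≡ y ℕ.+ (x ℕ.+ t ℕ.+ 1 ℕ.+ g ℕ.+ d ℕ.+ (1 ℕ.+ D)) ℕ.+ (g′ ℕ.+ d′)
      i₁ = ℕR.solve-∀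
      i₂ : ∀ x y T D g d g′ d′ → y ℕ.+ T ℕ.+ 2 ℕ.+ D ℕ.+ (x ℕ.+ (g ℕ.+ d ℕ.+ (g′ ℕ.+ d′)))
        ≡ x ℕ.+ (y ℕ.+ T ℕ.+ 1 ℕ.+ g′ ℕ.+ d′ ℕ.+ (1 ℕ.+ D)) ℕ.+ (g ℕ.+ d)
      i₂ = ℕR.solve-∀

  iso : Iso L
  iso = subst (λ k → 8 ℕ.* card L ℕ.≤ sqr (k ℕ.∸ 2) ℕ.+ 4) (sym eqβ) (bound δ (ℕP.n≤1+n δ))

  private
    δ≡0 : Good L → δ ≡ 0
    δ≡0 good with δ in eq
    ... | zero  = refl
    ... | suc D = contradiction (subst (λ k → sqr (k ℕ.∸ 3) ℕ.+ 4 ℕ.< 8 ℕ.* card L) β≡ good)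
          (ℕP.≤⇒≯ (bound D (ℕP.≤-reflexive eq)))
      where
      β≡ : β ≡ 3 ℕ.+ (t ℕ.+ T ℕ.+ D)
      β≡ = trans eqβ (trans (cong (λ k → 2 ℕ.+ (t ℕ.+ T ℕ.+ k)) eq) (cong (2 ℕ.+_) (ℕP.+-suc (t ℕ.+ T) D)))

  module _ (latL : Lat L) (good : Good L) where
    private
      gd g′d′ : ℕ
      gd = g ℕ.+ d
      g′d′ = g′ ℕ.+ d′
      gd≡0 : gd ≡ 0
      gd≡0 = ℕP.m+n≡0⇒m≡0 gd (δ≡0 good)
      g′d′≡0 : g′d′ ≡ 0
      g′d′≡0 = ℕP.m+n≡0⇒n≡0 gd (δ≡0 good)
      T′ : ∀ b → Tight (cls b L)
      T′ false = tight z∈ (ℕP.≤-reflexive (sym (trans (sym (trans (cong (x ℕ.+ t ℕ.+ 1 ℕ.+_) (ℕP.m+n≡0⇒m≡0 g gd≡0)) (ℕP.+-identityʳ _))) (proj₂ gX))))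
      T′ true = tight z′∈ (ℕP.≤-reflexive (sym (trans (sym (trans (cong (y ℕ.+ T ℕ.+ 1 ℕ.+_) (ℕP.m+n≡0⇒m≡0 g′ g′d′≡0)) (ℕP.+-identityʳ _))) (proj₂ gY))))
      nbrL : ∀ {p} → p ∈ L → p ∈ sq L
      nbrL {p} p∈ with ∈-++⁻ X (split-⊑ L p∈) | p ∈? sq X | p ∈? sq Y
      ... | _       | yes q | _     = sq-mono (cls⊑ L false) q
      ... | _       | no _  | yes q = sq-mono (cls⊑ L true) q
      ... | inj₁ r  | no _  | no q  = contradiction (∈-∖⁺ r q) (card-0 (X ∖ sq Y) (ℕP.m+n≡0⇒n≡0 g′ g′d′≡0))
      ... | inj₂ r  | no q  | no _  = contradiction (∈-∖⁺ r q) (card-0 (Y ∖ sq X) (ℕP.m+n≡0⇒n≡0 g gd≡0))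

    good⇒solid : Solid (In L)
    good⇒solid = solid latL T′ nbrL

    good⇒width : 2 ℕ.+ (ps L ℕ.+ qs L) ℕ.≤ β
    good⇒width = subst (2 ℕ.+ (ps L ℕ.+ qs L) ℕ.≤_) (sym eqβ)
      (n≤₂ δ (le π₁) (le π₂) (i (ps L) (qs L) (ps X) (qs X) (ps Y) (qs Y) δ))
      where
      le : ∀ π → card (map π L) ℕ.≤ card (map π X) ℕ.+ card (map π Y)
      le π = ℕP.≤-trans (card-mono sub) (card-++-≤ (map π X) (map π Y))
        where
        sub : map π L ⊑ map π X ++ map π Y
        sub p with ∈-map⁻ π p
        ... | _ , q , refl = [ ∈-++⁺ˡ ∘ ∈-map⁺ π , ∈-++⁺ʳ (map π X) ∘ ∈-map⁺ π ]′ (∈-++⁻ X (split-⊑ L q))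
      i : ∀ p q p₁ q₁ p₂ q₂ δ → 2 ℕ.+ (p₁ ℕ.+ q₁ ℕ.+ (p₂ ℕ.+ q₂) ℕ.+ δ) ℕ.+ (p ℕ.+ q)
        ≡ 2 ℕ.+ (p ℕ.+ q) ℕ.+ (p₁ ℕ.+ p₂ ℕ.+ (q₁ ℕ.+ q₂)) ℕ.+ δ
      i = ℕR.solve-∀

module OneClass {L : List Pt} {z : Pt} {b : Bool} (z∈ : z ∈ L) (mono : ∀ {u v} → (u , v) ∈ L → par v ≡ b) where
  private
    x t β : ℕ
    x = card L
    t = ps L ℕ.+ qs L
    β = card (bd L)

    β≡sq : β ≡ card (sq L)
    β≡sq = card-cong (λ p → proj₁ (∈-∖⁻ (sq L) L p)) λ p → ∈-∖⁺ p (sq∉ p)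
      where
      sq∉ : ∀ {p} → p ∈ sq L → p ∉ L
      sq∉ p q with ∈-sq⁻ L p
      ... | _ , v , _ , _ , us , ut , r , refl , refl =
        not-¬ refl (trans (sym (mono q)) (trans (par-unit v ut) (cong not (mono r))))

    gL : ∃ λ g → x ℕ.+ t ℕ.+ 1 ℕ.+ g ≡ card (sq L)
    gL = ℕP.m≤n⇒∃[o]m+o≡n (sq-lower z∈)
    g : ℕ
    g = proj₁ gL
    tt : ∃ λ t′ → 2 ℕ.+ t′ ≡ t
    tt = ℕP.m≤n⇒∃[o]m+o≡n (ℕP.+-mono-≤ (ps-pos z∈) (qs-pos z∈))
    t′ : ℕ
    t′ = proj₁ tt
    eqβ : β ≡ 2 ℕ.+ (x ℕ.+ (1 ℕ.+ t′) ℕ.+ g)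
    eqβ = trans β≡sq (trans (sym (proj₂ gL)) (trans (cong (λ k → x ℕ.+ k ℕ.+ 1 ℕ.+ g) (sym (proj₂ tt))) (i x t′ g)))
      where
      i : ∀ x t g → x ℕ.+ (2 ℕ.+ t) ℕ.+ 1 ℕ.+ g ≡ 2 ℕ.+ (x ℕ.+ (1 ℕ.+ t) ℕ.+ g)
      i = ℕR.solve-∀
    bound : ∀ D → 8 ℕ.* x ℕ.≤ sqr (x ℕ.+ (1 ℕ.+ t′) ℕ.+ D) ℕ.+ 4
    bound D = one-class x t′ D (card-pos z∈) (subst (λ k → 4 ℕ.* x ℕ.≤ sqr k) (sym (proj₂ tt)) (4card≤ L))

  iso : Iso L
  iso = subst (λ k → 8 ℕ.* x ℕ.≤ sqr (k ℕ.∸ 2) ℕ.+ 4) (sym eqβ) (bound g)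

  private
    not-good : ∀ {k} → β ≡ 3 ℕ.+ k → 8 ℕ.* x ℕ.≤ sqr k ℕ.+ 4 → ¬ Good L
    not-good eq le good = ℕP.≤⇒≯ le (subst (λ k → sqr (k ℕ.∸ 3) ℕ.+ 4 ℕ.< 8 ℕ.* x) eq good)

  module _ (good : Good L) where
    private
      g≡0 : g ≡ 0
      g≡0 with g in eq
      ... | zero  = refl
      ... | suc D = contradiction good (not-good (trans eqβ (trans (cong (λ k → 2 ℕ.+ (x ℕ.+ (1 ℕ.+ t′) ℕ.+ k)) eq) (i x t′ D))) (bound D))
        where
        i : ∀ x t D → 2 ℕ.+ (x ℕ.+ (1 ℕ.+ t) ℕ.+ (1 ℕ.+ D)) ≡ 3 ℕ.+ (x ℕ.+ (1 ℕ.+ t) ℕ.+ D)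
        i = ℕR.solve-∀

    good⇒tight : Tight L
    good⇒tight = tight z∈ (ℕP.≤-reflexive (trans (sym (proj₂ gL)) (trans (cong (x ℕ.+ t ℕ.+ 1 ℕ.+_) g≡0) (ℕP.+-identityʳ _))))

    -- With at least two lines in each direction p + q ≥ 4, and `square-bound` proves the size bound
    -- already for one boundary point fewer.
    good⇒line : ps L ℕ.≤ 1 ⊎ qs L ℕ.≤ 1
    good⇒line with ps L ℕ.≤? 1 | qs L ℕ.≤? 1
    ... | yes p | _     = inj₁ p
    ... | _     | yes q = inj₂ q
    ... | no p  | no q with t″ , t≡ ← ℕP.m≤n⇒∃[o]m+o≡n {4} {t} (ℕP.+-mono-≤ (ℕP.≰⇒> p) (ℕP.≰⇒> q)) =
      contradiction good (not-good (trans β≡sq (trans (sym (proj₂ gL)) (trans (cong (λ k → x ℕ.+ k ℕ.+ 1 ℕ.+ g) (sym t≡)) (i x t″ g))))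
        (square-bound x (t″ ℕ.+ g)))
      where
      i : ∀ x t g → x ℕ.+ (4 ℕ.+ t) ℕ.+ 1 ℕ.+ g ≡ 3 ℕ.+ (x ℕ.+ 2 ℕ.+ (t ℕ.+ g))
      i = ℕR.solve-∀

    good⇒boundary : x ℕ.+ t ℕ.+ 1 ℕ.≤ β
    good⇒boundary = ℕP.≤-trans (sq-lower z∈) (ℕP.≤-reflexive (sym β≡sq))

-- Filling a hole

Touches : (ℤ → ℤ → Set) → ℤ → ℤ → Set
Touches M u v = ∃₂ λ s t → IsUnit s × IsUnit t × M (u + s) (v + t)

touches? : ∀ {M} → (∀ u v → Dec (M u v)) → ∀ u v → Dec (Touches M u v)
touches? {M} M? u v with M? (u + 1ℤ) (v + 1ℤ) | M? (u + 1ℤ) (v + -1ℤ) | M? (u + -1ℤ) (v + 1ℤ) | M? (u + -1ℤ) (v + -1ℤ)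
... | yes m | _ | _ | _ = yes (1ℤ , 1ℤ , inj₁ refl , inj₁ refl , m)
... | no _ | yes m | _ | _ = yes (1ℤ , -1ℤ , inj₁ refl , inj₂ refl , m)
... | no _ | no _ | yes m | _ = yes (-1ℤ , 1ℤ , inj₂ refl , inj₁ refl , m)
... | no _ | no _ | no _ | yes m = yes (-1ℤ , -1ℤ , inj₂ refl , inj₂ refl , m)
... | no n₁ | no n₂ | no n₃ | no n₄ = no λ
  { (_ , _ , inj₁ refl , inj₁ refl , m) → n₁ m
  ; (_ , _ , inj₁ refl , inj₂ refl , m) → n₂ m
  ; (_ , _ , inj₂ refl , inj₁ refl , m) → n₃ m
  ; (_ , _ , inj₂ refl , inj₂ refl , m) → n₄ m }

-- Adding (u , v) to M creates at most one new neighbour, namely (u + s , v + t).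
Fillable : (ℤ → ℤ → Set) → Set
Fillable M = ∃₂ λ u v → ∃₂ λ s t → IsUnit s × IsUnit t ×
  ¬ M u v × M (u - (s + s)) v × M u (v - (t + t)) × Touches M u v

-- Only the orientation with points of `M` below and to the left is treated; `flipM` and `negM`
-- reduce the others to it.
Hole : (ℤ → ℤ → Set) → ℤ → ℤ → Set
Hole M u v = ¬ M u v × par u ≡ par v × (∃ λ v′ → M u v′ × v′ ≤ v) × (∃ λ u′ → M u′ v × u′ ≤ u)

flipM : (ℤ → ℤ → Set) → ℤ → ℤ → Set
flipM M u v = M v u

flip-Hole : ∀ {M u v} → Hole M u v → Hole (flipM M) v u
flip-Hole (n , e , p , q) = n , sym e , q , p

flip-Touches : ∀ M u v → Touches M u v → Touches (flipM M) v u
flip-Touches M u v (s , t , us , ut , m) = t , s , ut , us , m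

flip-Solid : ∀ {M} → Solid M → Solid (flipM M)
flip-Solid {M} S = record
  { dec = λ u v → dec v u
  ; lat = λ m → sym (lat m)
  ; nbr = λ {u} {v} m → flip-Touches M v u (nbr m)
  ; joinᵤ = joinᵥ
  ; joinᵥ = joinᵤ
  ; coverᵤ = coverᵥ
  ; coverᵥ = coverᵤ
  } where open Solid S

flip-Fillable : ∀ {M} → Fillable (flipM M) → Fillable M
flip-Fillable {M} (u , v , s , t , us , ut , n , m₁ , m₂ , q) = v , u , t , s , ut , us , n , m₂ , m₁ , flip-Touches (flipM M) u v q

negM : (ℤ → ℤ → Set) → ℤ → ℤ → Set
negM M u v = M (- u) v

module _ {M : ℤ → ℤ → Set} where
  private
    n₁ : ∀ u s → - u + s ≡ - (u + - s)
    n₁ = solve-∀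
    n₂ : ∀ u s → - (u + s) ≡ - u + - s
    n₂ = solve-∀
    n₃ : ∀ u s → - (u - (s + s)) ≡ - u - (- s + - s)
    n₃ = solve-∀

  neg-Touches : ∀ u v → Touches M (- u) v → Touches (negM M) u v
  neg-Touches u v (s , t , us , ut , m) = - s , t , IsUnit-neg us , ut , subst (λ k → M k (v + t)) (n₁ u s) m

  neg-Touches⁻ : ∀ u v → Touches (negM M) u v → Touches M (- u) v
  neg-Touches⁻ u v (s , t , us , ut , m) = - s , t , IsUnit-neg us , ut , subst (λ k → M k (v + t)) (n₂ u s) m

  neg-Solid : Solid M → Solid (negM M)
  neg-Solid S = record
    { dec = λ u v → dec (- u) v
    ; lat = λ {u} m → trans (sym (par-neg u)) (lat m)
    ; nbr = λ {u} {v} m → neg-Touches u v (nbr m)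
    ; joinᵤ = λ u {s₁} {s₂} us₁ us₂ m₁ m₂ l₁ l₂ pw →
        case joinᵤ (- u) (IsUnit-neg us₁) (IsUnit-neg us₂) (subst (λ k → M k _) (n₂ u s₁) m₁)
          (subst (λ k → M k _) (n₂ u s₂) m₂) l₁ l₂ (trans pw (cong not (sym (par-neg u)))) of
        λ { (s , us , m) → - s , IsUnit-neg us , subst (λ k → M k _) (n₁ u s) m }
    ; joinᵥ = λ v {w = w} us₁ us₂ m₁ m₂ l₁ l₂ pw →
        joinᵥ v us₂ us₁ m₂ m₁ (ℤP.neg-mono-≤ l₂) (ℤP.neg-mono-≤ l₁) (trans (par-neg w) pw)
    ; coverᵤ = λ m₁ m₂ l₁ l₂ → coverᵤ m₂ m₁ (ℤP.neg-mono-≤ l₂) (ℤP.neg-mono-≤ l₁)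
    ; coverᵥ = λ m₁ m₂ l₁ l₂ → case coverᵥ m₁ m₂ l₁ l₂ of λ { (u , m) → - u , subst (λ k → M k _) (sym (ℤP.neg-involutive u)) m }
    } where open Solid S

  neg-Fillable : Fillable (negM M) → Fillable M
  neg-Fillable (u , v , s , t , us , ut , n , m₁ , m₂ , q) =
    - u , v , - s , t , IsUnit-neg us , ut , n , subst (λ k → M k v) (n₃ u s) m₁ , m₂ , neg-Touches⁻ u v q

module _ {M : ℤ → ℤ → Set} (S : Solid M) where
  open Solid S
  private
    e₁ : ∀ u → u - + 2 + 1ℤ ≡ u + -1ℤ
    e₁ = solve-∀
    e₂ : ∀ u → u + -1ℤ + -1ℤ ≡ u - + 2
    e₂ = solve-∀
    e₃ : ∀ u → u + -1ℤ + 1ℤ ≡ u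
    e₃ = solve-∀

  hole-gap : ∀ {u v} → Hole M u v → ∃ λ u′ → M u′ v × u′ + + 2 ≤ u
  hole-gap (n , e , _ , u′ , m , l) = u′ , m , par-step (trans (lat m) (sym e)) l λ { refl → n m }

  -- The line at `u - 2` is occupied by `coverᵤ`. If its point lay at or above height `v`, `joinᵤ`
  -- across `u - 1` would connect it with the point of the line `u` below `v` and yield `(u , v)` or
  -- `(u - 2 , v)`, both missing. So it lies below, and `(u - 2 , v)` is a hole.
  hole-step : ∀ {u v} → Hole M u v → M (u - + 2) v ⊎ Hole M (u - + 2) v
  hole-step {u} {v} h@(n , e , (v′ , m′ , l′) , _) with dec (u - + 2) v | hole-gap h
  ... | yes m | _ = inj₁ m
  ... | no k  | u′ , m , l with coverᵤ {w = u - + 2} m m′ (le₁ 0 l (i₁ u u′)) (le₀ 2 (i₂ u))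
    where
    i₁ : ∀ u u′ → u - + 2 + (u′ + + 2) ≡ u′ + u + 0ℤ
    i₁ = solve-∀
    i₂ : ∀ u → u ≡ u - + 2 + + 2
    i₂ = solve-∀
  ... | v″ , m″ with ℤP.≤-total v″ v
  ... | inj₁ l″ = inj₂ (k , trans (par-±2 u (inj₂ refl)) e , (v″ , m″ , l″) , u′ , m , le₁ 0 l (i₁ u u′))
    where
    i₁ : ∀ u u′ → u - + 2 + (u′ + + 2) ≡ u′ + u + 0ℤ
    i₁ = solve-∀
  ... | inj₂ l″ with joinᵤ (u + -1ℤ) (inj₁ refl) (inj₂ refl) (subst (λ k → M k v′) (sym (e₃ u)) m′)
                     (subst (λ k → M k v″) (sym (e₂ u)) m″) l′ l″
                     (trans (sym e) (trans (sym (not-involutive _)) (cong not (sym (par-unit u (inj₂ refl))))))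
  ... | _ , inj₁ refl , r = contradiction (subst (λ k → M k v) (e₃ u) r) n
  ... | _ , inj₂ refl , r = contradiction (subst (λ k → M k v) (e₂ u) r) k

  -- This makes `(u - 1 , v - 1)` a hole. Suppose the point found on the line `u - 1` lay at or
  -- above height `v - 1`. A neighbour of `(u , v - 2)` at height `v - 1` touches `(u , v)`. One at
  -- height `v - 3` is joined across `u` to the found point, which again gives a neighbour of
  -- `(u , v)`.
  hole-diagonal : ∀ {u v} → par u ≡ par v → ¬ Touches M u v → M (u - + 2) v → M u (v - + 2) →
    ∃ λ v′ → M (u + -1ℤ) v′ × v′ ≤ v + -1ℤ
  hole-diagonal {u} {v} e nt m₁ m₂ with coverᵤ {w = u + -1ℤ} m₁ m₂ (le₀ 1 (sym (e₁ u))) (le₀ 1 (sym (e₃ u)))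
  ... | v′ , m′ with ℤP.≤-total v′ (v + -1ℤ)
  ... | inj₁ l = v′ , m′ , l
  ... | inj₂ l with nbr m₂
  ... | s , _ , us , inj₁ refl , m = ⊥-elim (nt (s , -1ℤ , us , inj₂ refl , subst (M (u + s)) (e₁ v) m))
  ... | s , _ , us , inj₂ refl , m with joinᵤ u {w = v + -1ℤ} us (inj₂ refl) m m′ (le₀ 2 (i v)) l
        (trans (par-unit v (inj₂ refl)) (cong not (sym e)))
    where
    i : ∀ v → v + -1ℤ ≡ v - + 2 + -1ℤ + + 2
    i = solve-∀
  ... | s′ , us′ , r = ⊥-elim (nt (s′ , -1ℤ , us′ , inj₂ refl , r))

-- In a solid set every obstruction to filling a hole is another hole with smaller u + v.
descend : ∀ {M} → Solid M → ∀ {a c} → (∀ {u v} → M u v → a ≤ u × c ≤ v) →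
  ∀ n {u v} → u + v ≤ a + c + + n → Hole M u v → Fillable M
descend S {a} {c} lo zero {u} {v} le h@(_ , _ , (_ , m′ , l′) , _) with hole-gap S h
... | u′ , m , l = ⊥-elim (absurd₁ 1 (ℤP.+-mono-≤ (ℤP.+-mono-≤ (ℤP.+-mono-≤ le l) (proj₁ (lo m))) (ℤP.≤-trans (proj₂ (lo m′)) l′))
      (i u v a c u′))
  where
  i : ∀ u v a c u′ → u + v + (u′ + + 2) + a + c ≡ a + c + 0ℤ + u + u′ + v + + 2
  i = solve-∀
descend {M} S {a} {c} lo (suc n) {u} {v} le h@(nm , e , _) with hole-step S h | hole-step (flip-Solid S) (flip-Hole h)
... | inj₂ h′ | _ = descend S lo n (le₁ 1 le (i u v (a + c) (+ n))) h′
  where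
  i : ∀ u v x n → x + n + (u + v) ≡ u - + 2 + v + (x + (1ℤ + n)) + 1ℤ
  i = solve-∀
... | inj₁ _ | inj₂ h′ = descend S lo n (le₁ 1 le (i u v (a + c) (+ n))) (flip-Hole h′)
  where
  i : ∀ u v x n → x + n + (u + v) ≡ u + (v - + 2) + (x + (1ℤ + n)) + 1ℤ
  i = solve-∀
... | inj₁ m₁ | inj₁ m₂ with touches? (Solid.dec S) u v
... | yes tch = u , v , 1ℤ , 1ℤ , inj₁ refl , inj₁ refl , nm , m₁ , m₂ , tch
... | no ntch = descend S lo n (le₁ 1 le (i u v (a + c) (+ n)))
      ( (λ m → ntch (-1ℤ , -1ℤ , inj₂ refl , inj₂ refl , m))
      , trans (par-unit u (inj₂ refl)) (trans (cong not e) (sym (par-unit v (inj₂ refl))))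
      , hole-diagonal S e ntch m₁ m₂
      , hole-diagonal (flip-Solid S) (sym e) (ntch ∘ flip-Touches (flipM M) v u) m₂ m₁ )
  where
  i : ∀ u v x n → x + n + (u + v) ≡ u + -1ℤ + (v + -1ℤ) + (x + (1ℤ + n)) + 1ℤ
  i = solve-∀

descend′ : ∀ {M} → Solid M → ∀ {a c} → (∀ {u v} → M u v → a ≤ u × c ≤ v) → ∀ {u v} → Hole M u v → Fillable M
descend′ S {a} {c} lo {u} {v} h@(_ , _ , (_ , m , l) , (_ , m′ , l′)) with
  ≤⇒+ (ℤP.+-mono-≤ (ℤP.≤-trans (proj₁ (lo m′)) l′) (ℤP.≤-trans (proj₂ (lo m)) l))
... | n , eq = descend S lo n (ℤP.≤-reflexive eq) h

neg-below : ∀ {u b} → - u ≤ b → - b ≤ u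
neg-below {u} {b} l = subst (- b ≤_) (ℤP.neg-involutive u) (ℤP.neg-mono-≤ l)

-- The four cases are the quadrants in which the two given points lie as seen from the missing one.
fill : ∀ {M} → Solid M → ∀ {a b c d} → (∀ {u v} → M u v → (a ≤ u × u ≤ b) × (c ≤ v × v ≤ d)) →
  ∀ {u v u′ v′} → ¬ M u v → par u ≡ par v → M u v′ → M u′ v → Fillable M
fill {M} S bounds {u} {v} {u′} {v′} n e m m′ with ℤP.≤-total u′ u | ℤP.≤-total v′ v
... | inj₁ l | inj₁ k = descend′ S (λ q → proj₁ (proj₁ (bounds q)) , proj₁ (proj₂ (bounds q)))
      (n , e , (_ , m , k) , _ , m′ , l)
... | inj₂ l | inj₁ k = neg-Fillable (descend′ (neg-Solid S) (λ q → neg-below (proj₂ (proj₁ (bounds q))) , proj₁ (proj₂ (bounds q)))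
      (subst (λ k → ¬ M k v) (sym (ℤP.neg-involutive u)) n , trans (par-neg u) e
      , (_ , subst (λ k → M k v′) (sym (ℤP.neg-involutive u)) m , k)
      , _ , subst (λ k → M k v) (sym (ℤP.neg-involutive u′)) m′ , ℤP.neg-mono-≤ l))
... | inj₁ l | inj₂ k = flip-Fillable (neg-Fillable (descend′ (neg-Solid (flip-Solid S))
      (λ q → neg-below (proj₂ (proj₂ (bounds q))) , proj₁ (proj₁ (bounds q)))
      (subst (λ k → ¬ M u k) (sym (ℤP.neg-involutive v)) n , trans (par-neg v) (sym e)
      , (_ , subst (λ k → M u′ k) (sym (ℤP.neg-involutive v)) m′ , l)
      , _ , subst (λ k → M u k) (sym (ℤP.neg-involutive v′)) m , ℤP.neg-mono-≤ k)))
... | inj₂ l | inj₂ k = flip-Fillable (neg-Fillable (flip-Fillable (neg-Fillable (descend′ (neg-Solid (flip-Solid (neg-Solid (flip-Solid S))))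
      (λ q → neg-below (proj₂ (proj₁ (bounds q))) , neg-below (proj₂ (proj₂ (bounds q))))
      ((λ q → n (subst₂ M (ℤP.neg-involutive u) (ℤP.neg-involutive v) q)) , trans (par-neg u) (trans e (sym (par-neg v)))
      , (_ , subst₂ M (sym (ℤP.neg-involutive u)) (sym (ℤP.neg-involutive v′)) m , ℤP.neg-mono-≤ k)
      , _ , subst₂ M (sym (ℤP.neg-involutive u′)) (sym (ℤP.neg-involutive v)) m′ , ℤP.neg-mono-≤ l)))))

-- Boxes

agree : Bool → Bool → Bool
agree true  b = b
agree false b = not b

agree-notʳ : ∀ a b → agree a (not b) ≡ not (agree a b)
agree-notʳ true  b = refl
agree-notʳ false b = refl

agree-notˡ : ∀ a b → agree (not a) b ≡ not (agree a b)
agree-notˡ true  b = refl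
agree-notˡ false b = sym (not-involutive b)

agree-refl : ∀ a → agree a a ≡ true
agree-refl true  = refl
agree-refl false = refl

agree⇒≡ : ∀ a b → agree a b ≡ true → a ≡ b
agree⇒≡ true  true  _ = refl
agree⇒≡ false false _ = refl

cell : ℤ → ℤ → List Pt
cell u v = if agree (par u) (par v) then (u , v) ∷ [] else []

row : ℤ → ℤ → ℕ → List Pt
row u c zero    = []
row u c (suc Q) = cell u c ++ row u (c + 1ℤ) Q

box : ℤ → ℕ → ℤ → ℕ → List Pt
box a zero    c Q = []
box a (suc P) c Q = row a c Q ++ box (a + 1ℤ) P c Q

-- A half-open range, so that `P` counts its places.
Within : ℤ → ℕ → ℤ → Set
Within a P u = a ≤ u × u + 1ℤ ≤ a + + P

within-zero : ∀ {a u} → ¬ Within a 0 u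
within-zero {a} {u} (p , q) = absurd₁ 0 (ℤP.+-mono-≤ p q) (i a u)
  where
  i : ∀ a u → a + (u + 1ℤ) ≡ u + (a + 0ℤ) + 1ℤ
  i = solve-∀

within⇒≤ : ∀ {a P u} → Within a P u → a ≤ u × u ≤ a + + P
within⇒≤ (p , q) = p , ℤP.≤-trans (le₀ 1 refl) q

within-next : ∀ {a P u} → Within (a + 1ℤ) P u → Within a (suc P) u
within-next {a} {P} {u} (p , q) = le₁ 1 p (i a u) , le₁ 0 q (j a u (+ P))
  where
  i : ∀ a u → u + (a + 1ℤ) ≡ a + u + 1ℤ
  i = solve-∀
  j : ∀ a u P → a + (1ℤ + P) + (u + 1ℤ) ≡ u + 1ℤ + (a + 1ℤ + P) + 0ℤ
  j = solve-∀

within-first : ∀ a P → Within a (suc P) a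
within-first a P = ℤP.≤-refl , le₀ P (i a (+ P))
  where
  i : ∀ a P → a + (1ℤ + P) ≡ a + 1ℤ + P
  i = solve-∀

within-suc : ∀ {a P u} → Within a (suc P) u → u ≢ a → Within (a + 1ℤ) P u
within-suc {a} {P} {u} (p , q) ne = subst (_≤ u) (ℤP.+-comm 1ℤ a) (ℤP.i<j⇒suc[i]≤j (ℤP.≤∧≢⇒< p (ne ∘ sym))) , le₁ 0 q (j a u (+ P))
  where
  j : ∀ a u P → a + 1ℤ + P + (u + 1ℤ) ≡ u + 1ℤ + (a + (1ℤ + P)) + 0ℤ
  j = solve-∀

∈-cell⁻ : ∀ {u c p} → p ∈ cell u c → p ≡ (u , c) × par u ≡ par c
∈-cell⁻ {u} {c} p with agree (par u) (par c) in eq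
∈-cell⁻ (here refl) | true = refl , agree⇒≡ _ _ eq

∈-row⁻ : ∀ {u c Q u′ v} → (u′ , v) ∈ row u c Q → u′ ≡ u × par u ≡ par v × Within c Q v
∈-row⁻ {u} {c} {suc Q} p with ∈-++⁻ (cell u c) p
... | inj₁ q with refl , e ← ∈-cell⁻ q = refl , e , within-first c Q
... | inj₂ q with eu , e , w ← ∈-row⁻ {Q = Q} q = eu , e , within-next w

∈-row⁺ : ∀ {u c Q v} → par u ≡ par v → Within c Q v → (u , v) ∈ row u c Q
∈-row⁺ {Q = zero} e w = ⊥-elim (within-zero w)
∈-row⁺ {u} {c} {suc Q} {v} e w with v ℤ.≟ c
... | no ne = ∈-++⁺ʳ (cell u c) (∈-row⁺ {Q = Q} e (within-suc w ne))
... | yes refl rewrite e | agree-refl (par v) = here refl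

∈-box⁻ : ∀ {a P c Q u v} → (u , v) ∈ box a P c Q → par u ≡ par v × Within a P u × Within c Q v
∈-box⁻ {a} {suc P} {c} {Q} p with ∈-++⁻ (row a c Q) p
... | inj₁ q with refl , e , w ← ∈-row⁻ {Q = Q} q = e , within-first a P , w
... | inj₂ q with e , w , w′ ← ∈-box⁻ {P = P} q = e , within-next w , w′

∈-box⁺ : ∀ {a P c Q u v} → par u ≡ par v → Within a P u → Within c Q v → (u , v) ∈ box a P c Q
∈-box⁺ {P = zero} e w _ = ⊥-elim (within-zero w)
∈-box⁺ {a} {suc P} {c} {Q} {u} e w w′ with u ℤ.≟ a
... | yes refl = ∈-++⁺ˡ (∈-row⁺ {Q = Q} e w′)
... | no ne = ∈-++⁺ʳ (row a c Q) (∈-box⁺ {P = P} e (within-suc w ne) w′)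

next∌ : ∀ {c P} → ¬ Within (c + 1ℤ) P c
next∌ {c} (p , _) = absurd₁ 0 p refl

cell-unique : ∀ u c → Unique (cell u c)
cell-unique u c with agree (par u) (par c)
... | true  = [] ∷ []
... | false = []

row-unique : ∀ u c Q → Unique (row u c Q)
row-unique u c zero    = []
row-unique u c (suc Q) = Uniq.++⁺ (cell-unique u c) (row-unique u (c + 1ℤ) Q)
  λ (p , q) → case ∈-cell⁻ p of λ { (refl , _) → next∌ (proj₂ (proj₂ (∈-row⁻ {Q = Q} q))) }

box-unique : ∀ a P c Q → Unique (box a P c Q)
box-unique a zero    c Q = []
box-unique a (suc P) c Q = Uniq.++⁺ (row-unique a c Q) (box-unique (a + 1ℤ) P c Q)
  λ (p , q) → case ∈-row⁻ {Q = Q} p of λ { (refl , _) → next∌ (proj₁ (proj₂ (∈-box⁻ {P = P} q))) }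

-- Lattice points and other places alternate along a line; the Boolean tells whether the first place
-- is a lattice point.
rowCount : Bool → ℕ → ℕ
rowCount b     zero    = 0
rowCount true  (suc Q) = suc (rowCount false Q)
rowCount false (suc Q) = rowCount true Q

boxCount : Bool → ℕ → ℕ → ℕ
boxCount b zero    Q = 0
boxCount b (suc P) Q = rowCount b Q ℕ.+ boxCount (not b) P Q

length-row : ∀ u c Q → length (row u c Q) ≡ rowCount (agree (par u) (par c)) Q
length-row u c zero = refl
length-row u c (suc Q) with agree (par u) (par c) in eq
... | true = cong suc (trans (length-row u (c + 1ℤ) Q) (cong (λ b → rowCount b Q)
      (trans (cong (agree (par u)) (par-unit c (inj₁ refl))) (trans (agree-notʳ (par u) (par c)) (cong not eq)))))
... | false = trans (length-row u (c + 1ℤ) Q) (cong (λ b → rowCount b Q)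
      (trans (cong (agree (par u)) (par-unit c (inj₁ refl))) (trans (agree-notʳ (par u) (par c)) (cong not eq))))

length-box : ∀ a P c Q → length (box a P c Q) ≡ boxCount (agree (par a) (par c)) P Q
length-box a zero c Q = refl
length-box a (suc P) c Q = trans (length-++ (row a c Q)) (cong₂ ℕ._+_ (length-row a c Q)
  (trans (length-box (a + 1ℤ) P c Q) (cong (λ b → boxCount b P Q)
    (trans (cong (λ b → agree b (par c)) (par-unit a (inj₁ refl))) (agree-notˡ (par a) (par c))))))

rowCount-sum : ∀ b Q → rowCount b Q ℕ.+ rowCount (not b) Q ≡ Q
rowCount-sum b     zero    = refl
rowCount-sum true  (suc Q) = cong suc (rowCount-sum false Q)
rowCount-sum false (suc Q) = trans (ℕP.+-suc (rowCount true Q) (rowCount false Q)) (cong suc (rowCount-sum true Q))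

rowCount-≤ : ∀ Q → rowCount false Q ℕ.≤ rowCount true Q × rowCount true Q ℕ.≤ suc (rowCount false Q)
rowCount-≤ zero = z≤n , z≤n
rowCount-≤ (suc Q) with p , q ← rowCount-≤ Q = q , s≤s p

-- Two consecutive lines are complementary, so together they hold exactly `Q` lattice points. The
-- two bounds below descend by two lines at a time.
boxCount-2 : ∀ b P Q → boxCount b (suc (suc P)) Q ≡ Q ℕ.+ boxCount b P Q
boxCount-2 b P Q = trans (sym (ℕP.+-assoc (rowCount b Q) _ _)) (cong₂ ℕ._+_ (rowCount-sum b Q)
  (cong (λ k → boxCount k P Q) (not-involutive b)))

boxCount-upper : ∀ b P Q → 2 ℕ.* boxCount b P Q ℕ.≤ P ℕ.* Q ℕ.+ 1
boxCount-upper b zero Q = z≤n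
boxCount-upper true 1 Q = n≤₁ 0 (proj₂ (rowCount-≤ Q))
  (trans (cong (λ k → k ℕ.+ 0 ℕ.+ 1 ℕ.+ rowCount true Q) (sym (rowCount-sum true Q))) (i (rowCount true Q) (rowCount false Q)))
  where
  i : ∀ r s → r ℕ.+ s ℕ.+ 0 ℕ.+ 1 ℕ.+ r ≡ 2 ℕ.* (r ℕ.+ 0) ℕ.+ (1 ℕ.+ s) ℕ.+ 0
  i = ℕR.solve-∀
boxCount-upper false 1 Q = n≤₁ 1 (proj₁ (rowCount-≤ Q))
  (trans (cong (λ k → k ℕ.+ 0 ℕ.+ 1 ℕ.+ rowCount false Q) (sym (rowCount-sum true Q))) (i (rowCount true Q) (rowCount false Q)))
  where
  i : ∀ r s → r ℕ.+ s ℕ.+ 0 ℕ.+ 1 ℕ.+ s ≡ 2 ℕ.* (s ℕ.+ 0) ℕ.+ r ℕ.+ 1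
  i = ℕR.solve-∀
boxCount-upper b (suc (suc P)) Q = n≤₁ 0 (boxCount-upper b P Q)
  (trans (i Q (boxCount b P Q) P) (cong (λ k → 2 ℕ.* k ℕ.+ (P ℕ.* Q ℕ.+ 1) ℕ.+ 0) (sym (boxCount-2 b P Q))))
  where
  i : ∀ Q k P → (2 ℕ.+ P) ℕ.* Q ℕ.+ 1 ℕ.+ 2 ℕ.* k ≡ 2 ℕ.* (Q ℕ.+ k) ℕ.+ (P ℕ.* Q ℕ.+ 1) ℕ.+ 0
  i = ℕR.solve-∀

boxCount-lower : ∀ P Q → P ℕ.* Q ℕ.≤ 2 ℕ.* boxCount true P Q
boxCount-lower zero Q = z≤n
boxCount-lower 1 Q = n≤₁ 0 (proj₁ (rowCount-≤ Q))
  (trans (i (rowCount true Q) (rowCount false Q)) (cong (λ k → k ℕ.+ 0 ℕ.+ rowCount true Q ℕ.+ 0) (rowCount-sum true Q)))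
  where
  i : ∀ r s → 2 ℕ.* (r ℕ.+ 0) ℕ.+ s ≡ r ℕ.+ s ℕ.+ 0 ℕ.+ r ℕ.+ 0
  i = ℕR.solve-∀
boxCount-lower (suc (suc P)) Q = n≤₁ 0 (boxCount-lower P Q)
  (trans (cong (λ k → 2 ℕ.* k ℕ.+ P ℕ.* Q) (boxCount-2 true P Q)) (i Q (boxCount true P Q) P))
  where
  i : ∀ Q k P → 2 ℕ.* (Q ℕ.+ k) ℕ.+ P ℕ.* Q ≡ (2 ℕ.+ P) ℕ.* Q ℕ.+ 2 ℕ.* k ℕ.+ 0
  i = ℕR.solve-∀

vol : ℤ → ℕ → ℤ → ℕ → ℕ
vol a P c Q = length (box a P c Q)

vol-upper : ∀ a P c Q → 2 ℕ.* vol a P c Q ℕ.≤ P ℕ.* Q ℕ.+ 1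
vol-upper a P c Q rewrite length-box a P c Q = boxCount-upper _ P Q

vol-lower : ∀ a P c Q → par a ≡ par c → P ℕ.* Q ℕ.≤ 2 ℕ.* vol a P c Q
vol-lower a P c Q e rewrite length-box a P c Q | e | agree-refl (par c) = boxCount-lower P Q

vol-sw : ∀ a P c Q → vol a P c Q ≡ vol c Q a P
vol-sw a P c Q = ℕP.≤-antisym (le a P c Q) (le c Q a P)
  where
  le : ∀ a P c Q → vol a P c Q ℕ.≤ vol c Q a P
  le a P c Q = ℕP.≤-trans (unique-≤ (box-unique a P c Q) sub) (ℕP.≤-reflexive (length-map swap (box c Q a P)))
    where
    sub : box a P c Q ⊑ sw (box c Q a P)
    sub p with e , w , w′ ← ∈-box⁻ {P = P} p = ∈-sw⁺ (∈-box⁺ {P = Q} (sym e) w′ w)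

-- Enclosing boxes and the shape of good sets

record Enc (L : List Pt) (a : ℤ) (P : ℕ) (c : ℤ) (Q : ℕ) : Set where
  field
    inside : ∀ {u v} → (u , v) ∈ L → Within a P u × Within c Q v
    left   : ∃ λ v → (a , v) ∈ L
    right  : ∃₂ λ u v → (u , v) ∈ L × u + 1ℤ ≡ a + + P
    bottom : ∃ λ u → (u , c) ∈ L
    top    : ∃₂ λ u v → (u , v) ∈ L × v + 1ℤ ≡ c + + Q

Enc-sw : ∀ {L a P c Q} → Enc L a P c Q → Enc (sw L) c Q a P
Enc-sw E = record
  { inside = λ p → swap (inside (∈-sw⁻ p))
  ; left   = proj₁ bottom , ∈-sw⁺ (proj₂ bottom)
  ; right  = case top of λ { (u , v , p , e) → v , u , ∈-sw⁺ p , e }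
  ; bottom = proj₁ left , ∈-sw⁺ (proj₂ left)
  ; top    = case right of λ { (u , v , p , e) → v , u , ∈-sw⁺ p , e }
  } where open Enc E

Enc-⊑ : ∀ {L L′ a P c Q} → Enc L a P c Q → L ⊑ L′ → (∀ {u v} → (u , v) ∈ L′ → Within a P u × Within c Q v) →
  Enc L′ a P c Q
Enc-⊑ E sub ins = record
  { inside = ins
  ; left   = proj₁ left , sub (proj₂ left)
  ; right  = case right of λ { (u , v , p , e) → u , v , sub p , e }
  ; bottom = proj₁ bottom , sub (proj₂ bottom)
  ; top    = case top of λ { (u , v , p , e) → u , v , sub p , e }
  } where open Enc E

Lat-sw : ∀ {L} → Lat L → Lat (sw L)
Lat-sw lat p = sym (lat (∈-sw⁻ p))

-- The second alternative is a set in a single class. It is not solid, since none of its points has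
-- a neighbour in the set, and is treated as a line.
Shape : List Pt → Set
Shape L = (Solid (In L) × 2 ℕ.+ (ps L ℕ.+ qs L) ℕ.≤ card (bd L))
  ⊎ (Tight L × (ps L ℕ.≤ 1 ⊎ qs L ℕ.≤ 1) × card L ℕ.+ (ps L ℕ.+ qs L) ℕ.+ 1 ℕ.≤ card (bd L))

≡[]⇒∉ : ∀ {X : List Pt} {z} → X ≡ [] → z ∉ X
≡[]⇒∉ refl ()

classify : ∀ {L z} → z ∈ L → Iso L × (Lat L → Good L → Shape L)
classify {L} z∈ with cls false L in ef | cls true L in et
... | y ∷ _ | y′ ∷ _ = TwoClasses.iso {L} z₀ z₁ , λ latL good →
      inj₁ (TwoClasses.good⇒solid {L} z₀ z₁ latL good , TwoClasses.good⇒width {L} z₀ z₁ latL good)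
  where
  z₀ : y ∈ cls false L
  z₀ = subst (y ∈_) (sym ef) (here refl)
  z₁ : y′ ∈ cls true L
  z₁ = subst (y′ ∈_) (sym et) (here refl)
... | [] | _ = OneClass.iso z∈ mono , λ _ good →
      inj₂ (OneClass.good⇒tight z∈ mono good , OneClass.good⇒line z∈ mono good , OneClass.good⇒boundary z∈ mono good)
  where
  mono : ∀ {u v} → (u , v) ∈ L → par v ≡ true
  mono p = Bool.¬-not λ e → ≡[]⇒∉ ef (∈-cls⁺ p e)
... | _ ∷ _ | [] = OneClass.iso z∈ mono , λ _ good →
      inj₂ (OneClass.good⇒tight z∈ mono good , OneClass.good⇒line z∈ mono good , OneClass.good⇒boundary z∈ mono good)
  where
  mono : ∀ {u v} → (u , v) ∈ L → par v ≡ false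
  mono p = Bool.¬-not λ e → ≡[]⇒∉ et (∈-cls⁺ p e)

range-≤ : ∀ a n X → (∀ i → i ℕ.< n → (a + + i , 0ℤ) ∈ X) → n ℕ.≤ card X
range-≤ a n X h = ℕP.≤-trans (ℕP.≤-reflexive (sym (trans (length-map f (upTo n)) (length-upTo n))))
  (≤-card (Uniq.map⁺ (λ e → ℤP.+-injective (+-cancelˡ a (,-injectiveˡ e))) (Uniq.upTo⁺ n)) sub)
  where
  f : ℕ → Pt
  f i = a + + i , 0ℤ
  sub : map f (upTo n) ⊑ X
  sub p with ∈-map⁻ f p
  ... | i , q , refl = h i (∈-upTo⁻ q)

within-i : ∀ a P {i} → i ℕ.< P → Within a P (a + + i)
within-i a P {i} i<P = ℤP.i≤i+j a (+ i) , le₁ 0 (+≤+ i<P) (e a (+ i) (+ P))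
  where
  e : ∀ a i P → a + P + (1ℤ + i) ≡ a + i + 1ℤ + P + 0ℤ
  e = solve-∀

≤-last : ∀ {u w x} → w + 1ℤ ≤ x → u + 1ℤ ≡ x → w ≤ u
≤-last {u} {w} p refl = le₁ 0 p (e u w)
  where
  e : ∀ u w → u + (w + 1ℤ) ≡ w + (u + 1ℤ) + 0ℤ
  e = solve-∀

-- `P` is odd and every second place is occupied, both ends included. The occupied places and their
-- translates by 1 cover `suc P` consecutive integers.
line-range : ∀ {X u₁ u₂ v P} → Convex X → (u₁ , v) ∈ X → (u₂ , v) ∈ X → par u₁ ≡ par u₂ → u₂ + 1ℤ ≡ u₁ + + P →
  suc P ℕ.≤ ps X ℕ.+ ps X
line-range {X} {u₁} {u₂} {v} {P} cx p₁ p₂ e eq = ℕP.≤-trans (range-≤ u₁ (suc P) (S ++ map (shift 1ℤ) S) h)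
  (ℕP.≤-trans (card-++-≤ S (map (shift 1ℤ) S)) (ℕP.+-monoʳ-≤ (ps X) (card-map-≤ (shift 1ℤ) S)))
  where
  S : List Pt
  S = map π₁ X
  h : ∀ i → i ℕ.< suc P → (u₁ + + i , 0ℤ) ∈ S ++ map (shift 1ℤ) S
  h i (s≤s i≤P) with par (u₁ + + i) Bool.≟ par u₂
  ... | yes pe = ∈-++⁺ˡ (∈-map⁺ π₁ (cx p₁ p₂ (ℤP.i≤i+j u₁ (+ i)) (≤-last (proj₂ (within-i u₁ P i<P)) eq) pe))
    where
    i<P : i ℕ.< P
    i<P = ℕP.≤∧≢⇒< i≤P λ { refl → not-¬ refl (trans (sym pe) (trans (cong par (sym eq)) (par-unit u₂ (inj₁ refl)))) }
  ... | no pe = back i i≤P pe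
    where
    back : ∀ i → i ℕ.≤ P → par (u₁ + + i) ≢ par u₂ → (u₁ + + i , 0ℤ) ∈ S ++ map (shift 1ℤ) S
    back zero _ pe = contradiction (trans (cong par (ℤP.+-identityʳ u₁)) e) pe
    back (suc i) i<P pe = ∈-++⁺ʳ S (subst (λ k → (k , 0ℤ) ∈ map (shift 1ℤ) S) (j u₁ (+ i))
      (∈-map⁺ (shift 1ℤ) (∈-map⁺ π₁ (cx p₁ p₂ (ℤP.i≤i+j u₁ (+ i)) (≤-last (proj₂ (within-i u₁ P i<P)) eq) pe′))))
      where
      j : ∀ u i → u + i + 1ℤ ≡ u + (1ℤ + i)
      j = solve-∀
      pe′ : par (u₁ + + i) ≡ par u₂
      pe′ = trans (sym (not-involutive _)) (trans (cong not (trans (sym (par-unit (u₁ + + i) (inj₁ refl)))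
        (trans (cong par (j u₁ (+ i))) (Bool.¬-not pe)))) (not-involutive _))

same-u : ∀ {L} → ps L ℕ.≤ 1 → ∀ {u v u′ v′} → (u , v) ∈ L → (u′ , v′) ∈ L → u ≡ u′
same-u {L} le {u} {v} {u′} {v′} p q with u ℤ.≟ u′
... | yes e = e
... | no ne = contradiction (ℕP.≤-trans (≤-card (((λ e → ne (,-injectiveˡ e)) ∷ []) ∷ [] ∷ []) sub) le) λ { (s≤s ()) }
  where
  sub : (u , 0ℤ) ∷ (u′ , 0ℤ) ∷ [] ⊑ map π₁ L
  sub (here refl)         = ∈-map⁺ π₁ p
  sub (there (here refl)) = ∈-map⁺ π₁ q

module _ {L : List Pt} {a : ℤ} {P : ℕ} {c : ℤ} {Q : ℕ} (E : Enc L a P c Q) (latL : Lat L) where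
  open Enc E

  column-top : ps L ℕ.≤ 1 → P ≡ 1 × (∃ λ v → (a , c) ∈ L × (a , v) ∈ L × v + 1ℤ ≡ c + + Q)
  column-top le with left | right | bottom | top
  ... | _ , l | u , _ , r , e | u′ , b | u″ , v , t , e′
    with refl ← same-u le l r | refl ← same-u le l b | refl ← same-u le l t =
    ℤP.+-injective (sym (+-cancelˡ a e)) , v , b , t , e′

  column-width : Tight L → ps L ℕ.≤ 1 → suc (P ℕ.+ Q) ℕ.≤ 1 ℕ.+ (card L ℕ.+ qs L)
  column-width T le with column-top le
  ... | refl , v , p , q , e = s≤s (ℕP.≤-trans (subst (λ k → suc Q ℕ.≤ k ℕ.+ k) (ps-sw L)
        (line-range (Tight.convex₂ T) (∈-sw⁺ p) (∈-sw⁺ q) (trans (sym (latL p)) (latL q)) e))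
        (ℕP.+-monoˡ-≤ (qs L) (card-map-≤ π₂ L)))

  column-full : Tight L → ps L ℕ.≤ 1 → ∀ {u v} → par u ≡ par v → Within a P u → Within c Q v → (u , v) ∈ L
  column-full T le {u} {w} e (l , r) (l′ , r′) with column-top le
  ... | refl , v , p , q , eq with refl ← ℤP.≤-antisym l (≤-last r refl) =
    ∈-sw⁻ (Tight.convex₂ T (∈-sw⁺ p) (∈-sw⁺ q) l′ (≤-last r′ eq) (trans (sym e) (latL q)))

Tight-sw : ∀ {X} → Tight X → Tight (sw X)
Tight-sw {X} T = record
  { convex₁ = convex₂ ; convex₂ = subst Convex (sym inv) convex₁
  ; convex-E₁ = convex-E₂ ; convex-E₂ = subst (λ Z → Convex (sw (E₁ Z))) (sym inv) convex-E₁
  ; convex-π₁ = convex-π₂ ; convex-π₂ = subst (λ Z → Convex (map π₁ Z)) (sym inv) convex-π₁ }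
  where
  open Tight T
  inv : sw (sw X) ≡ X
  inv = trans (sym (map-∘ X)) (map-id X)

-- In the solid case no line of the box is empty, so P ≤ p and Q ≤ q. In the one-line case, say P =
-- 1, every second place is occupied, so Q + 1 ≤ 2q, and |L| ≥ q turns |L| + p + q + 1 ≤ |∂L| into
-- the claim.
width : ∀ {L a P c Q} → Enc L a P c Q → Lat L → Good L → 2 ℕ.+ (P ℕ.+ Q) ℕ.≤ card (bd L)
width {L} {a} {P} {c} {Q} E latL good with proj₂ (classify (proj₂ (Enc.left E))) latL good
... | inj₁ (S , le) = ℕP.≤-trans (s≤s (s≤s (ℕP.+-mono-≤ leP leQ))) le
  where
  open Enc E
  open Solid S
  leP : P ℕ.≤ ps L
  leP = range-≤ a P _ λ i i<P → case right of λ { (_ , _ , r , e) →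
    ∈-map⁺ π₁ (proj₂ (coverᵤ (proj₂ left) r (proj₁ (within-i a P i<P)) (≤-last (proj₂ (within-i a P i<P)) e))) }
  leQ : Q ℕ.≤ qs L
  leQ = range-≤ c Q _ λ i i<Q → case top of λ { (_ , _ , r , e) →
    ∈-map⁺ π₂ (proj₂ (coverᵥ (proj₂ bottom) r (proj₁ (within-i c Q i<Q)) (≤-last (proj₂ (within-i c Q i<Q)) e))) }
... | inj₂ (T , inj₁ le , le′) = n≤₃ 0 (column-width E latL T le) (ps-pos (proj₂ (Enc.left E))) le′ (i (card (bd L)) P Q (card L) (ps L) (qs L))
  where
  i : ∀ β P Q x p q → β ℕ.+ (1 ℕ.+ (P ℕ.+ Q) ℕ.+ (1 ℕ.+ (x ℕ.+ (p ℕ.+ q) ℕ.+ 1)))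
    ≡ 2 ℕ.+ (P ℕ.+ Q) ℕ.+ (1 ℕ.+ (x ℕ.+ q) ℕ.+ (p ℕ.+ β)) ℕ.+ 0
  i = ℕR.solve-∀
... | inj₂ (T , inj₂ le , le′) = n≤₃ 0 (column-width (Enc-sw E) (Lat-sw latL) (Tight-sw T) (ℕP.≤-trans (ℕP.≤-reflexive (ps-sw L)) le))
      (qs-pos (proj₂ (Enc.left E))) le′ (trans (i (card (bd L)) P Q (card L) (ps L) (qs L))
        (cong₂ (λ x p → 2 ℕ.+ (P ℕ.+ Q) ℕ.+ (1 ℕ.+ (x ℕ.+ p) ℕ.+ (qs L ℕ.+ card (bd L))) ℕ.+ 0) (sym (card-sw L)) (sym (qs-sw L))))
  where
  i : ∀ β P Q x p q → β ℕ.+ (1 ℕ.+ (Q ℕ.+ P) ℕ.+ (1 ℕ.+ (x ℕ.+ (p ℕ.+ q) ℕ.+ 1)))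
    ≡ 2 ℕ.+ (P ℕ.+ Q) ℕ.+ (1 ℕ.+ (x ℕ.+ p) ℕ.+ (q ℕ.+ β)) ℕ.+ 0
  i = ℕR.solve-∀

-- The added point itself leaves the boundary, hence the `suc` on the left.
boundary-∷ : ∀ {L u v} W → (u , v) ∉ L → (u , v) ∈ sq L →
  (∀ {s t} → IsUnit s → IsUnit t → (u + s , v + t) ∈ L ⊎ (u + s , v + t) ∈ sq L ⊎ (u + s , v + t) ∈ W) →
  suc (card (bd ((u , v) ∷ L))) ℕ.≤ card (bd L) ℕ.+ length W
boundary-∷ {L} {u} {v} W z∉ z∈ new = ℕP.≤-trans (ℕP.≤-reflexive (sym (card-∷ z∉bd)))
  (ℕP.≤-trans (card-mono sub) (ℕP.≤-trans (card-++-≤ (bd L) W) (ℕP.+-monoʳ-≤ (card (bd L)) (card-≤ {W} {W} id))))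
  where
  z∉bd : (u , v) ∉ bd ((u , v) ∷ L)
  z∉bd p = proj₂ (∈-∖⁻ (sq ((u , v) ∷ L)) ((u , v) ∷ L) p) (here refl)
  sub : (u , v) ∷ bd ((u , v) ∷ L) ⊑ bd L ++ W
  sub (here refl) = ∈-++⁺ˡ (∈-∖⁺ z∈ z∉)
  sub (there p) with q , n ← ∈-∖⁻ (sq ((u , v) ∷ L)) ((u , v) ∷ L) p with ∈-sq⁻ ((u , v) ∷ L) q
  ... | _ , _ , _ , _ , us , ut , there r , refl , refl = ∈-++⁺ˡ (∈-∖⁺ (∈-sq⁺ us ut r) (n ∘ there))
  ... | _ , _ , _ , _ , us , ut , here refl , refl , refl with new us ut
  ... | inj₁ r = contradiction (there r) n
  ... | inj₂ (inj₁ r) = ∈-++⁺ˡ (∈-∖⁺ r (n ∘ there))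
  ... | inj₂ (inj₂ r) = ∈-++⁺ʳ (bd L) r

unit-cases : ∀ {s t} → IsUnit s → IsUnit t → t ≡ s ⊎ t ≡ - s
unit-cases (inj₁ refl) (inj₁ refl) = inj₁ refl
unit-cases (inj₁ refl) (inj₂ refl) = inj₂ refl
unit-cases (inj₂ refl) (inj₁ refl) = inj₂ refl
unit-cases (inj₂ refl) (inj₂ refl) = inj₁ refl

touches⇒sq : ∀ {L u v} → Touches (In L) u v → (u , v) ∈ sq L
touches⇒sq {L} {u} {v} (s , t , us , ut , p) = subst₂ (λ x y → (x , y) ∈ sq L) (unit-cancel u s) (unit-cancel v t)
  (∈-sq⁺ (IsUnit-neg us) (IsUnit-neg ut) p)

-- In the solid case `coverᵤ` and `coverᵥ` put points of `L` on both lines through the missing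
-- point, so `fill` applies; it may return a different point. One-line sets miss nothing, by
-- `column-full`.
fill-step : ∀ {L a P c Q u v} → Enc L a P c Q → Lat L → Good L → par u ≡ par v → Within a P u → Within c Q v → (u , v) ∉ L →
  ∃₂ λ u v → (u , v) ∉ L × par u ≡ par v × Within a P u × Within c Q v × card (bd ((u , v) ∷ L)) ℕ.≤ card (bd L)
fill-step {L} {a} {P} {c} {Q} {u} {v} E latL good e wu wv z∉ with proj₂ (classify (proj₂ (Enc.left E))) latL good
... | inj₂ (T , inj₁ le , _) = contradiction (column-full E latL T le e wu wv) z∉
... | inj₂ (T , inj₂ le , _) = contradiction (∈-sw⁻ (column-full (Enc-sw E) (Lat-sw latL) (Tight-sw T)
      (ℕP.≤-trans (ℕP.≤-reflexive (ps-sw L)) le) (sym e) wv wu)) z∉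
... | inj₁ (S , _) with fill S (λ p → within⇒≤ (proj₁ (Enc.inside E p)) , within⇒≤ (proj₂ (Enc.inside E p))) z∉ e (proj₂ lineᵤ) (proj₂ lineᵥ)
  where
  open Enc E
  open Solid S
  lineᵤ : ∃ λ v′ → (u , v′) ∈ L
  lineᵤ = case right of λ { (_ , _ , r , eq) → coverᵤ (proj₂ left) r (proj₁ wu) (≤-last (proj₂ wu) eq) }
  lineᵥ : ∃ λ u′ → (u′ , v) ∈ L
  lineᵥ = case top of λ { (_ , _ , r , eq) → coverᵥ (proj₂ bottom) r (proj₁ wv) (≤-last (proj₂ wv) eq) }
... | u* , v* , s , t , us , ut , n , m₁ , m₂ , tch = u* , v* , n ,
    trans (trans (sym (par-±2 u* (IsUnit-neg us))) (cong par (i₀ u* s))) (latL m₁) ,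
    -- The new point shares one coordinate with each of two points of `L`, hence stays in the box.
    proj₁ (Enc.inside E m₂) , proj₂ (Enc.inside E m₁) ,
    ℕP.≤-pred (ℕP.≤-trans (boundary-∷ ((u* + s , v* + t) ∷ []) n (touches⇒sq tch) new) (ℕP.≤-reflexive (ℕP.+-comm _ 1)))
  where
  i₀ : ∀ u s → u + (- s + - s) ≡ u - (s + s)
  i₀ = solve-∀
  i₁ : ∀ u s → u - (s + s) + s ≡ u + - s
  i₁ = solve-∀
  new : ∀ {s′ t′} → IsUnit s′ → IsUnit t′ → (u* + s′ , v* + t′) ∈ L ⊎ (u* + s′ , v* + t′) ∈ sq L ⊎ (u* + s′ , v* + t′) ∈ (u* + s , v* + t) ∷ []
  new {s′} {t′} us′ ut′ with unit-cases us us′ | unit-cases ut ut′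
  -- Neighbours on the side of `- s` are shared with the point two steps away along `u`, and the one
  -- at `(s , - t)` with the point two steps away along `v`.
  ... | inj₂ refl | _         = inj₂ (inj₁ (subst (λ k → (k , v* + t′) ∈ sq L) (i₁ u* s) (∈-sq⁺ us ut′ m₁)))
  ... | inj₁ refl | inj₂ refl = inj₂ (inj₁ (subst (λ k → (u* + s , k) ∈ sq L) (i₁ v* t) (∈-sq⁺ us ut m₂)))
  ... | inj₁ refl | inj₁ refl = inj₂ (inj₂ (here refl))

-- Growth

sqr-mono : ∀ {m n} → m ℕ.≤ n → sqr m ℕ.≤ sqr n
sqr-mono p = ℕP.*-mono-≤ p p

sqr-cancel-< : ∀ {m n} → sqr m ℕ.+ 4 ℕ.< sqr n ℕ.+ 4 → m ℕ.< n
sqr-cancel-< {m} {n} p = ℕP.≰⇒> λ n≤m → ℕP.<⇒≱ p (ℕP.+-monoˡ-≤ 4 (sqr-mono n≤m))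

m∸3<n⇒m≤2+n : ∀ {m n} → m ℕ.∸ 3 ℕ.< n → m ℕ.≤ 2 ℕ.+ n
m∸3<n⇒m≤2+n {m} {n} p = ℕP.≤-trans (ℕP.m≤n+m∸n m 3) (s≤s (s≤s p))

8vol≤ : ∀ a P c Q → 8 ℕ.* vol a P c Q ℕ.≤ sqr (P ℕ.+ Q) ℕ.+ 4
8vol≤ a P c Q = n≤₂ 0 (ℕP.*-monoʳ-≤ 4 (vol-upper a P c Q)) (amgm P Q) (i (vol a P c Q) (P ℕ.* Q) (sqr (P ℕ.+ Q)))
  where
  i : ∀ k r s → s ℕ.+ 4 ℕ.+ (4 ℕ.* (2 ℕ.* k) ℕ.+ 4 ℕ.* r) ≡ 8 ℕ.* k ℕ.+ (4 ℕ.* (r ℕ.+ 1) ℕ.+ s) ℕ.+ 0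
  i = ℕR.solve-∀

module _ {L : List Pt} {a : ℤ} {P : ℕ} {c : ℤ} {Q : ℕ} (E : Enc L a P c Q) (latL : Lat L) where
  enc⊑box : L ⊑ box a P c Q
  enc⊑box {u , v} p = ∈-box⁺ {P = P} (latL p) (proj₁ (Enc.inside E p)) (proj₂ (Enc.inside E p))

  card≤vol : card L ℕ.≤ vol a P c Q
  card≤vol = card-≤ enc⊑box

  -- The box holds too few points for a good set with a larger boundary. Together with `width` the
  -- boundary has exactly P + Q + 2 points.
  good⇒boundary≤ : Good L → card (bd L) ℕ.≤ 2 ℕ.+ (P ℕ.+ Q)
  good⇒boundary≤ good = m∸3<n⇒m≤2+n (sqr-cancel-< (ℕP.<-≤-trans good
    (ℕP.≤-trans (ℕP.*-monoʳ-≤ 8 card≤vol) (8vol≤ a P c Q))))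

good-∷ : ∀ {L z} → z ∉ L → card (bd (z ∷ L)) ℕ.≤ card (bd L) → Good L → Good (z ∷ L)
good-∷ {L} {z} z∉ le good = ℕP.≤-<-trans (ℕP.+-monoˡ-≤ 4 (sqr-mono (ℕP.∸-monoˡ-≤ 3 le)))
  (ℕP.<-≤-trans good (ℕP.*-monoʳ-≤ 8 (ℕP.≤-trans (ℕP.n≤1+n (card L)) (ℕP.≤-reflexive (sym (card-∷ z∉))))))

-- `big` concerns the box only: one point more would exceed the size bound for P + Q. `L` may be any
-- good set with this enclosing box.
record Immortal (L : List Pt) : Set where
  constructor immortal
  field
    {a c} : ℤ
    {P Q} : ℕ
    lat  : Lat L
    enc  : Enc L a P c Q
    good : Good L
    big  : sqr (P ℕ.+ Q) ℕ.+ 4 ℕ.< 8 ℕ.* suc (vol a P c Q)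

lat-∷ : ∀ {L u v} → par u ≡ par v → Lat L → Lat ((u , v) ∷ L)
lat-∷ e lat (here refl) = e
lat-∷ e lat (there p)   = lat p

within-∷ : ∀ {L a P c Q u v} → Within a P u → Within c Q v → (∀ {u v} → (u , v) ∈ L → Within a P u × Within c Q v) →
  ∀ {u′ v′} → (u′ , v′) ∈ (u , v) ∷ L → Within a P u′ × Within c Q v′
within-∷ wu wv ins (here refl) = wu , wv
within-∷ wu wv ins (there p)   = ins p

-- `big` and the upper bound give (Q - P)² < 8, so Q - P ≤ 2. Lengthening the shorter side leaves a
-- difference of at most 1 in absolute value, and then a box with at least half of its places on the
-- lattice is again as large as possible.
big-next : ∀ {P Q K K′} → P ℕ.≤ Q → sqr (P ℕ.+ Q) ℕ.+ 4 ℕ.< 8 ℕ.* suc K → 2 ℕ.* K ℕ.≤ P ℕ.* Q ℕ.+ 1 →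
  suc P ℕ.* Q ℕ.≤ 2 ℕ.* K′ → sqr (suc P ℕ.+ Q) ℕ.+ 4 ℕ.< 8 ℕ.* suc K′
big-next {P} {Q} {K} {K′} P≤Q big up lo with ℕP.m≤n⇒∃[o]m+o≡n P≤Q
... | 0 , refl = n≤₁ 2 (ℕP.*-monoʳ-≤ 4 lo) (i P K′)
  where
  i : ∀ P K → 8 ℕ.* (1 ℕ.+ K) ℕ.+ 4 ℕ.* ((1 ℕ.+ P) ℕ.* (P ℕ.+ 0))
    ≡ 1 ℕ.+ ((1 ℕ.+ P ℕ.+ (P ℕ.+ 0)) ℕ.* (1 ℕ.+ P ℕ.+ (P ℕ.+ 0)) ℕ.+ 4) ℕ.+ 4 ℕ.* (2 ℕ.* K) ℕ.+ 2
  i = ℕR.solve-∀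
... | 1 , refl = n≤₁ 3 (ℕP.*-monoʳ-≤ 4 lo) (i P K′)
  where
  i : ∀ P K → 8 ℕ.* (1 ℕ.+ K) ℕ.+ 4 ℕ.* ((1 ℕ.+ P) ℕ.* (P ℕ.+ 1))
    ≡ 1 ℕ.+ ((1 ℕ.+ P ℕ.+ (P ℕ.+ 1)) ℕ.* (1 ℕ.+ P ℕ.+ (P ℕ.+ 1)) ℕ.+ 4) ℕ.+ 4 ℕ.* (2 ℕ.* K) ℕ.+ 3
  i = ℕR.solve-∀
... | 2 , refl = n≤₁ 2 (ℕP.*-monoʳ-≤ 4 lo) (i P K′)
  where
  i : ∀ P K → 8 ℕ.* (1 ℕ.+ K) ℕ.+ 4 ℕ.* ((1 ℕ.+ P) ℕ.* (P ℕ.+ 2))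
    ≡ 1 ℕ.+ ((1 ℕ.+ P ℕ.+ (P ℕ.+ 2)) ℕ.* (1 ℕ.+ P ℕ.+ (P ℕ.+ 2)) ℕ.+ 4) ℕ.+ 4 ℕ.* (2 ℕ.* K) ℕ.+ 2
  i = ℕR.solve-∀
... | suc (suc (suc e)) , refl = ⊥-elim (ℕP.1+n≰n {0} (n≤₂ (1 ℕ.+ 6 ℕ.* e ℕ.+ e ℕ.* e) big (ℕP.*-monoʳ-≤ 4 up) (i P e K)))
  where
  i : ∀ P e K → 0 ℕ.+ (1 ℕ.+ ((P ℕ.+ (P ℕ.+ (3 ℕ.+ e))) ℕ.* (P ℕ.+ (P ℕ.+ (3 ℕ.+ e))) ℕ.+ 4) ℕ.+ 4 ℕ.* (2 ℕ.* K))
    ≡ 1 ℕ.+ (8 ℕ.* (1 ℕ.+ K) ℕ.+ 4 ℕ.* (P ℕ.* (P ℕ.+ (3 ℕ.+ e)) ℕ.+ 1)) ℕ.+ (1 ℕ.+ 6 ℕ.* e ℕ.+ e ℕ.* e)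
  i = ℕR.solve-∀

module _ {L : List Pt} {a : ℤ} {P : ℕ} {c : ℤ} {Q : ℕ} (E : Enc L a P c Q) (latL : Lat L)
  (full : ∀ {u v} → par u ≡ par v → Within a P u → Within c Q v → (u , v) ∈ L) where

  open Enc E

  -- A box grows by one point on a side of length at least 2 with only one new boundary point;
  -- σ is the outward direction and u₁ the outermost line of the box on that side.
  add-on-side : ∀ {u₁ σ v} → IsUnit σ → Within a P u₁ → ¬ Within a P (u₁ + σ) →
    (∀ {u} → Within a P u → u ≢ u₁ → Within a P (u₁ + - σ)) → 2 ℕ.≤ Q → par (u₁ + σ) ≡ par v → Within c Q v →
    (u₁ + σ , v) ∉ L × card (bd ((u₁ + σ , v) ∷ L)) ℕ.≤ suc (card (bd L))
  add-on-side {u₁} {σ} {v} uσ w₁ out inward 2≤Q e wv = z∉ , ℕP.≤-pred (ℕP.≤-trans (boundary-∷ W z∉ z∈ new)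
      (ℕP.≤-reflexive (ℕP.+-comm _ 2)))
    where
    W : List Pt
    W = (u₁ + σ + σ , v + 1ℤ) ∷ (u₁ + σ + σ , v + -1ℤ) ∷ []
    z∉ : (u₁ + σ , v) ∉ L
    z∉ p = out (proj₁ (inside p))
    pv : ∀ {t} → IsUnit t → par u₁ ≡ par (v + t)
    pv ut = trans (sym (not-involutive _)) (trans (cong not (trans (sym (par-unit u₁ uσ)) e)) (sym (par-unit v ut)))
    up : Within c Q (v + 1ℤ) ⊎ v + 1ℤ ≡ c + + Q
    up with (v + 1ℤ) ℤ.≟ (c + + Q)
    ... | yes eq = inj₂ eq
    ... | no ne  = inj₁ (ℤP.≤-trans (proj₁ wv) (le₀ 1 refl) ,
            subst (_≤ c + + Q) (ℤP.+-comm 1ℤ (v + 1ℤ)) (ℤP.i<j⇒suc[i]≤j (ℤP.≤∧≢⇒< (proj₂ wv) ne)))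
    down : Within c Q (v + -1ℤ) ⊎ v ≡ c
    down with v ℤ.≟ c
    ... | yes eq = inj₂ eq
    ... | no ne  = inj₁ (le₁ 0 (subst (_≤ v) (ℤP.+-comm 1ℤ c) (ℤP.i<j⇒suc[i]≤j (ℤP.≤∧≢⇒< (proj₁ wv) (ne ∘ sym)))) (i₁ v c) ,
            le₁ 1 (proj₂ wv) (i₂ v (c + + Q)))
      where
      i₁ : ∀ v c → v + -1ℤ + (c + 1ℤ) ≡ c + v + 0ℤ
      i₁ = solve-∀
      i₂ : ∀ v x → x + (v + 1ℤ) ≡ v + -1ℤ + 1ℤ + x + 1ℤ
      i₂ = solve-∀
    z∈ : (u₁ + σ , v) ∈ sq L
    z∈ with up | down
    ... | inj₁ w | _ = subst (λ k → (u₁ + σ , k) ∈ sq L) (unit-cancel v 1ℤ)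
          (∈-sq⁺ uσ (inj₂ refl) (full (pv (inj₁ refl)) w₁ w))
    ... | inj₂ _ | inj₁ w = subst (λ k → (u₁ + σ , k) ∈ sq L) (unit-cancel v -1ℤ)
          (∈-sq⁺ uσ (inj₁ refl) (full (pv (inj₂ refl)) w₁ w))
    -- Both neighbours on the side are outside the box only if `v` is the first and the last place,
    -- that is, Q = 1.
    ... | inj₂ eq | inj₂ refl = ⊥-elim (ℕP.<⇒≢ 2≤Q (ℤP.+-injective (+-cancelˡ v eq)))
    -- At an end of the side `(u₁ , v + t)` leaves the box but is still in `sq L`, as a neighbour of
    -- `(u₁ - σ , v)`. The box does reach the line `u₁ - σ`: a point of `L` at height `v` cannot be
    -- on the line `u₁`, for parity reasons.
    back : ∀ {t u} → IsUnit t → (u , v) ∈ L → (u₁ , v + t) ∈ sq L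
    back {t} {u} ut p = subst (λ k → (k , v + t) ∈ sq L) (i u₁ σ) (∈-sq⁺ uσ ut
      (full (trans (par-unit u₁ (IsUnit-neg uσ)) (trans (sym (par-unit u₁ uσ)) e))
        (inward (proj₁ (inside p)) λ { refl → not-¬ refl (trans (sym (latL p)) (trans (pv {1ℤ} (inj₁ refl)) (par-unit v (inj₁ refl)))) })
        wv))
      where
      i : ∀ u s → u + - s + s ≡ u
      i = solve-∀
    inner : ∀ {t} → IsUnit t → (u₁ , v + t) ∈ L ⊎ (u₁ , v + t) ∈ sq L
    inner (inj₁ refl) with up
    ... | inj₁ w = inj₁ (full (pv (inj₁ refl)) w₁ w)
    ... | inj₂ eq with u , v′ , p , eq′ ← top with refl ← trans (sym (unit-cancel v′ 1ℤ)) (trans (cong (_+ -1ℤ) (trans eq′ (sym eq))) (unit-cancel v 1ℤ)) =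
      inj₂ (back (inj₁ refl) p)
    inner (inj₂ refl) with down
    ... | inj₁ w = inj₁ (full (pv (inj₂ refl)) w₁ w)
    ... | inj₂ refl = inj₂ (back (inj₂ refl) (proj₂ bottom))
    new : ∀ {s t} → IsUnit s → IsUnit t → (u₁ + σ + s , v + t) ∈ L ⊎ (u₁ + σ + s , v + t) ∈ sq L ⊎ (u₁ + σ + s , v + t) ∈ W
    new {s} {t} us ut with unit-cases uσ us
    ... | inj₂ refl = subst (λ k → (k , v + t) ∈ L ⊎ (k , v + t) ∈ sq L ⊎ (k , v + t) ∈ W) (sym (unit-cancel u₁ σ))
          ([ inj₁ , inj₂ ∘ inj₁ ]′ (inner ut))
    new us (inj₁ refl) | inj₁ refl = inj₂ (inj₂ (here refl))
    new us (inj₂ refl) | inj₁ refl = inj₂ (inj₂ (there (here refl)))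

  side-point : 2 ℕ.≤ Q → ∀ u → ∃ λ v → par u ≡ par v × Within c Q v
  side-point (s≤s (s≤s {n = Q′} z≤n)) u with par u Bool.≟ par c
  ... | yes e = c , e , within-first c (suc Q′)
  ... | no ne = c + 1ℤ , trans (Bool.¬-not ne) (sym (par-unit c (inj₁ refl))) , within-next (within-first (c + 1ℤ) Q′)

  private
    i₁ : ∀ u a → u + -1ℤ + (a + 1ℤ) ≡ a + u + 0ℤ
    i₁ = solve-∀
    i₂ : ∀ u x → x + (u + 1ℤ) ≡ u + -1ℤ + 1ℤ + x + 1ℤ
    i₂ = solve-∀
    i₃ : ∀ a P → a + P + 1ℤ ≡ a + (1ℤ + P)
    i₃ = solve-∀
    i₄ : ∀ a → a ≡ a + -1ℤ + 1ℤ
    i₄ = solve-∀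
    i₅ : ∀ a P → a + P ≡ a + -1ℤ + (1ℤ + P)
    i₅ = solve-∀
    within-suc-P : ∀ {u} → Within a P u → Within a (suc P) u
    within-suc-P (p , q) = p , ℤP.≤-trans q (le₀ 1 (sym (i₃ a (+ P))))
    within-pred : ∀ {u} → Within a P u → Within (a + -1ℤ) (suc P) u
    within-pred (p , q) = ℤP.≤-trans (le₀ 1 (i₄ a)) p , ℤP.≤-trans q (ℤP.≤-reflexive (i₅ a (+ P)))

  -- The side is chosen so that the corner `(a′ , c)` of the larger box is a lattice point, as
  -- `vol-lower` requires. If `(a , c)` is not one, moving the left side outward by one makes it so.
  widen : 2 ℕ.≤ Q → ∃₂ λ u v → ∃ λ a′ → (u , v) ∉ L × par u ≡ par v × card (bd ((u , v) ∷ L)) ℕ.≤ suc (card (bd L)) ×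
    par a′ ≡ par c × Enc ((u , v) ∷ L) a′ (suc P) c Q
  widen 2≤Q with par a Bool.≟ par c
  widen 2≤Q | yes pa with u₁ , _ , r , eq ← right with v , e , wv ← side-point 2≤Q (u₁ + 1ℤ)
    with z∉ , le ← add-on-side {u₁} {1ℤ} (inj₁ refl) (proj₁ (inside r))
      (λ w → absurd₁ 0 (proj₂ w) (cong (_+ 1ℤ) eq))
      (λ {u} w ne → le₁ 0 (ℤP.≤-trans (ℤP.+-monoˡ-≤ 1ℤ (proj₁ w)) (subst (_≤ u₁) (ℤP.+-comm 1ℤ u)
          (ℤP.i<j⇒suc[i]≤j (ℤP.≤∧≢⇒< (≤-last (proj₂ w) eq) ne)))) (i₁ u₁ a) ,
          le₁ 1 (ℤP.≤-reflexive eq) (i₂ u₁ (a + + P)))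
      2≤Q e wv =
    u₁ + 1ℤ , v , a , z∉ , e , le , pa , record
      { inside = within-∷ (ℤP.≤-trans (proj₁ (proj₁ (inside r))) (le₀ 1 refl) ,
                           ℤP.≤-reflexive (trans (cong (_+ 1ℤ) eq) (i₃ a (+ P)))) wv
                   (λ p → within-suc-P (proj₁ (inside p)) , proj₂ (inside p))
      ; left = proj₁ left , there (proj₂ left)
      ; right = u₁ + 1ℤ , v , here refl , trans (cong (_+ 1ℤ) eq) (i₃ a (+ P))
      ; bottom = proj₁ bottom , there (proj₂ bottom)
      ; top = case top of λ { (u , v , p , e) → u , v , there p , e } }
  widen 2≤Q | no pa with v , e , wv ← side-point 2≤Q (a + -1ℤ)
    with z∉ , le ← add-on-side {a} { -1ℤ} (inj₂ refl) (proj₁ (inside (proj₂ left)))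
      (λ w → absurd₁ 0 (proj₁ w) (i₄ a))
      (λ {u} w ne → le₀ 1 refl , ℤP.≤-trans (ℤP.+-monoˡ-≤ 1ℤ (subst (_≤ u) (ℤP.+-comm 1ℤ a)
          (ℤP.i<j⇒suc[i]≤j (ℤP.≤∧≢⇒< (proj₁ w) (ne ∘ sym))))) (proj₂ w))
      2≤Q e wv =
    a + -1ℤ , v , a + -1ℤ , z∉ , e , le , trans (par-unit a (inj₂ refl)) (sym (Bool.¬-not (pa ∘ sym))) , record
      { inside = within-∷ (within-first (a + -1ℤ) P) wv (λ p → within-pred (proj₁ (inside p)) , proj₂ (inside p))
      ; left = v , here refl
      ; right = case right of λ { (u , v , p , e) → u , v , there p , trans e (i₅ a (+ P)) }
      ; bottom = proj₁ bottom , there (proj₂ bottom)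
      ; top = case top of λ { (u , v , p , e) → u , v , there p , e } }

card-bd-sw : ∀ L → card (bd (sw L)) ≡ card (bd L)
card-bd-sw L = trans (card-cong sub₁ sub₂) (card-sw (bd L))
  where
  sub₁ : bd (sw L) ⊑ sw (bd L)
  sub₁ p with q , n ← ∈-∖⁻ (sq (sw L)) (sw L) p with ∈-sq⁻ (sw L) q
  ... | _ , _ , _ , _ , us , ut , r , refl , refl = ∈-sw⁺ (∈-∖⁺ (∈-sq⁺ ut us (∈-sw⁻ r)) (n ∘ ∈-sw⁺))
  sub₂ : sw (bd L) ⊑ bd (sw L)
  sub₂ p with q , n ← ∈-∖⁻ (sq L) L (∈-sw⁻ p) with ∈-sq⁻ L q
  ... | _ , _ , _ , _ , us , ut , r , refl , refl = ∈-∖⁺ (∈-sq⁺ ut us (∈-sw⁺ r)) (n ∘ ∈-sw⁻)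

immortal-sw : ∀ {L} → Immortal L → Immortal (sw L)
immortal-sw {L} (immortal {a} {c} {P} {Q} lat enc good big) = immortal (Lat-sw lat) (Enc-sw enc)
  (subst₂ (λ β k → sqr (β ℕ.∸ 3) ℕ.+ 4 ℕ.< 8 ℕ.* k) (sym (card-bd-sw L)) (sym (card-sw L)) good)
  (subst₂ (λ s k → sqr s ℕ.+ 4 ℕ.< 8 ℕ.* suc k) (ℕP.+-comm P Q) (vol-sw a P c Q) big)

Grows : List Pt → Set
Grows L = ∃ λ z → z ∉ L × Immortal (z ∷ L)

Full : List Pt → ℤ → ℕ → ℤ → ℕ → Set
Full L a P c Q = ∀ {u v} → par u ≡ par v → Within a P u → Within c Q v → (u , v) ∈ L

module _ {L : List Pt} {a : ℤ} {P : ℕ} {c : ℤ} {Q : ℕ} (latL : Lat L) (E : Enc L a P c Q) (good : Good L)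
  (big : sqr (P ℕ.+ Q) ℕ.+ 4 ℕ.< 8 ℕ.* suc (vol a P c Q)) (full : Full L a P c Q) where

  private
    vol≤card : vol a P c Q ℕ.≤ card L
    vol≤card = ≤-card (box-unique a P c Q) λ {z} p → case ∈-box⁻ {P = P} p of λ (e , w , w′) → full e w w′

  -- The boundary grows to at most P + Q + 3. By `big` the new set, one point larger than the box,
  -- exceeds the size bound for P + Q, so it is good with that boundary.
  grow-wide : P ℕ.≤ Q → 2 ℕ.≤ Q → Grows L
  grow-wide P≤Q 2≤Q with u , v , a′ , z∉ , e , le , pa , E′ ← widen E latL full 2≤Q =
    (u , v) , z∉ , immortal (lat-∷ e latL) E′
      (ℕP.≤-<-trans (ℕP.+-monoˡ-≤ 4 (sqr-mono (ℕP.∸-monoˡ-≤ 3 (ℕP.≤-trans le (s≤s (good⇒boundary≤ E latL good))))))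
        (ℕP.<-≤-trans big (ℕP.*-monoʳ-≤ 8 (ℕP.≤-trans (s≤s vol≤card) (ℕP.≤-reflexive (sym (card-∷ z∉)))))))
      (big-next P≤Q big (vol-upper a P c Q) (vol-lower a′ (suc P) c Q pa))

-- No side has two places here, so a diagonal neighbour lengthens both sides at once. A boundary of
-- 5 points allows at most (3² + 4) / 8 < 2 points, so 6 is best possible.
grow-point : ∀ {L a c} → Lat L → Enc L a 1 c 1 → Good L → Grows L
grow-point {L} {a} {c} latL E good = (a + 1ℤ , c + 1ℤ) , z∉ , immortal {a = a} {c} {2} {2} (lat-∷ pz latL) E′ good′ big′
  where
  open Enc E
  only : ∀ {u v} → (u , v) ∈ L → u ≡ a × v ≡ c
  only p = let (l , r) , (l′ , r′) = inside p in ℤP.≤-antisym (≤-last r refl) l , ℤP.≤-antisym (≤-last r′ refl) l′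
  p∈ : (a , c) ∈ L
  p∈ = subst (λ k → (a , k) ∈ L) (proj₂ (only (proj₂ left))) (proj₂ left)
  z∉ : (a + 1ℤ , c + 1ℤ) ∉ L
  z∉ p = absurd₁ 0 (ℤP.≤-reflexive (proj₁ (only p))) refl
  pz : par (a + 1ℤ) ≡ par (c + 1ℤ)
  pz = trans (par-unit a (inj₁ refl)) (trans (cong not (latL p∈)) (sym (par-unit c (inj₁ refl))))
  W : List Pt
  W = (a + 1ℤ + 1ℤ , c + 1ℤ + 1ℤ) ∷ (a + 1ℤ + 1ℤ , c + 1ℤ + -1ℤ) ∷ (a + 1ℤ + -1ℤ , c + 1ℤ + 1ℤ) ∷ []
  new : ∀ {s t} → IsUnit s → IsUnit t → (a + 1ℤ + s , c + 1ℤ + t) ∈ L ⊎ (a + 1ℤ + s , c + 1ℤ + t) ∈ sq L ⊎ (a + 1ℤ + s , c + 1ℤ + t) ∈ W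
  new (inj₁ refl) (inj₁ refl) = inj₂ (inj₂ (here refl))
  new (inj₁ refl) (inj₂ refl) = inj₂ (inj₂ (there (here refl)))
  new (inj₂ refl) (inj₁ refl) = inj₂ (inj₂ (there (there (here refl))))
  new (inj₂ refl) (inj₂ refl) = inj₁ (subst₂ (In L) (sym (unit-cancel a 1ℤ)) (sym (unit-cancel c 1ℤ)) p∈)
  β′≤6 : card (bd ((a + 1ℤ , c + 1ℤ) ∷ L)) ℕ.≤ 6
  β′≤6 = ℕP.≤-pred (ℕP.≤-trans (boundary-∷ W z∉ (∈-sq⁺ (inj₁ refl) (inj₁ refl) p∈) new)
    (ℕP.+-monoˡ-≤ 3 (good⇒boundary≤ E latL good)))
  good′ : Good ((a + 1ℤ , c + 1ℤ) ∷ L)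
  good′ = ℕP.≤-<-trans (ℕP.+-monoˡ-≤ 4 (sqr-mono (ℕP.∸-monoˡ-≤ 3 β′≤6)))
    (ℕP.<-≤-trans (ℕP.m≤m+n 14 2) (ℕP.*-monoʳ-≤ 8 (ℕP.≤-trans (s≤s (card-pos p∈)) (ℕP.≤-reflexive (sym (card-∷ z∉))))))
  E′ : Enc ((a + 1ℤ , c + 1ℤ) ∷ L) a 2 c 2
  E′ = record
    { inside = within-∷ (within-next (within-first (a + 1ℤ) 0)) (within-next (within-first (c + 1ℤ) 0))
        λ p → case only p of λ { (refl , refl) → within-first a 1 , within-first c 1 }
    ; left = c , there p∈
    ; right = a + 1ℤ , c + 1ℤ , here refl , ℤP.+-assoc a 1ℤ 1ℤ
    ; bottom = a , there p∈
    ; top = a + 1ℤ , c + 1ℤ , here refl , ℤP.+-assoc c 1ℤ 1ℤ }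
  big′ : sqr 4 ℕ.+ 4 ℕ.< 8 ℕ.* suc (vol a 2 c 2)
  big′ = n≤₁ 3 (ℕP.*-monoʳ-≤ 4 (vol-lower a 2 c 2 (latL p∈))) (i (vol a 2 c 2))
    where
    i : ∀ k → 8 ℕ.* (1 ℕ.+ k) ℕ.+ 16 ≡ 21 ℕ.+ 4 ℕ.* (2 ℕ.* k) ℕ.+ 3
    i = ℕR.solve-∀

enc-pos : ∀ {L a P c Q} → Enc L a P c Q → 1 ℕ.≤ P
enc-pos {P = zero} E = ⊥-elim (within-zero (proj₁ (Enc.inside E (proj₂ (Enc.left E)))))
enc-pos {P = suc P} E = s≤s z≤n

grow-full : ∀ {L a P c Q} → Lat L → Enc L a P c Q → Good L → sqr (P ℕ.+ Q) ℕ.+ 4 ℕ.< 8 ℕ.* suc (vol a P c Q) →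
  Full L a P c Q → P ℕ.≤ Q → Grows L
grow-full {P = P} {Q = Q} latL E good big full P≤Q with 2 ℕ.≤? Q
... | yes 2≤Q = grow-wide latL E good big full P≤Q 2≤Q
... | no ¬2≤Q with refl ← ℕP.≤-antisym (ℕP.≤-pred (ℕP.≰⇒> ¬2≤Q)) (enc-pos (Enc-sw E))
  with refl ← ℕP.≤-antisym P≤Q (enc-pos E) = grow-point latL E good

missing? : ∀ L a P c Q → (∃₂ λ u v → par u ≡ par v × Within a P u × Within c Q v × (u , v) ∉ L) ⊎ Full L a P c Q
missing? L a P c Q with box a P c Q ∖ L in eq
... | [] = inj₂ full
  where
  full : Full L a P c Q
  full {u} {v} e w w′ with (u , v) ∈? L
  ... | yes p = p
  ... | no n  = contradiction (∈-∖⁺ (∈-box⁺ {P = P} e w w′) n) (≡[]⇒∉ eq)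
... | (u , v) ∷ _ with p , n ← ∈-∖⁻ (box a P c Q) L (subst ((u , v) ∈_) (sym eq) (here refl))
  with e , w , w′ ← ∈-box⁻ {P = P} p = inj₁ (u , v , e , w , w′ , n)

grow : ∀ {L} → Immortal L → Grows L
grow {L} im@(immortal {a} {c} {P} {Q} lat enc good big) with missing? L a P c Q
... | inj₁ (u , v , e , w , w′ , n) with u* , v* , z∉ , e* , wu , wv , le ← fill-step enc lat good e w w′ n =
  (u* , v*) , z∉ , immortal (lat-∷ e* lat) (Enc-⊑ enc there (within-∷ wu wv (Enc.inside enc))) (good-∷ z∉ le good) big
... | inj₂ full with ℕP.≤-total P Q
... | inj₁ P≤Q = grow-full lat enc good big full P≤Q
... | inj₂ Q≤P
  with (u , v) , z∉ , im′ ← grow-full (Immortal.lat (immortal-sw im)) (Immortal.enc (immortal-sw im))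
    (Immortal.good (immortal-sw im)) (Immortal.big (immortal-sw im)) (λ e w w′ → ∈-sw⁺ (full (sym e) w′ w)) Q≤P =
  (v , u) , z∉ ∘ ∈-sw⁺ , subst (λ X → Immortal ((v , u) ∷ X)) (trans (sym (map-∘ L)) (map-id L)) (immortal-sw im′)

fill-box : ∀ n {L a P c Q} → Lat L → Enc L a P c Q → Good L → vol a P c Q ℕ.≤ n ℕ.+ card L →
  ∃ λ L′ → L ⊑ L′ × Lat L′ × Enc L′ a P c Q × Good L′ × Full L′ a P c Q
fill-box n {L} {a} {P} {c} {Q} lat enc good le with missing? L a P c Q
... | inj₂ full = L , id , lat , enc , good , full
... | inj₁ (u , v , e , w , w′ , z∉) with n
... | zero = contradiction le (ℕP.<⇒≱ (ℕP.<-≤-trans (card-mono-< (enc⊑box enc lat) (∈-box⁺ {P = P} e w w′) z∉)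
      (card-≤ {box a P c Q} {box a P c Q} id)))
... | suc n with u* , v* , z∉* , e* , wu , wv , le* ← fill-step enc lat good e w w′ z∉
  with L′ , sub , rest ← fill-box n (lat-∷ e* lat) (Enc-⊑ enc there (within-∷ wu wv (Enc.inside enc))) (good-∷ z∉* le* good)
    (ℕP.≤-trans le (ℕP.≤-reflexive (sym (trans (cong (n ℕ.+_) (card-∷ z∉*)) (ℕP.+-suc n (card L)))))) =
  L′ , sub ∘ there , rest

-- Translation to the rotated coordinates

φ : Point → Pt
φ (x , y) = y - x , y + x

φ-injective : ∀ p q → φ p ≡ φ q → p ≡ q
φ-injective (x , y) (x′ , y′) eq = cong₂ _,_ x≡ (+-cancelˡ x′ (trans (ℤP.+-comm x′ y) (trans
    (trans (cong (λ k → y + k) (sym x≡)) (,-injectiveʳ eq)) (ℤP.+-comm y′ x′))))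
  where
  i : ∀ x y → + 2 ℤ.* x ≡ y + x - (y - x)
  i = solve-∀
  x≡ : x ≡ x′
  x≡ = ℤP.*-cancelˡ-≡ (+ 2) x x′ (trans (i x y) (trans (cong₂ _-_ (,-injectiveʳ eq) (,-injectiveˡ eq)) (sym (i x′ y′))))

φ-lat : ∀ p → par (proj₁ (φ p)) ≡ par (proj₂ (φ p))
φ-lat (x , y) = trans (sym (par-double (y - x) x)) (cong par (i x y))
  where
  i : ∀ x y → y - x + (x + x) ≡ y + x
  i = solve-∀

φ-surjective : ∀ u v → par u ≡ par v → ∃ λ p → φ p ≡ (u , v)
φ-surjective u v e with h , refl ← par-diff {u} {v} e = (h , u + h) , cong₂ _,_ (i u h) (ℤP.+-assoc u h h)
  where
  i : ∀ u h → u + h - h ≡ u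
  i = solve-∀

unit-vector : ∀ d₁ d₂ → ∣ d₁ ∣ ℕ.+ ∣ d₂ ∣ ≡ 1 → IsUnit (d₂ - d₁) × IsUnit (d₂ + d₁)
unit-vector (+ 0) (+ 1)      _ = inj₁ refl , inj₁ refl
unit-vector (+ 0) -[1+ 0 ]   _ = inj₂ refl , inj₂ refl
unit-vector (+ 1) (+ 0)      _ = inj₂ refl , inj₁ refl
unit-vector -[1+ 0 ] (+ 0)   _ = inj₁ refl , inj₂ refl

adj⇒ : ∀ {p q} → Adj p q → ∃₂ λ s t → IsUnit s × IsUnit t × φ p ≡ (proj₁ (φ q) + s , proj₂ (φ q) + t)
adj⇒ {x , y} {x′ , y′} adj with us , ut ← unit-vector (x - x′) (y - y′) adj =
  _ , _ , us , ut , cong₂ _,_ (i x y x′ y′) (j x y x′ y′)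
  where
  i : ∀ x y x′ y′ → y - x ≡ y′ - x′ + (y - y′ - (x - x′))
  i = solve-∀
  j : ∀ x y x′ y′ → y + x ≡ y′ + x′ + (y - y′ + (x - x′))
  j = solve-∀

⇒adj : ∀ {p q s t} → IsUnit s → IsUnit t → φ p ≡ (proj₁ (φ q) + s , proj₂ (φ q) + t) → Adj p q
⇒adj {p} {x , y} {s} {t} us ut eq = subst (λ r → Adj r (x , y)) (φ-injective (x + d₁ , y + d₂) p (sym eq′)) adj
  where
  vec : ∀ {s t} → IsUnit s → IsUnit t → ∃₂ λ d₁ d₂ → s ≡ d₂ - d₁ × t ≡ d₂ + d₁ × ∣ d₁ ∣ ℕ.+ ∣ d₂ ∣ ≡ 1
  vec (inj₁ refl) (inj₁ refl) = 0ℤ , 1ℤ , refl , refl , refl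
  vec (inj₁ refl) (inj₂ refl) = -1ℤ , 0ℤ , refl , refl , refl
  vec (inj₂ refl) (inj₁ refl) = 1ℤ , 0ℤ , refl , refl , refl
  vec (inj₂ refl) (inj₂ refl) = 0ℤ , -1ℤ , refl , refl , refl
  d₁ d₂ : ℤ
  d₁ = proj₁ (vec us ut)
  d₂ = proj₁ (proj₂ (vec us ut))
  i : ∀ x y d₁ d₂ → y - x + (d₂ - d₁) ≡ y + d₂ - (x + d₁)
  i = solve-∀
  j : ∀ x y d₁ d₂ → y + x + (d₂ + d₁) ≡ y + d₂ + (x + d₁)
  j = solve-∀
  k : ∀ x d → x + d - x ≡ d
  k = solve-∀
  eq′ : φ p ≡ φ (x + d₁ , y + d₂)
  eq′ = trans eq (cong₂ _,_ (trans (cong (λ r → y - x + r) (proj₁ (proj₂ (proj₂ (vec us ut))))) (i x y d₁ d₂))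
    (trans (cong (λ r → y + x + r) (proj₁ (proj₂ (proj₂ (proj₂ (vec us ut)))))) (j x y d₁ d₂)))
  adj : Adj (x + d₁ , y + d₂) (x , y)
  adj = trans (cong₂ (λ r r′ → ∣ r ∣ ℕ.+ ∣ r′ ∣) (k x d₁) (k y d₂)) (proj₂ (proj₂ (proj₂ (proj₂ (vec us ut)))))

size-mono : ∀ {A B k m} → A ⊆ B → HasSize A k → HasSize B m → k ℕ.≤ m
size-mono sub (l , u , mem , refl) (l′ , u′ , mem′ , refl) =
  unique-≤ u λ {p} p∈ → proj₂ (mem′ p) (sub p (proj₁ (mem p) p∈))

size-unique : ∀ {A k m} → HasSize A k → HasSize A m → k ≡ m
size-unique h h′ = ℕP.≤-antisym (size-mono (λ _ → id) h h′) (size-mono (λ _ → id) h′ h)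

-- A `Subset` is an arbitrary predicate; counting takes place in a list of rotated points. `Lat`
-- makes every listed point the image of a point of ℤ².
Rep : Subset → List Pt → Set
Rep A L = Lat L × (∀ p → (A p → φ p ∈ L) × (φ p ∈ L → A p))

⟦_⟧ : List Pt → Subset
⟦ L ⟧ p = φ p ∈ L

preimage : ∀ L → Lat L → ∃ λ l → map φ l ≡ L
preimage [] lat = [] , refl
preimage ((u , v) ∷ L) lat with q , refl ← φ-surjective u v (lat (here refl)) with l , refl ← preimage L (lat ∘ there) = q ∷ l , refl

rep-size : ∀ {A L} → Rep A L → HasSize A (card L)
rep-size {A} {L} (lat , mem) with l , eq ← preimage (deduplicate _≟_ L) (lat ∘ ∈-deduplicate⁻ _≟_ L) =
  l , Uniq.map⁻ (subst Unique (sym eq) (deduplicate-! L)) ,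
  (λ p → (λ p∈ → proj₂ (mem p) (∈-deduplicate⁻ _≟_ L (subst (φ p ∈_) eq (∈-map⁺ φ p∈)))) ,
         (λ Ap → case ∈-map⁻ φ (subst (φ p ∈_) (sym eq) (∈-deduplicate⁺ _≟_ (proj₁ (mem p) Ap))) of
           λ { (q , q∈ , e) → subst (_∈ l) (sym (φ-injective p q e)) q∈ })) ,
  trans (sym (length-map φ l)) (cong length eq)

rep-∂ : ∀ {A L} → Rep A L → Rep (∂ A) (bd L)
rep-∂ {A} {L} (lat , mem) = lat-bd , λ p → to p , from p
  where
  lat-bd : Lat (bd L)
  lat-bd p with q , _ ← ∈-∖⁻ (sq L) L p with u , v , _ , _ , us , ut , r , refl , refl ← ∈-sq⁻ L q =
    trans (par-unit u us) (trans (cong not (lat r)) (sym (par-unit v ut)))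
  to : ∀ p → ∂ A p → φ p ∈ bd L
  to p (p∉ , q , q∈ , adj) with s , t , us , ut , eq ← adj⇒ {p} {q} adj =
    ∈-∖⁺ (subst (_∈ sq L) (sym eq) (∈-sq⁺ us ut (proj₁ (mem q) q∈))) (p∉ ∘ proj₂ (mem p))
  from : ∀ p → φ p ∈ bd L → ∂ A p
  from p p∈ with q , n ← ∈-∖⁻ (sq L) L p∈ with u , v , s , t , us , ut , r , eu , ev ← ∈-sq⁻ L q
    with y , refl ← φ-surjective u v (lat r) =
    n ∘ proj₁ (mem p) , y , proj₂ (mem y) r , ⇒adj {p} {y} us ut (cong₂ _,_ eu ev)

size-rep : ∀ {A k} → HasSize A k → ∃ λ L → Rep A L × card L ≡ k
size-rep {A} {k} h@(l , u , mem , len) = map φ l , rep , size-unique (rep-size rep) h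
  where
  rep : Rep A (map φ l)
  rep = (λ p → case ∈-map⁻ φ p of λ { (q , _ , refl) → φ-lat q }) ,
    λ p → (λ Ap → ∈-map⁺ φ (proj₂ (mem p) Ap)) ,
          (λ p∈ → case ∈-map⁻ φ p∈ of λ { (q , q∈ , e) → subst A (φ-injective q p (sym e)) (proj₁ (mem q) q∈) })

-- Minimality as a numerical condition

card⇒∈ : ∀ L → 1 ℕ.≤ card L → ∃ λ z → z ∈ L
card⇒∈ (z ∷ L) _ = z , here refl

rep-refl : ∀ {L} → Lat L → Rep ⟦ L ⟧ L
rep-refl lat = lat , λ p → id , id

boundary-cancel-≤ : ∀ β β′ → sqr (β ℕ.∸ 3) ℕ.+ 4 ℕ.< sqr (β′ ℕ.∸ 2) ℕ.+ 4 → β ℕ.≤ β′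
boundary-cancel-≤ β β′ p = ℕP.≤-trans (m∸3<n⇒m≤2+n lt) (ℕP.≤-reflexive (ℕP.m+[n∸m]≡n 2≤β′))
  where
  lt : β ℕ.∸ 3 ℕ.< β′ ℕ.∸ 2
  lt = sqr-cancel-< p
  2≤β′ : 2 ℕ.≤ β′
  2≤β′ = ℕP.≮⇒≥ λ β′<2 → ℕP.<⇒≱ lt (ℕP.≤-trans (ℕP.≤-reflexive (ℕP.m≤n⇒m∸n≡0 (ℕP.<⇒≤ β′<2))) z≤n)

-- The competitor obeys `Iso` for its own boundary, while by `Good` the common size is too large for
-- any boundary below that of `L`.
good⇒least : ∀ L L′ → card L′ ≡ card L → 1 ℕ.≤ card L → Good L → card (bd L) ℕ.≤ card (bd L′)
good⇒least L L′ eq pos good = boundary-cancel-≤ (card (bd L)) (card (bd L′))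
  (ℕP.<-≤-trans good (ℕP.≤-trans (ℕP.≤-reflexive (cong (8 ℕ.*_) (sym eq))) iso))
  where
  iso : Iso L′
  iso = proj₁ (classify (proj₂ (card⇒∈ L′ (subst (1 ℕ.≤_) (sym eq) pos))))

good⇒minimal : ∀ {A L} → Rep A L → 1 ℕ.≤ card L → Good L → Minimal A
good⇒minimal {A} {L} rep pos good = card L , rep-size rep , pos , card (bd L) , rep-size (rep-∂ rep) , least
  where
  least : ∀ C m′ → HasSize C (card L) → HasSize (∂ C) m′ → card (bd L) ℕ.≤ m′
  least C m′ hC h∂ = let L′ , rep′ , eq = size-rep hC in
    ℕP.≤-trans (good⇒least L L′ eq pos good) (ℕP.≤-reflexive (size-unique (rep-size (rep-∂ rep′)) h∂))

grown : ∀ {L} → Immortal L → ℕ → Σ (List Pt) Immortal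
grown {L} im zero    = L , im
grown im (suc i) with z , _ , im′ ← grow (proj₂ (grown im i)) = z ∷ proj₁ (grown im i) , im′

grown-⊑ : ∀ {L} (im : Immortal L) i → proj₁ (grown im i) ⊑ proj₁ (grown im (suc i))
grown-⊑ im i = there

card-grown : ∀ {L} (im : Immortal L) i → card (proj₁ (grown im i)) ≡ card L ℕ.+ i
card-grown {L} im zero = sym (ℕP.+-identityʳ (card L))
card-grown {L} im (suc i) = trans (card-∷ (proj₁ (proj₂ (grow (proj₂ (grown im i))))))
  (trans (cong suc (card-grown im i)) (sym (ℕP.+-suc (card L) i)))

immortal-point : Immortal ((0ℤ , 0ℤ) ∷ [])
immortal-point = immortal {a = 0ℤ} {0ℤ} {1} {1} (λ { (here refl) → refl }) (record
  { inside = λ { (here refl) → within-first 0ℤ 0 , within-first 0ℤ 0 }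
  ; left = 0ℤ , here refl
  ; right = 0ℤ , 0ℤ , here refl , refl
  ; bottom = 0ℤ , here refl
  ; top = 0ℤ , 0ℤ , here refl , refl })
  (ℕP.m≤m+n 6 2) (ℕP.m≤m+n 9 7)

good-transfer : ∀ L L′ → card L ≡ card L′ → card (bd L′) ℕ.≤ card (bd L) → Good L → Good L′
good-transfer L L′ eq le good = ℕP.≤-<-trans (ℕP.+-monoˡ-≤ 4 (sqr-mono (ℕP.∸-monoˡ-≤ 3 le)))
  (ℕP.<-≤-trans good (ℕP.≤-reflexive (cong (8 ℕ.*_) eq)))

-- The set is compared with a good set of the same size, grown from a single point, whose 1 × 1 box
-- is as large as its sides allow.
minimal⇒good : ∀ {A L} → Rep A L → Minimal A → 1 ℕ.≤ card L × Good L
minimal⇒good {A} {L} rep (k , hA , pos , m , h∂ , least) =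
  ℕP.≤-trans pos (ℕP.≤-reflexive (sym k≡)) , good-transfer L₀ L card≡ β≤ (Immortal.good (proj₂ optimal))
  where
  k≡ : card L ≡ k
  k≡ = size-unique (rep-size rep) hA
  j : ∃ λ j → 1 ℕ.+ j ≡ k
  j = ℕP.m≤n⇒∃[o]m+o≡n pos
  optimal : Σ (List Pt) Immortal
  optimal = grown immortal-point (proj₁ j)
  L₀ : List Pt
  L₀ = proj₁ optimal
  rep₀ : Rep ⟦ L₀ ⟧ L₀
  rep₀ = rep-refl (Immortal.lat (proj₂ optimal))
  card₀ : card L₀ ≡ k
  card₀ = trans (card-grown immortal-point (proj₁ j)) (proj₂ j)
  card≡ : card L₀ ≡ card L
  card≡ = trans card₀ (sym k≡)
  β≤ : card (bd L) ℕ.≤ card (bd L₀)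
  β≤ = ℕP.≤-trans (ℕP.≤-reflexive (size-unique (rep-size (rep-∂ rep)) h∂))
    (least ⟦ L₀ ⟧ (card (bd L₀)) (subst (HasSize ⟦ L₀ ⟧) card₀ (rep-size rep₀)) (rep-size (rep-∂ rep₀)))

-- Enclosing boxes along chains and the dichotomy

extent : ∀ L {z} → z ∈ L → ∃₂ λ a P → (∀ {u v} → (u , v) ∈ L → Within a P u) ×
  (∃ λ v → (a , v) ∈ L) × (∃₂ λ u v → (u , v) ∈ L × u + 1ℤ ≡ a + + P)
extent L z∈ with argmin L z∈ | argmin (map (λ p → - proj₁ p , proj₂ p) L) (∈-map⁺ (λ p → - proj₁ p , proj₂ p) z∈)
... | (a , v) , a∈ , min | _ , b∈ , max with (b , v′) , b∈L , refl ← ∈-map⁻ (λ p → - proj₁ p , proj₂ p) b∈ with n , refl ← ≤⇒+ (min b∈L) =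
  a , suc n , (λ p → min p , ℤP.≤-trans (ℤP.+-monoˡ-≤ 1ℤ (ℤP.neg-cancel-≤ (max (∈-map⁺ (λ p → - proj₁ p , proj₂ p) p))))
    (ℤP.≤-reflexive (i a (+ n)))) , (v , a∈) , (a + + n , v′ , b∈L , i a (+ n))
  where
  i : ∀ a n → a + n + 1ℤ ≡ a + (1ℤ + n)
  i = solve-∀

enclose : ∀ L {z} → z ∈ L → ∃₂ λ a P → ∃₂ λ c Q → Enc L a P c Q
enclose L z∈ with a , P , ins , l , r ← extent L z∈ | c , Q , ins′ , (u , b) , (v , u′ , t , e) ← extent (sw L) (∈-sw⁺ z∈) =
  a , P , c , Q , record
    { inside = λ p → ins p , ins′ (∈-sw⁺ p)
    ; left = l
    ; right = r
    ; bottom = u , ∈-sw⁻ b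
    ; top = u′ , v , ∈-sw⁻ t , e }

enc-mono : ∀ {L L′ a P c Q a′ P′ c′ Q′} → L ⊑ L′ → Enc L a P c Q → Enc L′ a′ P′ c′ Q′ →
  P ℕ.≤ P′ × (P′ ℕ.≤ P → a′ ≡ a × P′ ≡ P)
enc-mono {a = a} {P} {a′ = a′} {P′} sub E E′ = P≤P′ , eq
  where
  lo : a′ ≤ a
  lo = proj₁ (proj₁ (Enc.inside E′ (sub (proj₂ (Enc.left E)))))
  hi : a + + P ≤ a′ + + P′
  hi = case Enc.right E of λ { (u , v , p , e) → subst (_≤ a′ + + P′) e (proj₂ (proj₁ (Enc.inside E′ (sub p)))) }
  i : ∀ a P a′ P′ → P′ + (a′ + (a + P)) ≡ P + (a + (a′ + P′)) + 0ℤ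
  i = solve-∀
  j : ∀ a P a′ → a′ + (a + P) ≡ a + (a′ + P) + 0ℤ
  j = solve-∀
  P≤P′ : P ℕ.≤ P′
  P≤P′ = ℤP.drop‿+≤+ (le₂ 0 lo hi (i a (+ P) a′ (+ P′)))
  eq : P′ ℕ.≤ P → a′ ≡ a × P′ ≡ P
  eq P′≤P with refl ← ℕP.≤-antisym P≤P′ P′≤P = ℤP.≤-antisym lo (le₁ 0 hi (j a (+ P) a′)) , refl

-- Neither side can shrink, so if the sum does not grow, both sides and hence the position of the
-- box are unchanged.
enclosed-within : ∀ {L L′ a P c Q a′ P′ c′ Q′} → L ⊑ L′ → Enc L a P c Q → Enc L′ a′ P′ c′ Q′ → P′ ℕ.+ Q′ ℕ.≤ P ℕ.+ Q →
  Enc L′ a P c Q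
enclosed-within {P = P} {Q = Q} {P′ = P′} {Q′ = Q′} sub E E′ le
  with P≤P′ , eqP ← enc-mono sub E E′ | Q≤Q′ , eqQ ← enc-mono (λ p → ∈-sw⁺ (sub (∈-sw⁻ p))) (Enc-sw E) (Enc-sw E′)
  with refl , refl ← eqP (ℕP.+-cancelʳ-≤ Q′ P′ P (ℕP.≤-trans le (ℕP.+-monoʳ-≤ P Q≤Q′)))
     | refl , refl ← eqQ (ℕP.+-cancelˡ-≤ P′ Q′ Q (ℕP.≤-trans le (ℕP.+-monoˡ-≤ Q P≤P′))) = E′

rep-⊑ : ∀ {A B L M} → A ⊆ B → Rep A L → Rep B M → L ⊑ M
rep-⊑ sub (lat , mem) (_ , mem′) {u , v} p with q , refl ← φ-surjective u v (lat p) = proj₁ (mem′ q) (sub q (proj₂ (mem q) p))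

-- As long as the size stays at most the maximum for the semiperimeter P + Q, the enclosing box cannot change.
chain-bound : ∀ {A L a P c Q} → Rep A L → Enc L a P c Q → 8 ℕ.* suc (vol a P c Q) ℕ.≤ sqr (P ℕ.+ Q) ℕ.+ 4 →
  ∀ n → Chain A n → card L ℕ.+ n ℕ.≤ vol a P c Q
chain-bound {A} {L} {a} {P} {c} {Q} rep E small n (k , hA , S , S0 , nest , mins) =
  ℕP.≮⇒≥ λ K<k+n → ℕP.<-irrefl refl (contra (subst (λ x → K ℕ.< x ℕ.+ n) k≡ K<k+n))
  where
  K : ℕ
  K = vol a P c Q
  k≡ : card L ≡ k
  k≡ = size-unique (rep-size rep) hA
  contra : K ℕ.< k ℕ.+ n → K ℕ.< K
  contra K<k+n = ℕP.≤-trans (ℕP.≤-reflexive (sym card≡)) (card≤vol Eᵢ (proj₁ repᵢ))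
    where
    -- The first index at which the chain has more points than the box, namely `suc K`.
    i : ℕ
    i = suc K ℕ.∸ k
    k+i : k ℕ.+ i ≡ suc K
    k+i = ℕP.m+[n∸m]≡n (ℕP.≤-trans (ℕP.≤-reflexive (sym k≡)) (ℕP.≤-trans (card≤vol E (proj₁ rep)) (ℕP.n≤1+n K)))
    i≤n : i ℕ.≤ n
    i≤n = ℕP.+-cancelˡ-≤ k i n (ℕP.≤-trans (ℕP.≤-reflexive k+i) K<k+n)
    nested : ∀ j → j ℕ.≤ n → A ⊆ S j
    nested zero    _   p Ap = subst (λ T → T p) (sym S0) Ap
    nested (suc j) j<n p Ap = nest j j<n p (nested j (ℕP.<⇒≤ j<n) p Ap)
    rᵢ : ∃ λ L′ → Rep (S i) L′ × card L′ ≡ k ℕ.+ i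
    rᵢ = size-rep (proj₂ (mins i i≤n))
    Lᵢ : List Pt
    Lᵢ = proj₁ rᵢ
    repᵢ : Rep (S i) Lᵢ
    repᵢ = proj₁ (proj₂ rᵢ)
    card≡ : card Lᵢ ≡ suc K
    card≡ = trans (proj₂ (proj₂ rᵢ)) k+i
    posgood : 1 ℕ.≤ card Lᵢ × Good Lᵢ
    posgood = minimal⇒good repᵢ (proj₁ (mins i i≤n))
    -- `suc K` points still fit the size bound for P + Q, so a minimal set of that size has at most
    -- P + Q + 2 boundary points; `width` then bounds its sides.
    β≤ : card (bd Lᵢ) ℕ.≤ 2 ℕ.+ (P ℕ.+ Q)
    β≤ = m∸3<n⇒m≤2+n (sqr-cancel-< (ℕP.<-≤-trans (proj₂ posgood)
      (ℕP.≤-trans (ℕP.≤-reflexive (cong (8 ℕ.*_) card≡)) small)))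
    e : ∃₂ λ a′ P′ → ∃₂ λ c′ Q′ → Enc Lᵢ a′ P′ c′ Q′
    e = enclose Lᵢ (proj₂ (card⇒∈ Lᵢ (proj₁ posgood)))
    E′ : Enc Lᵢ (proj₁ e) (proj₁ (proj₂ e)) (proj₁ (proj₂ (proj₂ e))) (proj₁ (proj₂ (proj₂ (proj₂ e))))
    E′ = proj₂ (proj₂ (proj₂ (proj₂ e)))
    Eᵢ : Enc Lᵢ a P c Q
    Eᵢ = enclosed-within (rep-⊑ (nested i i≤n) rep repᵢ) E E′
      (ℕP.≤-pred (ℕP.≤-pred (ℕP.≤-trans (width E′ (proj₁ repᵢ) (proj₂ posgood)) β≤)))

immortal-chain : ∀ {A L} → Rep A L → Immortal L → ∀ n → Chain A n
immortal-chain {A} {L} rep im n = card L , rep-size rep , S , refl , (λ i _ → nest i) , λ i _ →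
    good⇒minimal (repS i) (subst (1 ℕ.≤_) (sym (card-grown im i)) (ℕP.≤-trans pos (ℕP.m≤m+n _ i)))
      (Immortal.good (proj₂ (grown im i))) ,
    subst (HasSize (S i)) (card-grown im i) (rep-size (repS i))
  where
  pos : 1 ℕ.≤ card L
  pos = card-pos (proj₂ (Enc.left (Immortal.enc im)))
  S : ℕ → Subset
  -- `Chain` asks for an equality of predicates at 0, so `A` itself stands there instead of `⟦ L ⟧`.
  S zero    = A
  S (suc i) = ⟦ proj₁ (grown im (suc i)) ⟧
  repS : ∀ i → Rep (S i) (proj₁ (grown im i))
  repS zero    = rep
  repS (suc i) = rep-refl (Immortal.lat (proj₂ (grown im (suc i))))
  nest : ∀ i → S i ⊆ S (suc i)
  nest i p q = proj₂ (proj₂ (repS (suc i)) p) (grown-⊑ im i (proj₁ (proj₂ (repS i) p) q))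

-- Different quadruples can describe the same point set, since a side may contain no lattice point,
-- so the boxes are compared through their points. `least`, applied to the tight bounds, gives one
-- inclusion, and the points of `L` on the four sides give the other.
enc⇒box : ∀ {A L a P c Q} → Rep A L → Enc L a P c Q → ∀ {a′ b′ c′ d′} → IsEnc A a′ b′ c′ d′ →
  ∀ {F} → Enc F a P c Q → Lat F → Full F a P c Q → Rep (Box a′ b′ c′ d′) F
enc⇒box {A} {L} {a} {P} {c} {Q} (lat , mem) E {a′} {b′} {c′} {d′} (_ , A⊆ , least) {F} EF latF full = latF , λ p → to p , from p
  where
  open Enc E
  inBox : ∀ {u v} → (u , v) ∈ L → (a′ ≤ u × u ≤ b′) × (c′ ≤ v × v ≤ d′)
  inBox {u} {v} p with q , refl ← φ-surjective u v (lat p) = A⊆ q (proj₂ (mem q) p)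
  from : ∀ p → φ p ∈ F → Box a′ b′ c′ d′ p
  from p p∈ with (l , r) , (l′ , r′) ← Enc.inside EF p∈ | _ , pₗ ← left | _ , _ , pᵣ , eᵣ ← right | _ , pb ← bottom | _ , _ , pt , et ← top =
    (ℤP.≤-trans (proj₁ (proj₁ (inBox pₗ))) l , ℤP.≤-trans (≤-last r eᵣ) (proj₂ (proj₁ (inBox pᵣ)))) ,
    (ℤP.≤-trans (proj₁ (proj₂ (inBox pb))) l′ , ℤP.≤-trans (≤-last r′ et) (proj₂ (proj₂ (inBox pt))))
  -- The last place of a half-open range, because `Box` has closed bounds.
  B : ℤ → ℕ → ℤ
  B a P = a + + P + -1ℤ
  i : ∀ u x → x + -1ℤ + (u + 1ℤ) ≡ u + x + 0ℤ
  i = solve-∀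
  j : ∀ u x → x + u ≡ u + 1ℤ + (x + -1ℤ) + 0ℤ
  j = solve-∀
  sub : A ⊆ Box a (B a P) c (B c Q)
  sub p Ap with (l , r) , (l′ , r′) ← inside (proj₁ (mem p) Ap) = (l , le₁ 0 r (i (proj₁ (φ p)) (a + + P))) , (l′ , le₁ 0 r′ (i (proj₂ (φ p)) (c + + Q)))
  nonempty : NonEmpty (Box a (B a P) c (B c Q))
  nonempty with v , pₗ ← left with q , refl ← φ-surjective a v (lat pₗ) = q , sub q (proj₂ (mem q) pₗ)
  to : ∀ p → Box a′ b′ c′ d′ p → φ p ∈ F
  to p q with (l , r) , (l′ , r′) ← least a (B a P) c (B c Q) sub nonempty p q =
    full (φ-lat p) (l , le₁ 0 r (j (proj₁ (φ p)) (a + + P))) (l′ , le₁ 0 r′ (j (proj₂ (φ p)) (c + + Q)))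

-- `A` and its box have the same enclosing box, and the case distinction depends on that box alone.
-- If it is as large as possible, both sets grow forever. Otherwise `chain-bound` limits the chains
-- of `A` by the volume, and those of the box to length 0, as the box already has that many points.
dichotomy : ∀ {A B L F a P c Q} → Minimal A → Rep A L → Enc L a P c Q → Good L →
  Rep B F → Enc F a P c Q → Good F → Full F a P c Q → (Mortal A → Dead B) × (Dead B → Mortal A)
dichotomy {A} {B} {L} {F} {a} {P} {c} {Q} minA rep E good repF EF goodF full
  with sqr (P ℕ.+ Q) ℕ.+ 4 ℕ.<? 8 ℕ.* suc (vol a P c Q)
... | yes big =
  (λ (_ , N , bound) → ⊥-elim (ℕP.1+n≰n (bound (suc N) (immortal-chain rep (immortal (proj₁ rep) E good big) (suc N))))) ,
  (λ (_ , dead) → ⊥-elim (ℕP.1+n≢0 (dead 1 (immortal-chain repF (immortal (proj₁ repF) EF goodF big) 1))))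
... | no small =
  (λ _ → good⇒minimal repF (card-pos (proj₂ (Enc.left EF))) goodF , λ n ch → ℕP.n≤0⇒n≡0 (ℕP.+-cancelˡ-≤ (card F) n 0
    (ℕP.≤-trans (chain-bound repF EF (ℕP.≮⇒≥ small) n ch) (ℕP.≤-trans vol≤ (ℕP.m≤m+n (card F) 0))))) ,
  (λ _ → minA , vol a P c Q , λ n ch → ℕP.≤-trans (ℕP.m≤n+m n (card L)) (chain-bound rep E (ℕP.≮⇒≥ small) n ch))
  where
  vol≤ : vol a P c Q ℕ.≤ card F
  vol≤ = ≤-card (box-unique a P c Q) λ p → case ∈-box⁻ {P = P} p of λ (e , w , w′) → full e w w′

theorem8p6 : (A : Subset) → Minimal A → (a b c d : ℤ) → IsEnc A a b c d →
    (Mortal A → Dead (Box a b c d)) × (Dead (Box a b c d) → Mortal A)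
theorem8p6 A minA a b c d isEnc =
  let L , rep , _ = size-rep (proj₁ (proj₂ minA))
      pos , good = minimal⇒good rep minA
      a′ , P , c′ , Q , E = enclose L (proj₂ (card⇒∈ L pos))
      F , _ , latF , EF , goodF , full = fill-box (vol a′ P c′ Q) (proj₁ rep) E good (ℕP.m≤m+n _ (card L))
  in dichotomy minA rep E good (enc⇒box rep E isEnc EF latF full) EF goodF full
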